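{- Let $\Lambda$ be a lattice with an automorphism $F=1+D$ satisfying $\Lambda[D]=\Lambda[D^2]$, and let $(\cdot,\cdot)$ be a non-degenerate symmetric $F$-invariant $\mathbb{Q}$-valued pairing on $V=\Lambda\otimes\mathbb{Q}$ with $\Lambda^\vee\subseteq\Lambda$. Write the characteristic polynomial of $F$ on $\Lambda$ as $\pm(t-1)^rp(t)$ with $p(1)>0$. Then for all positive integers $e,f$, up to multiplication by squares of nonzero rationals, $$\left|\left(\Lambda/e\Lambda^\vee\right)^{F^f}\right|\sim\begin{cases}\left|\frac{\Lambda^F}{(\Lambda^{\vee})^F}\right|\cdot\frac{p(1)}{|\mathfrak{B}_{\Lambda,\Lambda^\vee}|\cdot|\mathcal{T}_D(\Lambda)|}\cdot e^r&\text{if }2\nmid e,\ 2\nmid f,\\ \left|\frac{\Lambda^F}{(\Lambda^{\vee})^F}\right|\cdot\frac{p(1)}{|\mathcal{T}_D(\Lambda)|}\cdot e^r&\text{if }2\mid e,\ 2\nmid f,\\ \left|\Lambda/\Lambda^\vee\right|\cdot e^{\mathrm{rk}\,\Lambda}&\text{if }2\mid f.\end{cases}$$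
   Context: $V[D]=\ker D$ on $V$, and $V=DV\oplus V[D]$. $\Lambda^\vee=\{v\in V:(v,\lambda)\in\mathbb{Z}\ \forall\lambda\in\Lambda\}$. $\mathcal{T}_D(\Lambda)=\Lambda/\big((\Lambda\cap DV)+(\Lambda\cap V[D])\big)$ and $\mathfrak{B}_{\Lambda,\Lambda^\vee}=\dfrac{\Lambda+D^{ -1}\Lambda^\vee}{\Lambda+V[D]}$ with $D^{ -1}\Lambda^\vee=\{v\in V:Dv\in\Lambda^\vee\}$. Superscript $F$ denotes fixed points. -}

module Defs where

open import Level using (0ℓ)
open import Data.Nat as ℕ using (ℕ; zero; suc)
open import Data.Integer as ℤ using (ℤ; +_)
open import Data.Rational as ℚ using (ℚ; 0ℚ; 1ℚ)
open import Data.Fin using (Fin; zero; suc; toℕ; punchIn; _≟_)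
open import Data.List using (List; []; _∷_)
open import Data.Product using (Σ; ∃; _×_; _,_)
open import Relation.Nullary using (¬_; yes; no)
open import Relation.Binary.PropositionalEquality using (_≡_)

-- Lattice Λ = ℤⁿ inside V = Λ ⊗ ℚ = ℚⁿ (after choosing a ℤ-basis of Λ)

V : ℕ → Set
V n = Fin n → ℚ

IMat : ℕ → Set
IMat n = Fin n → Fin n → ℤ

QMat : ℕ → Set
QMat n = Fin n → Fin n → ℚ

Pred : Set → Set₁
Pred A = A → Set

Σℚ : ∀ {n} → (Fin n → ℚ) → ℚ
Σℚ {zero}  f = 0ℚ
Σℚ {suc n} f = f zero ℚ.+ Σℚ (λ i → f (suc i))

Σℤ : ∀ {n} → (Fin n → ℤ) → ℤ
Σℤ {zero}  f = + 0
Σℤ {suc n} f = f zero ℤ.+ Σℤ (λ i → f (suc i))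

toℚ : ℤ → ℚ
toℚ z = z ℚ./ 1

IsInt : ℚ → Set
IsInt q = ∃ λ (z : ℤ) → q ≡ toℚ z

_≋_ : ∀ {n} → V n → V n → Set
u ≋ v = ∀ i → u i ≡ v i

0V : ∀ {n} → V n
0V _ = 0ℚ

_+V_ : ∀ {n} → V n → V n → V n
(u +V v) i = u i ℚ.+ v i

_-V_ : ∀ {n} → V n → V n → V n
(u -V v) i = u i ℚ.- v i

_·V_ : ∀ {n} → ℚ → V n → V n
(c ·V v) i = c ℚ.* v i

Λ : ∀ {n} → Pred (V n)
Λ v = ∀ i → IsInt (v i)

act : ∀ {n} → IMat n → V n → V n
act M v i = Σℚ (λ j → toℚ (M i j) ℚ.* v j)

actPow : ∀ {n} → IMat n → ℕ → V n → V n
actPow M zero    v = v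
actPow M (suc k) v = act M (actPow M k v)

actD : ∀ {n} → IMat n → V n → V n
actD F v = act F v -V v

idI : ∀ {n} → IMat n
idI i j with i ≟ j
... | yes _ = + 1
... | no  _ = + 0

_*I_ : ∀ {n} → IMat n → IMat n → IMat n
(M *I N) i k = Σℤ (λ j → M i j ℤ.* N j k)

IsAut : ∀ {n} → IMat n → Set
IsAut {n} F = Σ (IMat n) λ G → (∀ i j → (F *I G) i j ≡ idI i j) × (∀ i j → (G *I F) i j ≡ idI i j)

KerDEqKerD² : ∀ {n} → IMat n → Set
KerDEqKerD² {n} F = ∀ (x : V n) → Λ x →
  ((actD F x ≋ 0V → actD F (actD F x) ≋ 0V) × (actD F (actD F x) ≋ 0V → actD F x ≋ 0V))

pair : ∀ {n} → QMat n → V n → V n → ℚ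
pair B v w = Σℚ (λ i → Σℚ (λ j → v i ℚ.* (B i j ℚ.* w j)))

SymmetricForm : ∀ {n} → QMat n → Set
SymmetricForm {n} B = ∀ (v w : V n) → pair B v w ≡ pair B w v

NonDegenerate : ∀ {n} → QMat n → Set
NonDegenerate {n} B = ∀ (v : V n) → (∀ (w : V n) → pair B v w ≡ 0ℚ) → v ≋ 0V

FInvariant : ∀ {n} → IMat n → QMat n → Set
FInvariant {n} F B = ∀ (v w : V n) → pair B (act F v) (act F w) ≡ pair B v w

Λdual : ∀ {n} → QMat n → Pred (V n)
Λdual {n} B v = ∀ (l : V n) → Λ l → IsInt (pair B v l)

-- Cardinality of a quotient A/B of subsets of V (B ⊆ A subgroups):
-- a complete set of k pairwise inequivalent coset representatives.

HasCard : ∀ {n} → Pred (V n) → Pred (V n) → ℕ → Set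
HasCard {n} A B k = Σ (Fin k → V n) λ rep →
  (∀ i → A (rep i)) ×
  (∀ v → A v → ∃ λ i → B (v -V rep i)) ×
  (∀ v i j → B (v -V rep i) → B (v -V rep j) → i ≡ j)

scaledDual : ∀ {n} → QMat n → ℕ → Pred (V n)
scaledDual {n} B e v = ∃ λ (w : V n) → Λdual B w × v ≋ ((toℚ (+ e)) ·V w)

-- preimage in Λ of (Λ / eΛ^∨)^{F^f}
fixedModDual : ∀ {n} → IMat n → QMat n → ℕ → ℕ → Pred (V n)
fixedModDual F B e f v = Λ v × scaledDual B e (actPow F f v -V v)

ΛF : ∀ {n} → IMat n → Pred (V n)
ΛF F v = Λ v × act F v ≋ v

ΛdualF : ∀ {n} → IMat n → QMat n → Pred (V n)
ΛdualF F B v = Λdual B v × act F v ≋ v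

ΛplusDinvDual : ∀ {n} → IMat n → QMat n → Pred (V n)
ΛplusDinvDual {n} F B v = ∃ λ (a : V n) → ∃ λ (b : V n) →
  Λ a × Λdual B (actD F b) × v ≋ (a +V b)

ΛplusKerD : ∀ {n} → IMat n → Pred (V n)
ΛplusKerD {n} F v = ∃ λ (a : V n) → ∃ λ (c : V n) →
  Λ a × actD F c ≋ 0V × v ≋ (a +V c)

TDsub : ∀ {n} → IMat n → Pred (V n)
TDsub {n} F v = ∃ λ (a : V n) → ∃ λ (b : V n) →
  (Λ a × ∃ (λ (u : V n) → a ≋ actD F u)) × (Λ b × actD F b ≋ 0V) × v ≋ (a +V b)

-- Integer polynomials (coefficient lists, constant term first)

Poly : Set
Poly = List ℤ

_+P_ : Poly → Poly → Poly
[] +P q = q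
(a ∷ p) +P [] = a ∷ p
(a ∷ p) +P (b ∷ q) = (a ℤ.+ b) ∷ (p +P q)

scaleP : ℤ → Poly → Poly
scaleP c [] = []
scaleP c (a ∷ p) = (c ℤ.* a) ∷ scaleP c p

_*P_ : Poly → Poly → Poly
[] *P q = []
(a ∷ p) *P q = scaleP a q +P (+ 0 ∷ (p *P q))

negP : Poly → Poly
negP = scaleP (ℤ.- (+ 1))

constP : ℤ → Poly
constP c = c ∷ []

XP : Poly
XP = + 0 ∷ + 1 ∷ []

_^P_ : Poly → ℕ → Poly
p ^P zero = constP (+ 1)
p ^P suc k = p *P (p ^P k)

coeff : Poly → ℕ → ℤ
coeff [] k = + 0
coeff (a ∷ p) zero = a
coeff (a ∷ p) (suc k) = coeff p k

_≈P_ : Poly → Poly → Set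
p ≈P q = ∀ k → coeff p k ≡ coeff q k

evalP : Poly → ℤ → ℤ
evalP [] x = + 0
evalP (a ∷ p) x = a ℤ.+ x ℤ.* evalP p x

ΣP : ∀ {n} → (Fin n → Poly) → Poly
ΣP {zero} f = []
ΣP {suc n} f = f zero +P ΣP (λ i → f (suc i))

signP : ℕ → Poly → Poly
signP k p with k ℕ.% 2
... | zero = p
... | suc _ = negP p

detP : ∀ {n} → (Fin n → Fin n → Poly) → Poly
detP {zero} M = constP (+ 1)
detP {suc n} M = ΣP (λ j → signP (toℕ j)
  (M zero j *P detP (λ r c → M (suc r) (punchIn j c))))

charPoly : ∀ {n} → IMat n → Poly
charPoly {n} F = detP (λ i j → (XP *P constP (idI i j)) +P negP (constP (F i j)))

SqEquiv : ℚ → ℚ → Set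
SqEquiv a b = ∃ λ (q : ℚ) → ¬ (q ≡ 0ℚ) × a ≡ b ℚ.* (q ℚ.* q)

ℕtoℚ : ℕ → ℚ
ℕtoℚ k = toℚ (+ k)

{-# OPTIONS --safe #-}
module Submission where

open import Defs
open import Data.Nat using (ℕ; _^_; _>_)
open import Data.Nat.Divisibility using (_∣_)
open import Data.Integer as ℤ using (ℤ; +_; -[1+_])
open import Data.Rational as ℚ using (ℚ)
open import Data.Product using (_×_)
open import Data.Sum using (_⊎_)
open import Relation.Nullary using (¬_)
open import Relation.Binary.PropositionalEquality using (_≡_)
open import Data.Empty using (⊥; ⊥-elim)
open import Data.Fin as Fin using (Fin; zero; suc; toℕ; punchIn; punchOut; inject₁)
import Data.Fin.Properties as FinP
open import Data.Integer using (∣_∣)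
import Data.Integer.Divisibility.Signed as ℤDS
import Data.Integer.DivMod as ℤDM
import Data.Integer.Properties as ℤP
import Data.Integer.Solver
open import Data.List using ([]; _∷_)
open import Data.List.Relation.Unary.All using (All; []; _∷_)
open import Data.Nat as ℕ using (zero; suc; _!)
open import Data.Nat.Coprimality using (Coprime; coprime-Bézout; prime⇒coprime)
import Data.Nat.Divisibility as ℕD
open import Data.Nat.Divisibility using (divides)
import Data.Nat.DivMod as ℕDM
open import Data.Nat.GCD using (module Bézout)
open import Data.Nat.Induction using (<-wellFounded)
open import Data.Nat.ListAction using (product)
open import Data.Nat.Primality using (Prime; prime⇒nonZero; prime⇒nonTrivial)
open import Data.Nat.Primality.Factorisation using (factorise; PrimeFactorisation)
import Data.Nat.Properties as ℕP
import Data.Nat.Solver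
open import Data.Product using (Σ; ∃; _,_; proj₁; proj₂)
open import Data.Rational using (0ℚ; 1ℚ)
import Data.Rational.Properties as ℚP
import Data.Rational.Solver
import Data.Rational.Unnormalised as ℚᵘ
import Data.Rational.Unnormalised.Properties as ℚᵘP
open import Data.Sum using (inj₁; inj₂; [_,_]′)
open import Data.Unit using (⊤; tt)
open import Induction.WellFounded using (Acc; acc)
open import Relation.Binary.Definitions using (Tri; tri<; tri≈; tri>)
open import Relation.Binary.PropositionalEquality using (_≢_; refl; sym; trans; cong; cong₂; subst; subst₂; module ≡-Reasoning)
open import Relation.Nullary using (Dec; yes; no)

-- Write M = Λ/eΛ∨. An operator Y of Λ and an automorphism S with (Yx, Sx) = 0
-- make (Yx, Sy)/e an alternating ℚ/ℤ-valued form on Λ with radical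
-- {x : Yx ∈ eΛ∨}, and the order of a finite group carrying a nondegenerate
-- alternating form is a square: dividing x^⊥ by an element x of prime order p
-- divides the order by p². For f = 2g take Y = F^f - 1, S = F^g. For f = 2g + 1,
-- F^f - 1 = D(1 + (F+1)Θ), so the index of M^F in M^(F^f) is that of ker (F²-1)
-- in ker (F+1)(F^f-1), which is a quotient of two squares of the above kind;
-- this reduces to f = 1.
--
-- For f = 1 the formula becomes exact: with Q_e = [D⁻¹Λ∨ : {u : eu ∈ Λ + ker D}],
--   |M^F| · |T_D(Λ)| · Q_e = e^r · |Λ^F/(Λ∨)^F| · p(1).
-- It follows by counting indices between Λ + ker D, Λ∨ + ker D, D⁻¹Λ and D⁻¹Λ∨,
-- from the finite duality [D⁻¹Λ : D⁻¹Λ∨] = [Λ + ker D : Λ∨ + ker D], and from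
-- p(1) = [Λ : DΛ + ker D], read off from det(m - D) = ± m^r p(1 + m) modulo a
-- large m. Finally Q_1 = |𝔅|, Q_{2e} is a square because 2e(v, Dv) = -e(Dv, Dv),
-- and for odd e the e-torsion gives Q_1/Q_e = Q_2/Q_{2e}.

-- Everything is constructive: an index is a list of coset representatives, so splitting a tower A ⊇
-- B ⊇ C needs a membership test for the middle group. The obstacle is the test for Λ + ker D, whose
-- splitting ranges over all of ℚⁿ; it comes from finiteness of D⁻¹Λ / (Λ + ker D), and most other
-- tests reduce to it and to integrality of a rational. For the same reason a radical carries
-- witnesses of non-membership, and finite groups are taken apart by one element of prime order at a
-- time.
--
-- The number Q_e arises thus. Put J = [D⁻¹Λ : Λ + ker D]; D turns it into [Λ ∩ DV : DΛ], so p(1) =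
-- |T_D(Λ)| · J, and duality gives [D⁻¹Λ∨ : Λ∨ + ker D] = J as well. The preimage {v ∈ Λ : Dv ∈ eΛ∨}
-- of M^F contains Λ^F + eΛ∨; dividing by e identifies the quotient with {u ∈ D⁻¹Λ∨ : eu ∈ Λ + ker
-- D} / (Λ∨ + ker D), of order J / Q_e. The remaining factor (Λ^F + eΛ∨)/eΛ∨ = Λ^F / e(Λ∨)^F
-- supplies e^r · |Λ^F/(Λ∨)^F|.

module ℕS = Data.Nat.Solver.+-*-Solver
module ℤS = Data.Integer.Solver.+-*-Solver

-- Ring identities in ℚ

module ℚ-Identities where
  open Data.Rational.Solver.+-*-Solver

  x-0≡x : ∀ x → x ℚ.- 0ℚ ≡ x
  x-0≡x = solve 1 (λ x → x :- con 0ℚ := x) refl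

  0-0x : ∀ x → 0ℚ ≡ 0ℚ ℚ.- 0ℚ ℚ.* x
  0-0x = solve 1 (λ x → con 0ℚ := con 0ℚ :- con 0ℚ :* x) refl

  v-0x : ∀ v x → v ≡ v ℚ.- 0ℚ ℚ.* x
  v-0x = solve 2 (λ v x → v := v :- con 0ℚ :* x) refl

  bézout-+- : ∀ y n → (ℚ.- y) ℚ.* n ℚ.+ (1ℚ ℚ.+ y ℚ.* n) ≡ 1ℚ
  bézout-+- = solve 2 (λ y n → (:- y) :* n :+ (con 1ℚ :+ y :* n) := con 1ℚ) refl

  bézout-combine : ∀ u n w p x → u ℚ.* (n ℚ.* x) ℚ.+ w ℚ.* (p ℚ.* x) ≡ (u ℚ.* n ℚ.+ w ℚ.* p) ℚ.* x
  bézout-combine = solve 5 (λ u n w p x → u :* (n :* x) :+ w :* (p :* x) := (u :* n :+ w :* p) :* x) refl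

  shift-sub : ∀ u z v w x → (u ℚ.- z ℚ.* x) ℚ.- (v ℚ.- w ℚ.* x) ≡ (u ℚ.- v) ℚ.- (z ℚ.- w) ℚ.* x
  shift-sub = solve 5 (λ u z v w x → (u :- z :* x) :- (v :- w :* x) := (u :- v) :- (z :- w) :* x) refl

  shift-mod : ∀ v r d p x → (v ℚ.- (r ℚ.+ d ℚ.* p) ℚ.* x) ℚ.+ d ℚ.* (p ℚ.* x) ≡ v ℚ.- r ℚ.* x
  shift-mod = solve 5 (λ v r d p x → (v :- (r :+ d :* p) :* x) :+ d :* (p :* x) := v :- r :* x) refl

  factor-sub : ∀ a b y → a ℚ.* y ℚ.- b ℚ.* y ≡ (a ℚ.- b) ℚ.* y
  factor-sub = solve 3 (λ a b y → a :* y :- b :* y := (a :- b) :* y) refl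

  decompose-identity : ∀ vy t xy a v0 x0 → vy ℚ.- t ℚ.* xy ≡ a ℚ.* (v0 ℚ.- t ℚ.* x0) ℚ.+ ((vy ℚ.- a ℚ.* v0) ℚ.- t ℚ.* (xy ℚ.- a ℚ.* x0))
  decompose-identity = solve 6 (λ vy t xy a v0 x0 → vy :- t :* xy := a :* (v0 :- t :* x0) :+ ((vy :- a :* v0) :- t :* (xy :- a :* x0))) refl

  skew-identity : ∀ uu vv uv vu → (uu ℚ.+ (vv ℚ.- ((uu ℚ.- uv) ℚ.- (vu ℚ.- vv)))) ℚ.- uv ≡ vu
  skew-identity = solve 4 (λ uu vv uv vu → (uu :+ (vv :- ((uu :- uv) :- (vu :- vv)))) :- uv := vu) refl

  -1*x≡-x : ∀ x → (ℚ.- 1ℚ) ℚ.* x ≡ ℚ.- x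
  -1*x≡-x = solve 1 (λ x → (:- con 1ℚ) :* x := :- x) refl

  x-[0-y]≡x+y : ∀ x y → x ℚ.- (0ℚ ℚ.- y) ≡ x ℚ.+ y
  x-[0-y]≡x+y = solve 2 (λ x y → x :- (con 0ℚ :- y) := x :+ y) refl

  0-[x-y]≡y-x : ∀ x y → 0ℚ ℚ.- (x ℚ.- y) ≡ y ℚ.- x
  0-[x-y]≡y-x = solve 2 (λ x y → con 0ℚ :- (x :- y) := y :- x) refl

  [x-y]+[y-z]≡x-z : ∀ x y z → (x ℚ.- y) ℚ.+ (y ℚ.- z) ≡ x ℚ.- z
  [x-y]+[y-z]≡x-z = solve 3 (λ x y z → (x :- y) :+ (y :- z) := x :- z) refl

  [1+x]y≡y+xy : ∀ x y → (1ℚ ℚ.+ x) ℚ.* y ≡ y ℚ.+ x ℚ.* y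
  [1+x]y≡y+xy = solve 2 (λ x y → (con 1ℚ :+ x) :* y := y :+ x :* y) refl

  0-xy≡[-x]y : ∀ x y → 0ℚ ℚ.- x ℚ.* y ≡ (ℚ.- x) ℚ.* y
  0-xy≡[-x]y = solve 2 (λ x y → con 0ℚ :- x :* y := (:- x) :* y) refl

  [x-y]+y≡x : ∀ x y → (x ℚ.- y) ℚ.+ y ≡ x
  [x-y]+y≡x = solve 2 (λ x y → (x :- y) :+ y := x) refl

  [x+y]-y≡x : ∀ x y → (x ℚ.+ y) ℚ.- y ≡ x
  [x+y]-y≡x = solve 2 (λ x y → (x :+ y) :- y := x) refl

  [x-y]-z≡x-[y+z] : ∀ x y z → (x ℚ.- y) ℚ.- z ≡ x ℚ.- (y ℚ.+ z)
  [x-y]-z≡x-[y+z] = solve 3 (λ x y z → (x :- y) :- z := x :- (y :+ z)) refl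

  x-[x-y]≡y : ∀ x y → x ℚ.- (x ℚ.- y) ≡ y
  x-[x-y]≡y = solve 2 (λ x y → x :- (x :- y) := y) refl

  -- With P prime, R the residue of P·q₀ modulo P and uR + wP = 1, this exhibits q - a·u·q₀ as the
  -- integer a·w - a·u·k; the common factor P is left to be cancelled.
  fraction-identity : ∀ P q a u q₀ R k w → P ℚ.* q ≡ a → P ℚ.* q₀ ≡ R ℚ.+ k ℚ.* P → u ℚ.* R ℚ.+ w ℚ.* P ≡ 1ℚ →
    P ℚ.* (q ℚ.- a ℚ.* u ℚ.* q₀) ≡ P ℚ.* (a ℚ.* w ℚ.- a ℚ.* (u ℚ.* k))
  fraction-identity P q a u q₀ R k w e e₀ bz = begin
      P ℚ.* (q ℚ.- a ℚ.* u ℚ.* q₀) ≡⟨ solve 5 (λ P q a u q₀ → P :* (q :- a :* u :* q₀) := P :* q :- a :* u :* (P :* q₀)) refl P q a u q₀ ⟩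
      P ℚ.* q ℚ.- a ℚ.* u ℚ.* (P ℚ.* q₀) ≡⟨ cong₂ (λ y z → y ℚ.- a ℚ.* u ℚ.* z) (trans e (trans (sym (ℚP.*-identityʳ a)) (cong (a ℚ.*_) (sym bz)))) e₀ ⟩
      a ℚ.* (u ℚ.* R ℚ.+ w ℚ.* P) ℚ.- a ℚ.* u ℚ.* (R ℚ.+ k ℚ.* P) ≡⟨ solve 6 (λ a u R k P w → a :* (u :* R :+ w :* P) :- a :* u :* (R :+ k :* P) := P :* (a :* w :- a :* (u :* k))) refl a u R k P w ⟩
      P ℚ.* (a ℚ.* w ℚ.- a ℚ.* (u ℚ.* k)) ∎
    where open ≡-Reasoning

  interchange-+ : ∀ a b c d → (a ℚ.+ b) ℚ.+ (c ℚ.+ d) ≡ (a ℚ.+ c) ℚ.+ (b ℚ.+ d)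
  interchange-+ = solve 4 (λ a b c d → (a :+ b) :+ (c :+ d) := (a :+ c) :+ (b :+ d)) refl

  interchange-- : ∀ a b c d → (a ℚ.- b) ℚ.+ (c ℚ.- d) ≡ (a ℚ.+ c) ℚ.- (b ℚ.+ d)
  interchange-- = solve 4 (λ a b c d → (a :- b) :+ (c :- d) := (a :+ c) :- (b :+ d)) refl

  [a+b]-[c+d] : ∀ a b c d → (a ℚ.+ b) ℚ.- (c ℚ.+ d) ≡ (a ℚ.- c) ℚ.+ (b ℚ.- d)
  [a+b]-[c+d] = solve 4 (λ a b c d → (a :+ b) :- (c :+ d) := (a :- c) :+ (b :- d)) refl

  [a-b]-[c-d] : ∀ a b c d → (a ℚ.- b) ℚ.- (c ℚ.- d) ≡ (a ℚ.- c) ℚ.- (b ℚ.- d)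
  [a-b]-[c-d] = solve 4 (λ a b c d → (a :- b) :- (c :- d) := (a :- c) :- (b :- d)) refl

  distribˡ-- : ∀ c a b → c ℚ.* (a ℚ.- b) ≡ c ℚ.* a ℚ.- c ℚ.* b
  distribˡ-- = solve 3 (λ c a b → c :* (a :- b) := c :* a :- c :* b) refl

  x*[y*z]≡y*[x*z] : ∀ x y z → x ℚ.* (y ℚ.* z) ≡ y ℚ.* (x ℚ.* z)
  x*[y*z]≡y*[x*z] = solve 3 (λ x y z → x :* (y :* z) := y :* (x :* z)) refl

  [x*y]*z≡z*[x*y] : ∀ x y z → x ℚ.* (y ℚ.* z) ≡ z ℚ.* (x ℚ.* y)
  [x*y]*z≡z*[x*y] = solve 3 (λ x y z → x :* (y :* z) := z :* (x :* y)) refl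

  D-square-identity : ∀ a b c → (a ℚ.- b) ℚ.- (b ℚ.- c) ≡ (ℚ.- 1ℚ) ℚ.* ((b ℚ.- c) ℚ.+ (b ℚ.- a))
  D-square-identity = solve 3 (λ a b c → (a :- b) :- (b :- c) := (:- con 1ℚ) :* ((b :- c) :+ (b :- a))) refl

  x-y≡-[y-x] : ∀ x y → x ℚ.- y ≡ (ℚ.- 1ℚ) ℚ.* (y ℚ.- x)
  x-y≡-[y-x] = solve 2 (λ x y → x :- y := (:- con 1ℚ) :* (y :- x)) refl

  double : ∀ x → x ℚ.+ x ≡ (1ℚ ℚ.+ 1ℚ) ℚ.* x
  double = solve 1 (λ x → x :+ x := (con 1ℚ :+ con 1ℚ) :* x) refl

  [x+y]-x≡y : ∀ x y → (x ℚ.+ y) ℚ.- x ≡ y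
  [x+y]-x≡y = solve 2 (λ x y → (x :+ y) :- x := y) refl

  a+c-r : ∀ a c r → (a ℚ.+ c) ℚ.- r ≡ (a ℚ.- r) ℚ.+ c
  a+c-r = solve 3 (λ a c r → (a :+ c) :- r := (a :- r) :+ c) refl

  a+c≡[a-r]+[r+c] : ∀ a c r → a ℚ.+ c ≡ (a ℚ.- r) ℚ.+ (r ℚ.+ c)
  a+c≡[a-r]+[r+c] = solve 3 (λ a c r → a :+ c := (a :- r) :+ (r :+ c)) refl

  cross-diff : ∀ a c a′ c′ → a ℚ.+ c ≡ a′ ℚ.+ c′ → a ℚ.- a′ ≡ c′ ℚ.- c
  cross-diff a c a′ c′ e = trans (solve 3 (λ a c a′ → a :- a′ := (a :+ c) :- (a′ :+ c)) refl a c a′)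
    (trans (cong (λ t → t ℚ.- (a′ ℚ.+ c)) e) (solve 3 (λ a′ c c′ → (a′ :+ c′) :- (a′ :+ c) := c′ :- c) refl a′ c c′))

  peel : ∀ a a′ r → a ℚ.- r ≡ ((a ℚ.- a′) ℚ.- r) ℚ.+ a′
  peel = solve 3 (λ a a′ r → a :- r := ((a :- a′) :- r) :+ a′) refl

  neg-neg : ∀ x → (ℚ.- 1ℚ) ℚ.* ((ℚ.- 1ℚ) ℚ.* x) ≡ x
  neg-neg = solve 1 (λ x → (:- con 1ℚ) :* ((:- con 1ℚ) :* x) := x) refl

  two-e-identity : ∀ e x → (ℚ.- 1ℚ) ℚ.* (e ℚ.* ((ℚ.- 1ℚ) ℚ.* ((1ℚ ℚ.+ 1ℚ) ℚ.* x))) ≡ ((1ℚ ℚ.+ 1ℚ) ℚ.* e) ℚ.* x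
  two-e-identity = solve 2 (λ e x → (:- con 1ℚ) :* (e :* ((:- con 1ℚ) :* ((con 1ℚ :+ con 1ℚ) :* x))) := ((con 1ℚ :+ con 1ℚ) :* e) :* x) refl

  odd-combine : ∀ q x → (1ℚ ℚ.+ q ℚ.* (1ℚ ℚ.+ 1ℚ)) ℚ.* x ℚ.- q ℚ.* ((1ℚ ℚ.+ 1ℚ) ℚ.* x) ≡ x
  odd-combine = solve 2 (λ q x → (con 1ℚ :+ q :* (con 1ℚ :+ con 1ℚ)) :* x :- q :* ((con 1ℚ :+ con 1ℚ) :* x) := x) refl

  odd-halve : ∀ q e x → e ≡ 1ℚ ℚ.+ q ℚ.* (1ℚ ℚ.+ 1ℚ) → (1ℚ ℚ.+ q) ℚ.* (((1ℚ ℚ.+ 1ℚ) ℚ.* e) ℚ.* x) ≡ e ℚ.* ((1ℚ ℚ.+ e) ℚ.* x)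
  odd-halve q e x refl = solve 2 (λ q x → (con 1ℚ :+ q) :* (((con 1ℚ :+ con 1ℚ) :* (con 1ℚ :+ q :* (con 1ℚ :+ con 1ℚ))) :* x)
      := (con 1ℚ :+ q :* (con 1ℚ :+ con 1ℚ)) :* ((con 1ℚ :+ (con 1ℚ :+ q :* (con 1ℚ :+ con 1ℚ))) :* x)) refl q x

  odd-rest : ∀ e x → 0ℚ ℚ.- ((1ℚ ℚ.+ 1ℚ) ℚ.* e) ℚ.* x ≡ (1ℚ ℚ.+ 1ℚ) ℚ.* (x ℚ.- (1ℚ ℚ.+ e) ℚ.* x)
  odd-rest = solve 2 (λ e x → con 0ℚ :- ((con 1ℚ :+ con 1ℚ) :* e) :* x := (con 1ℚ :+ con 1ℚ) :* (x :- (con 1ℚ :+ e) :* x)) refl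

  scaled-split : ∀ e a a′ c c′ l k → (a ℚ.+ c) ℚ.- (a′ ℚ.+ c′) ≡ e ℚ.* (l ℚ.+ k) → a ℚ.- a′ ≡ (e ℚ.* k ℚ.- (c ℚ.- c′)) ℚ.+ e ℚ.* l
  scaled-split e a a′ c c′ l k h = trans (solve 4 (λ a a′ c c′ → a :- a′ := ((a :+ c) :- (a′ :+ c′)) :- (c :- c′)) refl a a′ c c′)
    (trans (cong (λ t → t ℚ.- (c ℚ.- c′)) h) (solve 5 (λ e l k c c′ → e :* (l :+ k) :- (c :- c′) := (e :* k :- (c :- c′)) :+ e :* l) refl e l k c c′))

  scaled-join : ∀ e a a′ c c′ l k → a ℚ.- a′ ≡ k ℚ.+ e ℚ.* l → (a ℚ.+ c) ℚ.- (a′ ℚ.+ c′) ≡ e ℚ.* l ℚ.+ (k ℚ.+ (c ℚ.- c′))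
  scaled-join e a a′ c c′ l k h = trans ([a+b]-[c+d] a c a′ c′) (trans (cong (ℚ._+ (c ℚ.- c′)) h)
    (solve 5 (λ k e l c c′ → (k :+ e :* l) :+ (c :- c′) := e :* l :+ (k :+ (c :- c′))) refl k e l c c′))

  cancel-middle : ∀ a b c → (a ℚ.+ b) ℚ.- (b ℚ.+ c) ≡ a ℚ.- c
  cancel-middle = solve 3 (λ a b c → (a :+ b) :- (b :+ c) := a :- c) refl

  [x-y]+[z-x]≡z-y : ∀ a b c → (a ℚ.- b) ℚ.+ (c ℚ.- a) ≡ c ℚ.- b
  [x-y]+[z-x]≡z-y = solve 3 (λ a b c → (a :- b) :+ (c :- a) := c :- b) refl

  neg-diff : ∀ a b → (0ℚ ℚ.- a) ℚ.- (0ℚ ℚ.- b) ≡ 0ℚ ℚ.- (a ℚ.- b)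
  neg-diff = solve 2 (λ a b → (con 0ℚ :- a) :- (con 0ℚ :- b) := con 0ℚ :- (a :- b)) refl

  difference-of-sums : ∀ v a b v′ a′ b′ → v ≡ a ℚ.+ b → v′ ≡ a′ ℚ.+ b′ → b ℚ.- b′ ≡ (v ℚ.- v′) ℚ.- (a ℚ.- a′)
  difference-of-sums v a b v′ a′ b′ refl refl = solve 4 (λ a b a′ b′ → b :- b′ := ((a :+ b) :- (a′ :+ b′)) :- (a :- a′)) refl a b a′ b′

  ratio-identity : ∀ X Y a b β → β ℚ.* b ≡ 1ℚ → X ℚ.* (b ℚ.* b) ≡ Y ℚ.* (a ℚ.* a) → X ≡ Y ℚ.* ((a ℚ.* β) ℚ.* (a ℚ.* β))
  ratio-identity X Y a b β e h = begin
    X                                              ≡⟨ solve 1 (λ X → X := X :* (con 1ℚ :* con 1ℚ)) refl X ⟩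
    X ℚ.* (1ℚ ℚ.* 1ℚ)                              ≡⟨ cong (λ t → X ℚ.* (t ℚ.* t)) (sym e) ⟩
    X ℚ.* ((β ℚ.* b) ℚ.* (β ℚ.* b))                ≡⟨ solve 3 (λ X b β → X :* ((β :* b) :* (β :* b)) := (X :* (b :* b)) :* (β :* β)) refl X b β ⟩
    (X ℚ.* (b ℚ.* b)) ℚ.* (β ℚ.* β)                ≡⟨ cong (ℚ._* (β ℚ.* β)) h ⟩
    (Y ℚ.* (a ℚ.* a)) ℚ.* (β ℚ.* β)                ≡⟨ solve 3 (λ Y a β → (Y :* (a :* a)) :* (β :* β) := Y :* ((a :* β) :* (a :* β))) refl Y a β ⟩
    Y ℚ.* ((a ℚ.* β) ℚ.* (a ℚ.* β))                ∎
    where open ≡-Reasoning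

open ℚ-Identities

-- Rational integers

toℚᵘ-toℚ : ∀ z → ℚ.toℚᵘ (toℚ z) ℚᵘ.≃ ℚᵘ.mkℚᵘ z 0
toℚᵘ-toℚ z = ℚP.toℚᵘ-fromℚᵘ (ℚᵘ.mkℚᵘ z 0)

toℚ-+ : ∀ a b → toℚ (a ℤ.+ b) ≡ toℚ a ℚ.+ toℚ b
toℚ-+ a b = ℚP.toℚᵘ-injective
  (ℚᵘP.≃-trans (toℚᵘ-toℚ (a ℤ.+ b))
  (ℚᵘP.≃-trans (ℚᵘ.*≡* (cong (ℤ._* (+ 1)) (cong₂ ℤ._+_ (sym (ℤP.*-identityʳ a)) (sym (ℤP.*-identityʳ b)))))
  (ℚᵘP.≃-trans (ℚᵘP.+-cong (ℚᵘP.≃-sym (toℚᵘ-toℚ a)) (ℚᵘP.≃-sym (toℚᵘ-toℚ b)))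
  (ℚᵘP.≃-sym (ℚP.toℚᵘ-homo-+ (toℚ a) (toℚ b))))))

toℚ-* : ∀ a b → toℚ (a ℤ.* b) ≡ toℚ a ℚ.* toℚ b
toℚ-* a b = ℚP.toℚᵘ-injective
  (ℚᵘP.≃-trans (toℚᵘ-toℚ (a ℤ.* b))
  (ℚᵘP.≃-trans (ℚᵘ.*≡* refl)
  (ℚᵘP.≃-trans (ℚᵘP.*-cong (ℚᵘP.≃-sym (toℚᵘ-toℚ a)) (ℚᵘP.≃-sym (toℚᵘ-toℚ b)))
  (ℚᵘP.≃-sym (ℚP.toℚᵘ-homo-* (toℚ a) (toℚ b))))))

toℚ-neg : ∀ a → toℚ (ℤ.- a) ≡ ℚ.- toℚ a
toℚ-neg a = trans (cong toℚ (sym (ℤP.-1*i≡-i a))) (trans (toℚ-* -[1+ 0 ] a)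
  (-1*x≡-x (toℚ a)))

toℚ-- : ∀ a b → toℚ (a ℤ.- b) ≡ toℚ a ℚ.- toℚ b
toℚ-- a b = trans (toℚ-+ a (ℤ.- b)) (cong (toℚ a ℚ.+_) (toℚ-neg b))

toℚ-injective : ∀ {a b} → toℚ a ≡ toℚ b → a ≡ b
toℚ-injective {a} {b} eq with ℚᵘP.≃-trans (ℚᵘP.≃-sym (toℚᵘ-toℚ a)) (ℚᵘP.≃-trans (ℚP.toℚᵘ-cong eq) (toℚᵘ-toℚ b))
... | ℚᵘ.*≡* e = trans (sym (ℤP.*-identityʳ a)) (trans e (ℤP.*-identityʳ b))

toℚ-≢0 : ∀ {a} → a ≢ + 0 → toℚ a ≢ 0ℚ
toℚ-≢0 {a} a≢0 eq = a≢0 (toℚ-injective {a} {+ 0} eq)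

int-0 : IsInt 0ℚ
int-0 = + 0 , refl

int-toℚ : ∀ z → IsInt (toℚ z)
int-toℚ z = z , refl

int-+ : ∀ {a b} → IsInt a → IsInt b → IsInt (a ℚ.+ b)
int-+ (x , p) (y , q) = x ℤ.+ y , trans (cong₂ ℚ._+_ p q) (sym (toℚ-+ x y))

int-- : ∀ {a b} → IsInt a → IsInt b → IsInt (a ℚ.- b)
int-- (x , p) (y , q) = x ℤ.- y , trans (cong₂ ℚ._-_ p q) (sym (toℚ-- x y))

int-* : ∀ {a b} → IsInt a → IsInt b → IsInt (a ℚ.* b)
int-* (x , p) (y , q) = x ℤ.* y , trans (cong₂ ℚ._*_ p q) (sym (toℚ-* x y))

int-resp : ∀ {a b} → a ≡ b → IsInt a → IsInt b
int-resp = subst IsInt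

-- Rationals are kept in lowest terms, so integrality is the equation denominator = 1. The tests for
-- Λ and Λ∨ come down to this one.
int? : ∀ q → Dec (IsInt q)
int? q with ℚ.↧ₙ q ℕ.≟ 1
... | yes d≡1 = yes (ℚ.↥ q , trans (sym (ℚP.↥p/↧p≡p q)) (ℚP./-cong {ℚ.↥ q} refl d≡1))
... | no  d≢1 = no λ { (z , refl) → d≢1 (den z) }
  where
  den : ∀ z → ℚ.↧ₙ (toℚ z) ≡ 1
  den z = ℕP.m*n≡1⇒m≡1 _ _ (ℤP.+-injective (trans (ℤP.pos-* (ℚ.↧ₙ (toℚ z)) _) (ℚP.↧-/ z 1)))

inverse : ∀ q → q ≢ 0ℚ → ∃ λ r → r ℚ.* q ≡ 1ℚ
inverse q q≢0 = (ℚ.1/_ q {{nz}}) , ℚP.*-inverseˡ q {{nz}}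
  where
  nz : ℚ.NonZero q
  nz = ℚ.≢-nonZero q≢0

cancelˡ : ∀ q {a b} → q ≢ 0ℚ → q ℚ.* a ≡ q ℚ.* b → a ≡ b
cancelˡ q {a} {b} q≢0 eq with inverse q q≢0
... | r , rq≡1 = begin
  a                ≡⟨ ℚP.*-identityˡ a ⟨
  1ℚ ℚ.* a         ≡⟨ cong (ℚ._* a) rq≡1 ⟨
  (r ℚ.* q) ℚ.* a  ≡⟨ ℚP.*-assoc r q a ⟩
  r ℚ.* (q ℚ.* a)  ≡⟨ cong (r ℚ.*_) eq ⟩
  r ℚ.* (q ℚ.* b)  ≡⟨ ℚP.*-assoc r q b ⟨
  (r ℚ.* q) ℚ.* b  ≡⟨ cong (ℚ._* b) rq≡1 ⟩
  1ℚ ℚ.* b         ≡⟨ ℚP.*-identityˡ b ⟩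
  b                ∎
  where open ≡-Reasoning

ℕtoℚ-* : ∀ a b → ℕtoℚ (a ℕ.* b) ≡ ℕtoℚ a ℚ.* ℕtoℚ b
ℕtoℚ-* a b = trans (cong toℚ (ℤP.pos-* a b)) (toℚ-* (+ a) (+ b))

ℕtoℚ-≢0 : ∀ {a} → a ℕ.> 0 → ℕtoℚ a ≢ 0ℚ
ℕtoℚ-≢0 {suc a} _ = toℚ-≢0 {+ suc a} (λ ())

-- Quotients of subgroups of ℚ^I

W : Set → Set
W I = I → ℚ

infix 4 _≐_
infixl 6 _⊕_ _⊖_
infixr 7 _⊙_

_≐_ : ∀ {I} → W I → W I → Set
u ≐ v = ∀ i → u i ≡ v i

𝟎 : ∀ {I} → W I
𝟎 _ = 0ℚ

_⊕_ _⊖_ : ∀ {I} → W I → W I → W I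
(u ⊕ v) i = u i ℚ.+ v i
(u ⊖ v) i = u i ℚ.- v i

_⊙_ : ∀ {I} → ℚ → W I → W I
(c ⊙ v) i = c ℚ.* v i

record Card {I : Set} (A B : Pred (W I)) (k : ℕ) : Set where
  constructor card
  field
    rep : Fin k → W I
    rep∈ : ∀ i → A (rep i)
    cover : ∀ v → A v → ∃ λ i → B (v ⊖ rep i)
    distinct : ∀ v i j → B (v ⊖ rep i) → B (v ⊖ rep j) → i ≡ j

-- Vectors are functions that agree only pointwise, hence the field `resp`; all other closure
-- properties follow from `zer` and `sub`.
record Subgroup {I : Set} (A : Pred (W I)) : Set where
  field
    resp : ∀ {u v} → u ≐ v → A u → A v
    zer  : A 𝟎
    sub  : ∀ {u v} → A u → A v → A (u ⊖ v)

  neg : ∀ {u} → A u → A (𝟎 ⊖ u)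
  neg = sub zer

  add : ∀ {u v} → A u → A v → A (u ⊕ v)
  add {u} {v} p q = resp (λ i → x-[0-y]≡x+y (u i) (v i)) (sub p (neg q))

  flip : ∀ u v → A (u ⊖ v) → A (v ⊖ u)
  flip u v p = resp (λ i → 0-[x-y]≡y-x (u i) (v i)) (neg p)

  chain : ∀ u v w → A (u ⊖ v) → A (v ⊖ w) → A (u ⊖ w)
  chain u v w p q = resp (λ i → [x-y]+[y-z]≡x-z (u i) (v i) (w i)) (add p q)

  self : ∀ u → A (u ⊖ u)
  self u = resp (λ i → sym (ℚP.+-inverseʳ (u i))) zer

  same : ∀ u v → u ≐ v → A (u ⊖ v)
  same u v eq = resp (λ i → cong (λ z → u i ℚ.- z) (eq i)) (self u)

  mulℕ : ∀ {u} k → A u → A (ℕtoℚ k ⊙ u)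
  mulℕ {u} zero    p = resp (λ i → sym (ℚP.*-zeroˡ (u i))) zer
  mulℕ {u} (suc k) p = resp
    (λ i → sym (trans (cong (ℚ._* u i) (toℚ-+ (+ 1) (+ k))) ([1+x]y≡y+xy (ℕtoℚ k) (u i))))
    (add p (mulℕ k p))

  mul : ∀ {u} z → A u → A (toℚ z ⊙ u)
  mul (+ k) p = mulℕ k p
  mul {u} -[1+ k ] p = resp
    (λ i → trans (0-xy≡[-x]y (ℕtoℚ (suc k)) (u i)) (cong (ℚ._* u i) (sym (toℚ-neg (+ suc k)))))
    (neg (mulℕ (suc k) p))

  split : ∀ u v → A (u ⊖ v) → A v → A u
  split u v p q = resp (λ i → [x-y]+y≡x (u i) (v i)) (add p q)

open Subgroup

card-inj : ∀ {I} {A B : Pred (W I)} {k} → Subgroup B → (c : Card A B k) →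
  ∀ i j → B (Card.rep c i ⊖ Card.rep c j) → i ≡ j
card-inj sB (card r _ _ inj) i j p = inj (r i) i j (self sB (r i)) p

-- Sending each representative of one system to its class in the other is injective.
card-≤ : ∀ {I} {A B : Pred (W I)} {k l} → Subgroup B → Card A B k → Card A B l → k ℕ.≤ l
card-≤ {B = B} sB c@(card r rA _ _) (card s _ cov _) = FinP.injective⇒≤ {f = f} f-inj
  where
  f : _
  f i = proj₁ (cov (r i) (rA i))
  f-inj : ∀ {i j} → f i ≡ f j → i ≡ j
  f-inj {i} {j} eq = card-inj sB c i j (chain sB (r i) (s (f i)) (r j) (proj₂ (cov (r i) (rA i)))
    (flip sB (r j) (s (f i)) (subst (λ x → B (r j ⊖ s x)) (sym eq) (proj₂ (cov (r j) (rA j))))))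

card-unique : ∀ {I} {A B : Pred (W I)} {k l} → Subgroup B → Card A B k → Card A B l → k ≡ l
card-unique sB c d = ℕP.≤-antisym (card-≤ sB c d) (card-≤ sB d c)

card->0 : ∀ {I} {A B : Pred (W I)} {k} → Subgroup A → Card A B k → k ℕ.> 0
card->0 {k = suc k} sA c = ℕ.s≤s ℕ.z≤n
card->0 {k = zero} sA (card _ _ cov _) with cov 𝟎 (zer sA)
... | () , _

card-tower : ∀ {I} {A B C : Pred (W I)} {k l} → Subgroup A → Subgroup B → Subgroup C →
  (∀ {v} → B v → A v) → (∀ {v} → C v → B v) →
  Card A B k → Card B C l → Card A C (k ℕ.* l)
card-tower {I} {A} {B} {C} {k} {l} sA sB sC B⊆A C⊆B (card r rA covr injr) (card s sB′ covs injs) =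
  card rep (λ x → add sA (rA _) (B⊆A (sB′ _))) cov inj
  where
  rep : Fin (k ℕ.* l) → W I
  rep x = r (proj₁ (Fin.remQuot {k} l x)) ⊕ s (proj₂ (Fin.remQuot {k} l x))

  assoc : ∀ (u v w : W I) → (u ⊖ v) ⊖ w ≐ u ⊖ (v ⊕ w)
  assoc u v w i = [x-y]-z≡x-[y+z] (u i) (v i) (w i)

  cov : ∀ v → A v → ∃ λ x → C (v ⊖ rep x)
  cov v Av with covr v Av
  ... | i , p with covs (v ⊖ r i) p
  ... | j , q = Fin.combine i j , subst (λ y → C (v ⊖ (r (proj₁ y) ⊕ s (proj₂ y)))) (sym (FinP.remQuot-combine i j))
      (resp sC (assoc v (r i) (s j)) q)

  inj : ∀ v x y → C (v ⊖ rep x) → C (v ⊖ rep y) → x ≡ y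
  inj v x y p q = trans (sym (FinP.combine-remQuot {k} l x))
      (trans (cong₂ Fin.combine i≡ j≡) (FinP.combine-remQuot {k} l y))
    where
    back : ∀ x → C (v ⊖ rep x) → C ((v ⊖ r (proj₁ (Fin.remQuot {k} l x))) ⊖ s (proj₂ (Fin.remQuot {k} l x)))
    back x = resp sC (λ i → sym (assoc v (r (proj₁ (Fin.remQuot {k} l x))) (s (proj₂ (Fin.remQuot {k} l x))) i))
    top : ∀ x → C (v ⊖ rep x) → B (v ⊖ r (proj₁ (Fin.remQuot {k} l x)))
    top x p = split sB (v ⊖ r (proj₁ (Fin.remQuot {k} l x))) (s (proj₂ (Fin.remQuot {k} l x))) (C⊆B (back x p)) (sB′ _)
    i≡ : proj₁ (Fin.remQuot {k} l x) ≡ proj₁ (Fin.remQuot {k} l y)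
    i≡ = injr v _ _ (top x p) (top y q)
    j≡ : proj₂ (Fin.remQuot {k} l x) ≡ proj₂ (Fin.remQuot {k} l y)
    j≡ = injs (v ⊖ r (proj₁ (Fin.remQuot {k} l x))) _ _ (back x p)
      (subst (λ i → C ((v ⊖ r i) ⊖ s (proj₂ (Fin.remQuot {k} l y)))) (sym i≡) (back y q))

-- The isomorphism theorem in the form used throughout. The map g may read off a component from the
-- proof of membership, so it need not be linear or canonical: preserving and reflecting congruence
-- and meeting every class is enough.
card-transfer : ∀ {I I′} {A B : Pred (W I)} {A′ B′ : Pred (W I′)} {k} → Subgroup B → Subgroup B′ →
  (g : ∀ x → A x → W I′) → (∀ x a → A′ (g x a)) →
  (∀ x y a b → B (x ⊖ y) → B′ (g x a ⊖ g y b)) →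
  (∀ x y a b → B′ (g x a ⊖ g y b) → B (x ⊖ y)) →
  (∀ v → A′ v → ∃ λ x → Σ (A x) λ a → B′ (v ⊖ g x a)) →
  Card A B k → Card A′ B′ k
card-transfer {B′ = B′} sB sB′ g g∈ to from sur c@(card r rA cov _) = card
  (λ i → g (r i) (rA i)) (λ i → g∈ _ _)
  (λ v v∈ → let (x , a , p) = sur v v∈ ; (i , q) = cov x a in
     i , chain sB′ v (g x a) (g (r i) (rA i)) p (to x (r i) a (rA i) q))
  (λ v i j p q → card-inj sB c i j (from (r i) (r j) (rA i) (rA j)
     (chain sB′ (g (r i) (rA i)) v (g (r j) (rA j)) (flip sB′ v (g (r i) (rA i)) p) q)))

card-cong : ∀ {I} {A B A′ B′ : Pred (W I)} {k} → Subgroup B → Subgroup B′ →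
  (∀ {v} → A v → A′ v) → (∀ {v} → A′ v → A v) →
  (∀ {v} → B v → B′ v) → (∀ {v} → B′ v → B v) →
  Card A B k → Card A′ B′ k
card-cong sB sB′ f f⁻ h h⁻ = card-transfer sB sB′ (λ x _ → x) (λ _ → f) (λ _ _ _ _ → h) (λ _ _ _ _ → h⁻)
  (λ v v∈ → v , f⁻ v∈ , self sB′ v)

-- A finite list meeting every class can be thinned to a transversal because congruence of two of
-- its members is decidable.
card-cover : ∀ {I} {A B : Pred (W I)} {k} → Subgroup B →
  (r : Fin k → W I) → (∀ i → A (r i)) → (∀ v → A v → ∃ λ i → B (v ⊖ r i)) →
  (∀ u v → A u → A v → Dec (B (u ⊖ v))) → ∃ λ l → Card A B l
card-cover {I} {A} {B} sB r rA cov B? = let (l , s , sA , rs , inj) = thin r rA in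
  l , card s sA
  (λ v Av → let (i , p) = cov v Av ; (j , q) = rs i in j , chain sB v (r i) (s j) p q)
  (λ v i j p q → inj i j (chain sB (s i) v (s j) (flip sB v (s i) p) q))
  where
  thin : ∀ {k} (r : Fin k → W I) → (∀ i → A (r i)) → ∃ λ l → Σ (Fin l → W I) λ s →
    (∀ i → A (s i)) × (∀ i → ∃ λ j → B (r i ⊖ s j)) × (∀ i j → B (s i ⊖ s j) → i ≡ j)
  thin {zero} r rA = 0 , r , rA , (λ ()) , (λ ())
  thin {suc k} r rA with thin (λ i → r (suc i)) (λ i → rA (suc i))
  ... | l , s , sA , rs , inj with FinP.any? (λ j → B? (r zero) (s j) (rA zero) (sA j))
  ... | yes (j , p) = l , s , sA , (λ { zero → j , p ; (suc i) → rs i }) , inj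
  ... | no ¬p = suc l , s′ , s′A , rs′ , inj′
    where
    s′ : Fin (suc l) → W I
    s′ zero = r zero
    s′ (suc j) = s j
    s′A : ∀ i → A (s′ i)
    s′A zero = rA zero
    s′A (suc j) = sA j
    rs′ : ∀ i → ∃ λ j → B (r i ⊖ s′ j)
    rs′ zero = zero , self sB (r zero)
    rs′ (suc i) = let (j , p) = rs i in suc j , p
    inj′ : ∀ i j → B (s′ i ⊖ s′ j) → i ≡ j
    inj′ zero zero p = refl
    inj′ zero (suc j) p = ⊥-elim (¬p (j , p))
    inj′ (suc i) zero p = ⊥-elim (¬p (i , flip sB (s i) (r zero) p))
    inj′ (suc i) (suc j) p = cong suc (inj i j p)

-- A vector lies in B exactly when it falls into the class of 0, and classes are numbered by
-- `Fin k`.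
card-dec : ∀ {I} {A B : Pred (W I)} {k} → Subgroup A → Subgroup B → Card A B k → ∀ v → A v → Dec (B v)
card-dec {B = B} sA sB (card r _ cov inj) v Av with cov v Av | cov 𝟎 (zer sA)
... | i , p | j , q with i FinP.≟ j
... | yes refl = yes (resp sB (λ i → x-0≡x (v i)) (chain sB v (r i) 𝟎 p (flip sB 𝟎 (r i) q)))
... | no i≢j = no λ Bv → i≢j (inj v i j p
    (chain sB v 𝟎 (r j) (resp sB (λ i → sym (x-0≡x (v i))) Bv) q))

-- The converse of `card-tower`: a transversal of A/C covers A/B, and its members in B cover B/C.
card-between : ∀ {I} {A B C : Pred (W I)} {k} → Subgroup A → Subgroup B → Subgroup C →
  (∀ {v} → B v → A v) → (∀ {v} → C v → B v) → (∀ v → A v → Dec (B v)) →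
  Card A C k → ∃ λ i → ∃ λ j → Card A B i × Card B C j × k ≡ i ℕ.* j
card-between {I} {A} {B} {C} sA sB sC B⊆A C⊆B B? c@(card r rA cov inj) =
  proj₁ top , proj₁ bot , proj₂ top , proj₂ bot ,
  card-unique sC c (card-tower sA sB sC B⊆A C⊆B (proj₂ top) (proj₂ bot))
  where
  top : ∃ λ i → Card A B i
  top = card-cover sB r rA (λ v Av → let (i , p) = cov v Av in i , C⊆B p) (λ u v Au Av → B? (u ⊖ v) (sub sA Au Av))

  -- Representatives outside B are replaced by 0, which is harmless since the list only has to cover
  -- B/C before `card-cover` removes repetitions.
  pick : ∀ v → Dec (B v) → W I
  pick v (yes _) = v
  pick v (no _)  = 𝟎
  pick∈ : ∀ v d → B (pick v d)
  pick∈ v (yes p) = p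
  pick∈ v (no _)  = zer sB
  pick≡ : ∀ w v d → B v → C (w ⊖ v) → C (w ⊖ pick v d)
  pick≡ w v (yes _) _ p = p
  pick≡ w v (no ¬q) q _ = ⊥-elim (¬q q)

  bot : ∃ λ j → Card B C j
  bot = card-cover sC (λ i → pick (r i) (B? (r i) (rA i))) (λ i → pick∈ (r i) (B? (r i) (rA i)))
    (λ v Bv → let (i , p) = cov v (B⊆A Bv) in
       i , pick≡ v (r i) (B? (r i) (rA i)) (split sB (r i) v (C⊆B (flip sC v (r i) p)) Bv) p)
    (λ u v Bu Bv → card-dec sA sC c (u ⊖ v) (B⊆A (sub sB Bu Bv)))

-- Torsion in finite quotients and elements of prime order

ℕtoℚ-∸ : ∀ {a b} → a ℕ.≤ b → ℕtoℚ (b ℕ.∸ a) ≡ ℕtoℚ b ℚ.- ℕtoℚ a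
ℕtoℚ-∸ {a} {b} a≤b = begin
  ℕtoℚ (b ℕ.∸ a)                             ≡⟨ sym ([x+y]-y≡x (ℕtoℚ (b ℕ.∸ a)) (ℕtoℚ a)) ⟩
  (ℕtoℚ (b ℕ.∸ a) ℚ.+ ℕtoℚ a) ℚ.- ℕtoℚ a     ≡⟨ cong (ℚ._- ℕtoℚ a) (sym (toℚ-+ (+ (b ℕ.∸ a)) (+ a))) ⟩
  ℕtoℚ ((b ℕ.∸ a) ℕ.+ a) ℚ.- ℕtoℚ a          ≡⟨ cong (λ x → ℕtoℚ x ℚ.- ℕtoℚ a) (ℕP.m∸n+n≡m a≤b) ⟩
  ℕtoℚ b ℚ.- ℕtoℚ a                          ∎
  where open ≡-Reasoning

∣! : ∀ {d k} → d ℕ.> 0 → d ℕ.≤ k → d ∣ (k !)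
∣! {suc d} {k} _ d≤k = ℕD.∣-trans (ℕD.m∣m*n (d !)) (ℕD.m≤n⇒m!∣n! d≤k)

-- The pigeonhole principle on the multiples 0, x, ..., kx gives some d with 0 < d ≤ k and dx ∈ B.
-- This d depends on x, but always divides k!, which is all that is needed of an exponent;
-- Lagrange's theorem is avoided.
card-kills : ∀ {I} {A B : Pred (W I)} {k} → Subgroup A → Subgroup B → Card A B k →
  ∀ x → A x → B (ℕtoℚ (k !) ⊙ x)
card-kills {I} {A} {B} {k} sA sB (card r _ cov _) x Ax with FinP.pigeonhole (ℕP.n<1+n k) (λ j → proj₁ (cov (ℕtoℚ (toℕ j) ⊙ x) (mulℕ sA (toℕ j) Ax)))
... | i , j , i<j , eq with ∣! {toℕ j ℕ.∸ toℕ i} {k} (ℕP.m<n⇒0<n∸m i<j) (ℕP.≤-trans (ℕP.m∸n≤m (toℕ j) (toℕ i)) (ℕP.≤-pred (FinP.toℕ<n j)))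
... | divides q k!≡ = resp sB (λ l → begin
    ℕtoℚ q ℚ.* (ℕtoℚ (toℕ j ℕ.∸ toℕ i) ℚ.* x l)  ≡⟨ ℚP.*-assoc (ℕtoℚ q) _ _ ⟨
    (ℕtoℚ q ℚ.* ℕtoℚ (toℕ j ℕ.∸ toℕ i)) ℚ.* x l  ≡⟨ cong (ℚ._* x l) (trans (sym (ℕtoℚ-* q _)) (cong ℕtoℚ (sym k!≡))) ⟩
    ℕtoℚ (k !) ℚ.* x l ∎) (mulℕ sB q Bd)
  where
  open ≡-Reasoning
  f : Fin (suc k) → Fin k
  f j = proj₁ (cov (ℕtoℚ (toℕ j) ⊙ x) (mulℕ sA (toℕ j) Ax))
  c : ∀ (j : Fin (suc k)) → B ((ℕtoℚ (toℕ j) ⊙ x) ⊖ r (proj₁ (cov (ℕtoℚ (toℕ j) ⊙ x) (mulℕ sA (toℕ j) Ax))))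
  c j = proj₂ (cov (ℕtoℚ (toℕ j) ⊙ x) (mulℕ sA (toℕ j) Ax))
  Bd : B (ℕtoℚ (toℕ j ℕ.∸ toℕ i) ⊙ x)
  Bd = resp sB (λ l → trans (factor-sub (ℕtoℚ (toℕ j)) (ℕtoℚ (toℕ i)) (x l))
      (cong (ℚ._* x l) (sym (ℕtoℚ-∸ (ℕP.<⇒≤ i<j)))))
    (chain sB (ℕtoℚ (toℕ j) ⊙ x) (r (f j)) (ℕtoℚ (toℕ i) ⊙ x) (c j)
      (flip sB (ℕtoℚ (toℕ i) ⊙ x) (r (f j)) (subst (λ y → B ((ℕtoℚ (toℕ i) ⊙ x) ⊖ r y)) eq (c i))))

denominator-clears : ∀ q → ℕtoℚ (ℚ.↧ₙ q) ℚ.* q ≡ toℚ (ℚ.↥ q)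
denominator-clears q@record{} = ℚP.toℚᵘ-injective (ℚᵘP.≃-trans (ℚP.toℚᵘ-homo-* (ℕtoℚ (ℚ.↧ₙ q)) q)
  (ℚᵘP.≃-trans (ℚᵘP.*-cong (toℚᵘ-toℚ (ℚ.↧ q)) ℚᵘP.≃-refl)
  (ℚᵘP.≃-trans (ℚᵘ.*≡* identity) (ℚᵘP.≃-sym (toℚᵘ-toℚ (ℚ.↥ q))))))
  where
  identity : (ℚ.↧ q ℤ.* ℚ.↥ q) ℤ.* + 1 ≡ ℚ.↥ q ℤ.* + (1 ℕ.* ℚ.↧ₙ q)
  identity = trans (ℤP.*-identityʳ _) (trans (ℤP.*-comm (ℚ.↧ q) (ℚ.↥ q)) (cong (λ t → ℚ.↥ q ℤ.* + t) (sym (ℕP.*-identityˡ (ℚ.↧ₙ q)))))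

card-trivial : ∀ {I} {A B : Pred (W I)} → Subgroup A → Subgroup B → (∀ {v} → A v → B v) → Card A B 1
card-trivial sA sB A⊆B = card (λ _ → 𝟎) (λ _ → zer sA) (λ v Av → zero , sub sB (A⊆B Av) (zer sB)) λ { _ zero zero _ _ → refl }

card-1 : ∀ {I} {A B : Pred (W I)} → Subgroup A → Subgroup B → Card A B 1 → ∀ v → A v → B v
card-1 sA sB (card r _ cov _) v Av with cov v Av | cov 𝟎 (zer sA)
... | zero , p | zero , q = resp sB (λ i → x-0≡x (v i)) (chain sB v (r zero) 𝟎 p (flip sB 𝟎 (r zero) q))

-- B is a finite union of cosets of C, and membership in C is decidable inside A.
card-dec-mid : ∀ {I} {A B C : Pred (W I)} {k l} → Subgroup A → Subgroup B → Subgroup C →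
  (∀ {v} → B v → A v) → (∀ {v} → C v → B v) → Card A C k → Card B C l → ∀ v → A v → Dec (B v)
card-dec-mid sA sB sC B⊆A C⊆B c (card s sB′ cov _) v Av
  with FinP.any? (λ i → card-dec sA sC c (v ⊖ s i) (sub sA Av (B⊆A (sB′ i))))
... | yes (i , p) = yes (split sB v (s i) (C⊆B p) (sB′ i))
... | no ¬p = no λ Bv → ¬p (cov v Bv)

bézout : ∀ {p n} → Coprime p n → ∃ λ u → ∃ λ w → toℚ u ℚ.* ℕtoℚ n ℚ.+ toℚ w ℚ.* ℕtoℚ p ≡ 1ℚ
bézout {p} {n} cop with coprime-Bézout cop
... | Bézout.+- x y eq = ℤ.- (+ y) , + x , (begin
    toℚ (ℤ.- (+ y)) ℚ.* ℕtoℚ n ℚ.+ ℕtoℚ x ℚ.* ℕtoℚ p ≡⟨ cong₂ (λ a b → a ℚ.* ℕtoℚ n ℚ.+ b) (toℚ-neg (+ y)) (trans (sym (ℕtoℚ-* x p)) (trans (cong ℕtoℚ (sym eq)) (trans (toℚ-+ (+ 1) (+ (y ℕ.* n))) (cong (1ℚ ℚ.+_) (ℕtoℚ-* y n))))) ⟩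
    (ℚ.- ℕtoℚ y) ℚ.* ℕtoℚ n ℚ.+ (1ℚ ℚ.+ ℕtoℚ y ℚ.* ℕtoℚ n) ≡⟨ bézout-+- (ℕtoℚ y) (ℕtoℚ n) ⟩
    1ℚ ∎)
  where open ≡-Reasoning
... | Bézout.-+ x y eq = + y , ℤ.- (+ x) , (begin
    ℕtoℚ y ℚ.* ℕtoℚ n ℚ.+ toℚ (ℤ.- (+ x)) ℚ.* ℕtoℚ p ≡⟨ cong₂ (λ a b → b ℚ.+ a ℚ.* ℕtoℚ p) (toℚ-neg (+ x)) (trans (sym (ℕtoℚ-* y n)) (trans (cong ℕtoℚ (sym eq)) (trans (toℚ-+ (+ 1) (+ (x ℕ.* p))) (cong (1ℚ ℚ.+_) (ℕtoℚ-* x p))))) ⟩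
    (1ℚ ℚ.+ ℕtoℚ x ℚ.* ℕtoℚ p) ℚ.+ (ℚ.- ℕtoℚ x) ℚ.* ℕtoℚ p ≡⟨ trans (ℚP.+-comm (1ℚ ℚ.+ ℕtoℚ x ℚ.* ℕtoℚ p) ((ℚ.- ℕtoℚ x) ℚ.* ℕtoℚ p)) (bézout-+- (ℕtoℚ x) (ℕtoℚ p)) ⟩
    1ℚ ∎)
  where open ≡-Reasoning

coprime-kill : ∀ {I} {B : Pred (W I)} {p n} → Subgroup B → Coprime p n → ∀ {x} → B (ℕtoℚ p ⊙ x) → B (ℕtoℚ n ⊙ x) → B x
coprime-kill {p = p} {n} sB cop {x} Bp Bn with bézout cop
... | u , w , eq = resp sB (λ i → trans
    (bézout-combine (toℚ u) (ℕtoℚ n) (toℚ w) (ℕtoℚ p) (x i))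
    (trans (cong (ℚ._* x i) eq) (ℚP.*-identityˡ (x i))))
  (add sB (mul sB u Bn) (mul sB w Bp))

infixl 6 _+ℤ_

_+ℤ_ : ∀ {I} → Pred (W I) → W I → Pred (W I)
(B +ℤ x) v = ∃ λ z → B (v ⊖ toℚ z ⊙ x)

+ℤ-subgroup : ∀ {I} {B : Pred (W I)} → Subgroup B → ∀ x → Subgroup (B +ℤ x)
+ℤ-subgroup {I} {B} sB x = record
  { resp = λ eq (z , p) → z , resp sB (λ i → cong (ℚ._- toℚ z ℚ.* x i) (eq i)) p
  ; zer  = + 0 , resp sB (λ i → 0-0x (x i)) (zer sB)
  ; sub  = λ {u} {v} (z , p) (w , q) → z ℤ.- w , resp sB (λ i → trans
      (shift-sub (u i) (toℚ z) (v i) (toℚ w) (x i))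
      (cong (λ y → (u i ℚ.- v i) ℚ.- y ℚ.* x i) (sym (toℚ-- z w)))) (sub sB p q)
  }

+ℤ-base : ∀ {I} {B : Pred (W I)} → Subgroup B → ∀ x {v} → B v → (B +ℤ x) v
+ℤ-base sB x {v} p = + 0 , resp sB (λ i → v-0x (v i) (x i)) p

+ℤ-⊆ : ∀ {I} {A B : Pred (W I)} {x} → Subgroup A → (∀ {v} → B v → A v) → A x → ∀ {v} → (B +ℤ x) v → A v
+ℤ-⊆ {x = x} sA B⊆A Ax {v} (z , p) = split sA v (toℚ z ⊙ x) (B⊆A p) (mul sA z Ax)

-- The multiples ix with i < p are incongruent: a difference of two indices is prime to p, and
-- `coprime-kill` would put x itself into B.
cyclic-card : ∀ {I} {B : Pred (W I)} {p} → Prime p → Subgroup B → ∀ x → ¬ B x → B (ℕtoℚ p ⊙ x) → Card (B +ℤ x) B p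
cyclic-card {I} {B} {p} pp sB x ¬Bx Bpx = card rep (λ i → + toℕ i , self sB (rep i)) cov inj
  where
  instance
    nz : ℕ.NonZero p
    nz = prime⇒nonZero pp
  rep : Fin p → W I
  rep i = ℕtoℚ (toℕ i) ⊙ x
  cov : ∀ v → (B +ℤ x) v → ∃ λ i → B (v ⊖ rep i)
  cov v (z , Bv) = Fin.fromℕ< (ℤDM.n%ℕd<d z p) , resp sB (λ i → trans (eq i) (cong (λ t → v i ℚ.- ℕtoℚ t ℚ.* x i) (sym (FinP.toℕ-fromℕ< (ℤDM.n%ℕd<d z p)))))
      (add sB Bv (mul sB (z ℤDM./ℕ p) Bpx))
    where
    eq : ∀ i → (v i ℚ.- toℚ z ℚ.* x i) ℚ.+ toℚ (z ℤDM./ℕ p) ℚ.* (ℕtoℚ p ℚ.* x i) ≡ v i ℚ.- ℕtoℚ (z ℤDM.%ℕ p) ℚ.* x i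
    eq i = trans (cong (λ y → (v i ℚ.- y ℚ.* x i) ℚ.+ toℚ (z ℤDM./ℕ p) ℚ.* (ℕtoℚ p ℚ.* x i))
        (trans (cong toℚ (ℤDM.a≡a%ℕn+[a/ℕn]*n z p)) (trans (toℚ-+ (+ (z ℤDM.%ℕ p)) ((z ℤDM./ℕ p) ℤ.* + p)) (cong (toℚ (+ (z ℤDM.%ℕ p)) ℚ.+_) (toℚ-* (z ℤDM./ℕ p) (+ p))))))
      (shift-mod (v i) (ℕtoℚ (z ℤDM.%ℕ p)) (toℚ (z ℤDM./ℕ p)) (ℕtoℚ p) (x i))
  lt : ∀ (i j : Fin p) → toℕ i ℕ.< toℕ j → B (rep j ⊖ rep i) → ⊥
  lt i j i<j q = ¬Bx (coprime-kill sB (prime⇒coprime pp {{ℕ.>-nonZero (ℕP.m<n⇒0<n∸m i<j)}} (ℕP.≤-<-trans (ℕP.m∸n≤m (toℕ j) (toℕ i)) (FinP.toℕ<n j))) Bpx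
    (resp sB (λ l → trans (factor-sub (ℕtoℚ (toℕ j)) (ℕtoℚ (toℕ i)) (x l))
      (cong (ℚ._* x l) (sym (ℕtoℚ-∸ (ℕP.<⇒≤ i<j))))) q))
  inj : ∀ v i j → B (v ⊖ rep i) → B (v ⊖ rep j) → i ≡ j
  inj v i j p q with ℕP.<-cmp (toℕ i) (toℕ j)
  ... | tri≈ _ eq _ = FinP.toℕ-injective eq
  ... | tri< lt′ _ _ = ⊥-elim (lt i j lt′ (chain sB (rep j) v (rep i) (flip sB v (rep j) q) p))
  ... | tri> _ _ gt = ⊥-elim (lt j i gt (chain sB (rep i) v (rep j) (flip sB v (rep i) p) q))

-- A vector outside B is killed by k!. Removing the prime factors of k! one by one, the last
-- multiple still outside B has prime order.
prime-order : ∀ {I} {A B : Pred (W I)} {k} → Subgroup A → Subgroup B → Card A B k → k ≢ 1 →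
  ∃ λ x → A x × ¬ B x × ∃ λ p → Prime p × B (ℕtoℚ p ⊙ x)
prime-order {I} {A} {B} {k} sA sB c k≢1 = go k c k≢1
  where
  B? : ∀ v → A v → Dec (B v)
  B? = card-dec sA sB c
  descend : ∀ fs → All Prime fs → ∀ x → A x → ¬ B x → B (ℕtoℚ (product fs) ⊙ x) →
    ∃ λ x → A x × ¬ B x × ∃ λ p → Prime p × B (ℕtoℚ p ⊙ x)
  descend [] [] x Ax ¬Bx q = ⊥-elim (¬Bx (resp sB (λ i → ℚP.*-identityˡ (x i)) q))
  descend (p ∷ ps) (pp ∷ pps) x Ax ¬Bx q with B? (ℕtoℚ (product ps) ⊙ x) (mulℕ sA (product ps) Ax)
  ... | yes q′ = descend ps pps x Ax ¬Bx q′
  ... | no ¬q′ = ℕtoℚ (product ps) ⊙ x , mulℕ sA (product ps) Ax , ¬q′ , p , pp ,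
    resp sB (λ i → trans (cong (ℚ._* x i) (ℕtoℚ-* p (product ps))) (ℚP.*-assoc (ℕtoℚ p) (ℕtoℚ (product ps)) (x i))) q
  from : ∀ x → A x → ¬ B x → ∃ λ x → A x × ¬ B x × ∃ λ p → Prime p × B (ℕtoℚ p ⊙ x)
  from x Ax ¬Bx = descend (PrimeFactorisation.factors pf) (PrimeFactorisation.factorsPrime pf) x Ax ¬Bx
      (subst (λ m → B (ℕtoℚ m ⊙ x)) (PrimeFactorisation.isFactorisation pf) (card-kills sA sB c x Ax))
    where
    pf : PrimeFactorisation (k !)
    pf = factorise (k !) {{k ℕP.!≢0}}
  go : ∀ k → Card A B k → k ≢ 1 → _
  go zero c _ = ⊥-elim (ℕP.<-irrefl refl (card->0 {A = A} {B = B} sA c))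
  go (suc zero) c k≢1 = ⊥-elim (k≢1 refl)
  -- Two distinct representatives cannot both lie in B.
  go (suc (suc k)) (card r rA _ inj) _ with B? (r zero) (rA zero)
  ... | no ¬p = from (r zero) (rA zero) ¬p
  ... | yes p with B? (r (suc zero)) (rA (suc zero))
  ... | no ¬q = from (r (suc zero)) (rA (suc zero)) ¬q
  ... | yes q with inj 𝟎 zero (suc zero) (neg sB p) (neg sB q)
  ... | ()

-- Pairings modulo ℤ: duality, biduality and alternating forms

record Bilinear {I I′ : Set} (b : W I → W I′ → ℚ) : Set where
  field
    respˡ : ∀ {u v y} → u ≐ v → b u y ≡ b v y
    respʳ : ∀ {u y z} → y ≐ z → b u y ≡ b u z
    subˡ  : ∀ u v y → b (u ⊖ v) y ≡ b u y ℚ.- b v y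
    subʳ  : ∀ u y z → b u (y ⊖ z) ≡ b u y ℚ.- b u z
    mulˡ  : ∀ c u y → b (c ⊙ u) y ≡ c ℚ.* b u y
    mulʳ  : ∀ c u y → b u (c ⊙ y) ≡ c ℚ.* b u y

open Bilinear

-- The annihilator of A′ in A modulo ℤ; maximality is stated by witnesses of
-- non-membership, which is what the constructive induction needs.
record Radical {I I′ : Set} (A : Pred (W I)) (A′ : Pred (W I′)) (b : W I → W I′ → ℚ) (B : Pred (W I)) : Set where
  field
    sound : ∀ {v y} → B v → A′ y → IsInt (b v y)
    wit   : ∀ {v} → A v → ¬ B v → ∃ λ y → A′ y × ¬ IsInt (b v y)

open Radical

-- The group (1/p)ℤ/ℤ has prime order, so the nonzero class of q₀ generates it. The multiplier is
-- a·u with a = pq and u an inverse of pq₀ modulo p.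
fraction : ∀ {p} → Prime p → ∀ {q₀ q} → IsInt (ℕtoℚ p ℚ.* q₀) → ¬ IsInt q₀ → IsInt (ℕtoℚ p ℚ.* q) →
  ∃ λ z → IsInt (q ℚ.- toℚ z ℚ.* q₀)
fraction {p} pp {q₀} {q} (a₀ , e₀) ¬i (a , e) = a ℤ.* u ,
  subst (λ y → IsInt (q ℚ.- y ℚ.* q₀)) (sym (toℚ-* a u))
    (int-resp (sym (cancelˡ P p≢0 (fraction-identity P q (toℚ a) (toℚ u) q₀ R (toℚ k) (toℚ w) e e₀′ bz)))
      (int-- (int-* (int-toℚ a) (int-toℚ w)) (int-* (int-toℚ a) (int-* (int-toℚ u) (int-toℚ k)))))
  where
  instance
    nz : ℕ.NonZero p
    nz = prime⇒nonZero pp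
  P R : ℚ
  P = ℕtoℚ p
  r : ℕ
  r = a₀ ℤDM.%ℕ p
  R = ℕtoℚ r
  k : ℤ
  k = a₀ ℤDM./ℕ p
  p≢0 : P ≢ 0ℚ
  p≢0 = ℕtoℚ-≢0 (ℕ.>-nonZero⁻¹ p)
  e₀′ : P ℚ.* q₀ ≡ R ℚ.+ toℚ k ℚ.* P
  e₀′ = trans e₀ (trans (cong toℚ (ℤDM.a≡a%ℕn+[a/ℕn]*n a₀ p)) (trans (toℚ-+ (+ r) (k ℤ.* + p)) (cong (R ℚ.+_) (toℚ-* k (+ p)))))
  r≢0 : r ≢ 0
  r≢0 r≡0 = ¬i (k , cancelˡ P p≢0 (trans e₀′ (trans (cong (λ y → ℕtoℚ y ℚ.+ toℚ k ℚ.* P) r≡0) (trans (ℚP.+-identityˡ (toℚ k ℚ.* P)) (ℚP.*-comm (toℚ k) P)))))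
  bz′ : ∃ λ u → ∃ λ w → toℚ u ℚ.* R ℚ.+ toℚ w ℚ.* P ≡ 1ℚ
  bz′ = bézout (prime⇒coprime pp {{ℕ.≢-nonZero r≢0}} (ℤDM.n%ℕd<d a₀ p))
  u w : ℤ
  u = proj₁ bz′
  w = proj₁ (proj₂ bz′)
  bz : toℚ u ℚ.* R ℚ.+ toℚ w ℚ.* P ≡ 1ℚ
  bz = proj₂ (proj₂ bz′)

_⊥ℤ[_]_ : ∀ {I I′} → Pred (W I′) → (W I → W I′ → ℚ) → W I → Pred (W I′)
(A′ ⊥ℤ[ b ] x) y = A′ y × IsInt (b x y)

⊥ℤ-subgroup : ∀ {I I′} {A′ : Pred (W I′)} {b : W I → W I′ → ℚ} → Subgroup A′ → Bilinear b → ∀ x → Subgroup (A′ ⊥ℤ[ b ] x)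
⊥ℤ-subgroup {b = b} sA′ bl x = record
  { resp = λ eq (p , q) → resp sA′ eq p , int-resp (respʳ bl eq) q
  ; zer  = zer sA′ , int-resp (sym (trans (respʳ bl {z = 0ℚ ⊙ 𝟎} (λ i → refl)) (trans (mulʳ bl 0ℚ x 𝟎) (ℚP.*-zeroˡ (b x 𝟎))))) int-0
  ; sub  = λ {u} {v} (p , q) (p′ , q′) → sub sA′ p p′ , int-resp (sym (subʳ bl x u v)) (int-- q q′) }

-- For x of order p modulo the radical, y ↦ b x y is a homomorphism from A′ to (1/p)ℤ/ℤ, nonzero by
-- the witness y₀. So A′ = x^⊥ + ℤy₀ with x^⊥ of index p, and passing from A′ to x^⊥ enlarges the
-- radical from B to exactly B + ℤx.
module PrimeStep {I I′ : Set} {A B : Pred (W I)} {A′ : Pred (W I′)} {b : W I → W I′ → ℚ} {x : W I} {p : ℕ}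
  (sA : Subgroup A) (sB : Subgroup B) (sA′ : Subgroup A′) (bl : Bilinear b) (rad : Radical A A′ b B)
  (Ax : A x) (¬Bx : ¬ B x) (pp : Prime p) (Bpx : B (ℕtoℚ p ⊙ x)) where

  p·int : ∀ {y} → A′ y → IsInt (ℕtoℚ p ℚ.* b x y)
  p·int {y} A′y = int-resp (mulˡ bl (ℕtoℚ p) x y) (sound rad Bpx A′y)

  y₀ : W I′
  y₀ = proj₁ (wit rad Ax ¬Bx)

  A′y₀ : A′ y₀
  A′y₀ = proj₁ (proj₂ (wit rad Ax ¬Bx))

  ¬int₀ : ¬ IsInt (b x y₀)
  ¬int₀ = proj₂ (proj₂ (wit rad Ax ¬Bx))

  expandʳ : ∀ u y a → b u (y ⊖ a ⊙ y₀) ≡ b u y ℚ.- a ℚ.* b u y₀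
  expandʳ u y a = trans (subʳ bl u y (a ⊙ y₀)) (cong (λ s → b u y ℚ.- s) (mulʳ bl a u y₀))

  expandˡ : ∀ v t y → b (v ⊖ t ⊙ x) y ≡ b v y ℚ.- t ℚ.* b x y
  expandˡ v t y = trans (subˡ bl v (t ⊙ x) y) (cong (λ s → b v y ℚ.- s) (mulˡ bl t x y))

  sA₁ : Subgroup (A′ ⊥ℤ[ b ] x)
  sA₁ = ⊥ℤ-subgroup sA′ bl x

  decompose : ∀ {y} → A′ y → ((A′ ⊥ℤ[ b ] x) +ℤ y₀) y
  decompose {y} A′y = let (z , i) = fraction pp (p·int A′y₀) ¬int₀ (p·int A′y) in
    z , sub sA′ A′y (mul sA′ z A′y₀) , int-resp (sym (expandʳ x y (toℚ z))) i

  A₁py₀ : (A′ ⊥ℤ[ b ] x) (ℕtoℚ p ⊙ y₀)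
  A₁py₀ = mulℕ sA′ p A′y₀ , int-resp (sym (mulʳ bl (ℕtoℚ p) x y₀)) (p·int A′y₀)

  perp-card : Card A′ (A′ ⊥ℤ[ b ] x) p
  perp-card = card-cong sA₁ sA₁ (+ℤ-⊆ {B = A′ ⊥ℤ[ b ] x} sA′ proj₁ A′y₀) decompose (λ q → q) (λ q → q)
    (cyclic-card pp sA₁ y₀ (λ q → ¬int₀ (proj₂ q)) A₁py₀)

  perp-sound : ∀ {v y} → (B +ℤ x) v → (A′ ⊥ℤ[ b ] x) y → IsInt (b v y)
  perp-sound {v} {y} (z , q) (A′y , i) = int-resp
    (trans (cong (ℚ._+ toℚ z ℚ.* b x y) (expandˡ v (toℚ z) y)) ([x-y]+y≡x (b v y) (toℚ z ℚ.* b x y)))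
    (int-+ (sound rad q A′y) (int-* (int-toℚ z) i))

  -- If v pairs non-integrally with py₀ ∈ x^⊥, that is the witness. Otherwise b v y₀ ≡ t · b x y₀
  -- for some integer t, so v - tx pairs integrally with y₀; it is outside B, and the x^⊥-component
  -- of a witness against v - tx is a witness against v.
  perp-wit : ∀ {v} → A v → ¬ (B +ℤ x) v → ∃ λ y → (A′ ⊥ℤ[ b ] x) y × ¬ IsInt (b v y)
  perp-wit {v} Av ¬Bv = case₁ (int? (b v (ℕtoℚ p ⊙ y₀)))
    where
    expand : ∀ a t y → b (v ⊖ t ⊙ x) y ≡ a ℚ.* (b v y₀ ℚ.- t ℚ.* b x y₀) ℚ.+ (b v (y ⊖ a ⊙ y₀) ℚ.- t ℚ.* b x (y ⊖ a ⊙ y₀))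
    expand a t y = trans (expandˡ v t y) (trans (decompose-identity (b v y) t (b x y) a (b v y₀) (b x y₀))
      (cong₂ (λ s s′ → a ℚ.* (b v y₀ ℚ.- t ℚ.* b x y₀) ℚ.+ (s ℚ.- t ℚ.* s′)) (sym (expandʳ v y a)) (sym (expandʳ x y a))))
    case₂ : ∀ t → IsInt (b v y₀ ℚ.- toℚ t ℚ.* b x y₀) → ∀ y → A′ y → ¬ IsInt (b (v ⊖ toℚ t ⊙ x) y) →
      ((A′ ⊥ℤ[ b ] x) +ℤ y₀) y → ∃ λ y → (A′ ⊥ℤ[ b ] x) y × ¬ IsInt (b v y)
    case₂ t j y A′y ¬k (a , A₁) = y ⊖ toℚ a ⊙ y₀ , A₁ , λ l → ¬k (int-resp (sym (expand (toℚ a) (toℚ t) y))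
      (int-+ (int-* (int-toℚ a) j) (int-- l (int-* (int-toℚ t) (proj₂ A₁)))))
    case₁ : Dec (IsInt (b v (ℕtoℚ p ⊙ y₀))) → ∃ λ y → (A′ ⊥ℤ[ b ] x) y × ¬ IsInt (b v y)
    case₁ (no ¬i) = ℕtoℚ p ⊙ y₀ , A₁py₀ , ¬i
    case₁ (yes i) = let (t , j) = fraction pp (p·int A′y₀) ¬int₀ (int-resp (mulʳ bl (ℕtoℚ p) v y₀) i)
                        (y , A′y , ¬k) = wit rad (sub sA Av (mul sA t Ax)) (λ q → ¬Bv (t , q))
                    in case₂ t j y A′y ¬k (decompose A′y)

  perp-radical : Radical A (A′ ⊥ℤ[ b ] x) b (B +ℤ x)
  perp-radical = record { sound = perp-sound ; wit = perp-wit }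

m<m*p : ∀ {p m} → Prime p → m ℕ.> 0 → m ℕ.< m ℕ.* p
m<m*p {p} {m} pp m>0 = ℕP.m<m*n m p {{ℕ.>-nonZero m>0}} (ℕ.nonTrivial⇒n>1 p {{prime⇒nonTrivial pp}})

-- The decreasing measure of the inductions below: adjoining x to B divides the index in H by p. The
-- test for B + ℤx that the splitting needs comes from its p cosets of B.
module Enlarge {I : Set} {H B : Pred (W I)} {x : W I} {p h : ℕ}
  (sH : Subgroup H) (sB : Subgroup B) (B⊆H : ∀ {v} → B v → H v) (c : Card H B h)
  (Hx : H x) (¬Bx : ¬ B x) (pp : Prime p) (Bpx : B (ℕtoℚ p ⊙ x)) where

  sB₁ : Subgroup (B +ℤ x)
  sB₁ = +ℤ-subgroup sB x

  B₁⊆H : ∀ {v} → (B +ℤ x) v → H v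
  B₁⊆H = +ℤ-⊆ {A = H} {B = B} {x = x} sH B⊆H Hx

  cyc : Card (B +ℤ x) B p
  cyc = cyclic-card pp sB x ¬Bx Bpx

  both : ∃ λ i → ∃ λ j → Card H (B +ℤ x) i × Card (B +ℤ x) B j × h ≡ i ℕ.* j
  both = card-between sH sB₁ sB B₁⊆H (+ℤ-base sB x) (card-dec-mid sH sB₁ sB B₁⊆H (+ℤ-base sB x) c cyc) c

  index : ℕ
  index = proj₁ both

  index-card : Card H (B +ℤ x) index
  index-card = proj₁ (proj₂ (proj₂ both))

  index-eq : h ≡ index ℕ.* p
  index-eq = trans (proj₂ (proj₂ (proj₂ (proj₂ both)))) (cong (index ℕ.*_) (card-unique sB (proj₁ (proj₂ (proj₂ (proj₂ both)))) cyc))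

  index-< : index ℕ.< h
  index-< = subst (index ℕ.<_) (sym index-eq) (m<m*p pp (card->0 sH index-card))

⊥ℤ-dec : ∀ {I I′} {A′ : Pred (W I′)} {b : W I → W I′ → ℚ} (x : W I) → ∀ v → A′ v → Dec ((A′ ⊥ℤ[ b ] x) v)
⊥ℤ-dec {b = b} x v A′v with int? (b x v)
... | yes i = yes (A′v , i)
... | no ¬i = no λ q → ¬i (proj₂ q)

-- H is absorbed into the radical one element of prime order at a time while A′ shrinks to x^⊥. Once
-- the radical equals H, what is left of A′ annihilates H, and the radical's own witness against w
-- is the required y.
biduality : ∀ {I I′} {A B H : Pred (W I)} {A′ : Pred (W I′)} {b : W I → W I′ → ℚ} {h} →
  Subgroup A → Subgroup B → Subgroup H → Subgroup A′ → Bilinear b → Radical A A′ b B →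
  (∀ {v} → B v → H v) → (∀ {v} → H v → A v) → Card H B h →
  ∀ w → A w → ¬ H w → ∃ λ y → A′ y × (∀ v → H v → IsInt (b v y)) × ¬ IsInt (b w y)
biduality {I} {I′} {A} {H = H} {b = b} {h = h} sA sB sH sA′ bl rad B⊆H H⊆A c w Aw ¬Hw = go h (<-wellFounded h) sB sA′ rad B⊆H c
  where
  Goal : Pred (W I′) → Set
  Goal A′ = ∃ λ y → A′ y × (∀ v → H v → IsInt (b v y)) × ¬ IsInt (b w y)
  go : ∀ h → Acc ℕ._<_ h → ∀ {B : Pred (W I)} {A′ : Pred (W I′)} → Subgroup B → Subgroup A′ → Radical A A′ b B →
    (∀ {v} → B v → H v) → Card H B h → Goal A′
  go h (acc rec) {B} {A′} sB sA′ rad B⊆H c = split-cases (h ℕ.≟ 1)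
    where
    step : (∃ λ x → H x × ¬ B x × ∃ λ p → Prime p × B (ℕtoℚ p ⊙ x)) → Goal A′
    step (x , Hx , ¬Bx , p , pp , Bpx) =
      let (y , (A′y , _) , r) = go E.index (rec E.index-<) E.sB₁ S.sA₁ S.perp-radical E.B₁⊆H E.index-card in y , A′y , r
      where
      module S = PrimeStep sA sB sA′ bl rad (H⊆A Hx) ¬Bx pp Bpx
      module E = Enlarge sH sB B⊆H c Hx ¬Bx pp Bpx
    split-cases : Dec (h ≡ 1) → Goal A′
    split-cases (no h≢1) = step (prime-order sH sB c h≢1)
    split-cases (yes h≡1) = let (y , A′y , ¬i) = wit rad Aw (λ Bw → ¬Hw (B⊆H Bw)) in
        y , A′y , (λ v Hv → sound rad (card-1 sH sB (subst (Card H B) h≡1 c) v Hv) A′y) , ¬i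

-- Replacing B by B + ℤx and A′ by x^⊥ divides both indices by the same prime and preserves both
-- radicals.
duality : ∀ {I I′} {A B : Pred (W I)} {A′ B′ : Pred (W I′)} {b : W I → W I′ → ℚ} {k k′} →
  Subgroup A → Subgroup B → Subgroup A′ → Subgroup B′ → Bilinear b →
  Radical A A′ b B → Radical A′ A (λ y u → b u y) B′ →
  (∀ {v} → B v → A v) → (∀ {v} → B′ v → A′ v) → Card A B k → Card A′ B′ k′ → k ≡ k′
duality {I} {I′} {A} {B′ = B′} {b = b} {k} sA sB sA′ sB′ bl rad rad′ B⊆A B′⊆A′ c c′ = go k (<-wellFounded k) sB sA′ rad rad′ B⊆A B′⊆A′ c c′
  where
  go : ∀ k → Acc ℕ._<_ k → ∀ {k′} {B : Pred (W I)} {A′ : Pred (W I′)} → Subgroup B → Subgroup A′ →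
    Radical A A′ b B → Radical A′ A (λ y u → b u y) B′ →
    (∀ {v} → B v → A v) → (∀ {v} → B′ v → A′ v) → Card A B k → Card A′ B′ k′ → k ≡ k′
  go k (acc rec) {k′} {B} {A′} sB sA′ rad rad′ B⊆A B′⊆A′ c c′ = split-cases (k ℕ.≟ 1)
    where
    -- At index 1 all of A = B annihilates A′, which contradicts any witness against membership in
    -- B′.
    A′⊆B′ : k ≡ 1 → ∀ {v} → Dec (B′ v) → A′ v → B′ v
    A′⊆B′ k≡1 (yes q) A′v = q
    A′⊆B′ k≡1 (no ¬q) A′v = let (u , Au , ¬i) = wit rad′ A′v ¬q in
      ⊥-elim (¬i (sound rad (card-1 sA sB (subst (Card A B) k≡1 c) u Au) A′v))
    step : (∃ λ x → A x × ¬ B x × ∃ λ p → Prime p × B (ℕtoℚ p ⊙ x)) → k ≡ k′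
    step (x , Ax , ¬Bx , p , pp , Bpx) = begin
      k               ≡⟨ E.index-eq ⟩
      E.index ℕ.* p   ≡⟨ cong (ℕ._* p) ih ⟩
      j′ ℕ.* p        ≡⟨ ℕP.*-comm j′ p ⟩
      p ℕ.* j′        ≡⟨ cong (ℕ._* j′) (card-unique S.sA₁ S.perp-card (proj₁ (proj₂ (proj₂ perp)))) ⟩
      _               ≡⟨ proj₂ (proj₂ (proj₂ (proj₂ perp))) ⟨
      k′              ∎
      where
      open ≡-Reasoning
      module S = PrimeStep sA sB sA′ bl rad Ax ¬Bx pp Bpx
      module E = Enlarge sA sB B⊆A c Ax ¬Bx pp Bpx
      B′⊆A₁ : ∀ {v} → B′ v → (A′ ⊥ℤ[ b ] x) v
      B′⊆A₁ q = B′⊆A′ q , sound rad′ q Ax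
      perp : ∃ λ i → ∃ λ j → Card A′ (A′ ⊥ℤ[ b ] x) i × Card (A′ ⊥ℤ[ b ] x) B′ j × k′ ≡ i ℕ.* j
      perp = card-between sA′ S.sA₁ sB′ proj₁ B′⊆A₁ (⊥ℤ-dec {b = b} x) c′
      j′ : ℕ
      j′ = proj₁ (proj₂ perp)
      ih : E.index ≡ j′
      ih = go E.index (rec E.index-<) E.sB₁ S.sA₁ S.perp-radical
        (record { sound = λ q Au → sound rad′ q Au ; wit = λ (A′v , _) ¬q → wit rad′ A′v ¬q })
        E.B₁⊆H B′⊆A₁ E.index-card (proj₁ (proj₂ (proj₂ (proj₂ perp))))
    split-cases : Dec (k ≡ 1) → k ≡ k′
    split-cases (no k≢1) = step (prime-order sA sB c k≢1)
    split-cases (yes k≡1) = trans k≡1 (card-unique sB′ (card-trivial sA′ sB′ (λ {v} A′v → A′⊆B′ k≡1 (card-dec sA′ sB′ c′ v A′v) A′v)) c′)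

square-* : ∀ p a → p ℕ.* ((a ℕ.* a) ℕ.* p) ≡ (p ℕ.* a) ℕ.* (p ℕ.* a)
square-* = ℕS.solve 2 (λ p a → p ℕS.:* ((a ℕS.:* a) ℕS.:* p) ℕS.:= (p ℕS.:* a) ℕS.:* (p ℕS.:* a)) refl

square-step : ∀ {k i j p} → k ≡ p ℕ.* j → j ≡ i ℕ.* p → (∃ λ a → i ≡ a ℕ.* a) → ∃ λ a → k ≡ a ℕ.* a
square-step {p = p} k≡ j≡ (a , i≡) = p ℕ.* a , trans k≡ (trans (cong (p ℕ.*_) (trans j≡ (cong (ℕ._* p) i≡))) (square-* p a))

-- One factor p is lost in passing from A to x^⊥, as b x maps onto (1/p)ℤ/ℤ. Since b x x is
-- integral, x lies in x^⊥, and there the radical grows to B + ℤx, which costs the second factor p.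
alternating-square : ∀ {I} {A B : Pred (W I)} {b : W I → W I → ℚ} {k} →
  Subgroup A → Subgroup B → Bilinear b → Radical A A b B → (∀ v → A v → IsInt (b v v)) →
  (∀ {v} → B v → A v) → Card A B k → ∃ λ a → k ≡ a ℕ.* a
alternating-square {I} {b = b} {k} sA sB bl rad alt B⊆A c = go k (<-wellFounded k) sA sB rad alt B⊆A c
  where
  go : ∀ k → Acc ℕ._<_ k → ∀ {A B : Pred (W I)} → Subgroup A → Subgroup B → Radical A A b B → (∀ v → A v → IsInt (b v v)) →
    (∀ {v} → B v → A v) → Card A B k → ∃ λ a → k ≡ a ℕ.* a
  go k (acc rec) {A} {B} sA sB rad alt B⊆A c = split-cases (k ℕ.≟ 1)
    where
    -- Polarisation: alternating modulo ℤ implies skew-symmetric modulo ℤ. This places the left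
    -- radical B inside x^⊥, which is defined by pairing on the other side.
    skew : ∀ u v → A u → A v → IsInt (b u v) → IsInt (b v u)
    skew u v Au Av i = int-resp eq (int-- (int-+ (alt u Au) (int-- (alt v Av) (alt (u ⊖ v) (sub sA Au Av)))) i)
      where
      eq : (b u u ℚ.+ (b v v ℚ.- b (u ⊖ v) (u ⊖ v))) ℚ.- b u v ≡ b v u
      eq = trans (cong (λ t → (b u u ℚ.+ (b v v ℚ.- t)) ℚ.- b u v) (trans (subˡ bl u v (u ⊖ v)) (cong₂ ℚ._-_ (subʳ bl u u v) (subʳ bl v u v))))
        (skew-identity (b u u) (b v v) (b u v) (b v u))
    step : (∃ λ x → A x × ¬ B x × ∃ λ p → Prime p × B (ℕtoℚ p ⊙ x)) → ∃ λ a → k ≡ a ℕ.* a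
    step (x , Ax , ¬Bx , p , pp , Bpx) = square-step {i = E.index} {p = p} k≡pj E.index-eq ih
      where
      module S = PrimeStep sA sB sA bl rad Ax ¬Bx pp Bpx
      A₁ : Pred (W I)
      A₁ = A ⊥ℤ[ b ] x
      B⊆A₁ : ∀ {v} → B v → A₁ v
      B⊆A₁ {v} q = B⊆A q , skew v x (B⊆A q) Ax (sound rad q Ax)
      top : ∃ λ i → ∃ λ j → Card A A₁ i × Card A₁ B j × k ≡ i ℕ.* j
      top = card-between sA S.sA₁ sB proj₁ B⊆A₁ (⊥ℤ-dec {b = b} x) c
      j : ℕ
      j = proj₁ (proj₂ top)
      module E = Enlarge {h = j} S.sA₁ sB B⊆A₁ (proj₁ (proj₂ (proj₂ (proj₂ top)))) (Ax , alt x Ax) ¬Bx pp Bpx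
      k≡pj : k ≡ p ℕ.* j
      k≡pj = trans (proj₂ (proj₂ (proj₂ (proj₂ top)))) (cong (ℕ._* j) (card-unique S.sA₁ (proj₁ (proj₂ (proj₂ top))) S.perp-card))
      j<k : j ℕ.< k
      j<k = subst (j ℕ.<_) (trans (ℕP.*-comm j p) (sym k≡pj)) (m<m*p pp (ℕP.≤-<-trans ℕ.z≤n E.index-<))
      ih : ∃ λ a → E.index ≡ a ℕ.* a
      ih = go E.index (rec (ℕP.<-trans E.index-< j<k)) S.sA₁ E.sB₁
        (record { sound = S.perp-sound ; wit = λ (Av , _) → S.perp-wit Av })
        (λ v (Av , _) → alt v Av) E.B₁⊆H E.index-card
    split-cases : Dec (k ≡ 1) → ∃ λ a → k ≡ a ℕ.* a
    split-cases (no k≢1) = step (prime-order sA sB c k≢1)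
    split-cases (yes k≡1) = 1 , k≡1

-- Determinants

Σℤ-cong : ∀ {n} {f g : Fin n → ℤ} → (∀ i → f i ≡ g i) → Σℤ f ≡ Σℤ g
Σℤ-cong {zero} h = refl
Σℤ-cong {suc n} h = cong₂ ℤ._+_ (h zero) (Σℤ-cong (λ i → h (suc i)))

Σℤ-0 : ∀ {n} {f : Fin n → ℤ} → (∀ i → f i ≡ + 0) → Σℤ f ≡ + 0
Σℤ-0 {zero} h = refl
Σℤ-0 {suc n} h = cong₂ ℤ._+_ (h zero) (Σℤ-0 (λ i → h (suc i)))

ℤ-sub-interchange : ∀ a b c d q → (a ℤ.- q ℤ.* b) ℤ.+ (c ℤ.- q ℤ.* d) ≡ (a ℤ.+ c) ℤ.- q ℤ.* (b ℤ.+ d)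
ℤ-sub-interchange = ℤS.solve 5 (λ a b c d q → (a :- q :* b) :+ (c :- q :* d) := (a :+ c) :- q :* (b :+ d)) refl
  where open ℤS

ℤ-0-q0 : ∀ q → + 0 ≡ + 0 ℤ.- q ℤ.* + 0
ℤ-0-q0 = ℤS.solve 1 (λ q → con (+ 0) := con (+ 0) :- q :* con (+ 0)) refl
  where open ℤS

Σℤ-sub : ∀ {n} q (f g : Fin n → ℤ) → Σℤ (λ i → f i ℤ.- q ℤ.* g i) ≡ Σℤ f ℤ.- q ℤ.* Σℤ g
Σℤ-sub {zero} q f g = ℤ-0-q0 q
Σℤ-sub {suc n} q f g = trans (cong (λ t → (f zero ℤ.- q ℤ.* g zero) ℤ.+ t) (Σℤ-sub q (λ i → f (suc i)) (λ i → g (suc i))))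
  (ℤ-sub-interchange (f zero) (g zero) (Σℤ (λ i → f (suc i))) (Σℤ (λ i → g (suc i))) q)

sgn : ℕ → ℤ
sgn zero = + 1
sgn (suc k) = ℤ.- sgn k

minor : ∀ {n} → Fin (suc n) → (Fin (suc n) → Fin (suc n) → ℤ) → Fin n → Fin n → ℤ
minor j c k i = c (punchIn j k) (suc i)

-- The first index of a matrix is its column.
det : ∀ {n} → (Fin n → Fin n → ℤ) → ℤ
det {zero} c = + 1
det {suc n} c = Σℤ (λ j → sgn (toℕ j) ℤ.* (c j zero ℤ.* det (minor j c)))

det-cong : ∀ {n} {c c′ : Fin n → Fin n → ℤ} → (∀ j i → c j i ≡ c′ j i) → det c ≡ det c′
det-cong {zero} h = refl
det-cong {suc n} h = Σℤ-cong (λ j → cong (sgn (toℕ j) ℤ.*_) (cong₂ ℤ._*_ (h j zero) (det-cong (λ k i → h (punchIn j k) (suc i)))))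

lin-head : ∀ s x q y d → s ℤ.* ((x ℤ.- q ℤ.* y) ℤ.* d) ≡ s ℤ.* (x ℤ.* d) ℤ.- q ℤ.* (s ℤ.* (y ℤ.* d))
lin-head = ℤS.solve 5 (λ s x q y d → s :* ((x :- q :* y) :* d) := s :* (x :* d) :- q :* (s :* (y :* d))) refl
  where open ℤS

lin-minor : ∀ s x q d e → s ℤ.* (x ℤ.* (d ℤ.- q ℤ.* e)) ≡ s ℤ.* (x ℤ.* d) ℤ.- q ℤ.* (s ℤ.* (x ℤ.* e))
lin-minor = ℤS.solve 5 (λ s x q d e → s :* (x :* (d :- q :* e)) := s :* (x :* d) :- q :* (s :* (x :* e))) refl
  where open ℤS

det-linear : ∀ {n} k q (c c′ c″ : Fin n → Fin n → ℤ) → (∀ i → c″ k i ≡ c k i ℤ.- q ℤ.* c′ k i) →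
  (∀ j → j ≢ k → ∀ i → c″ j i ≡ c j i) → (∀ j → j ≢ k → ∀ i → c′ j i ≡ c j i) →
  det c″ ≡ det c ℤ.- q ℤ.* det c′
det-linear {suc n} k q c c′ c″ at off″ off′ = trans (Σℤ-cong (λ j → term j (j FinP.≟ k)))
  (Σℤ-sub q (λ j → sgn (toℕ j) ℤ.* (c j zero ℤ.* det (minor j c))) (λ j → sgn (toℕ j) ℤ.* (c′ j zero ℤ.* det (minor j c′))))
  where
  term : ∀ j → Dec (j ≡ k) → sgn (toℕ j) ℤ.* (c″ j zero ℤ.* det (minor j c″)) ≡
    sgn (toℕ j) ℤ.* (c j zero ℤ.* det (minor j c)) ℤ.- q ℤ.* (sgn (toℕ j) ℤ.* (c′ j zero ℤ.* det (minor j c′)))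
  term j (yes refl) = trans
    (cong (sgn (toℕ j) ℤ.*_) (cong₂ ℤ._*_ (at zero) (det-cong (λ k i → off″ (punchIn j k) (FinP.punchInᵢ≢i j k) (suc i)))))
    (trans (lin-head (sgn (toℕ j)) (c j zero) q (c′ j zero) (det (minor j c)))
      (cong (λ t → sgn (toℕ j) ℤ.* (c j zero ℤ.* det (minor j c)) ℤ.- q ℤ.* (sgn (toℕ j) ℤ.* (c′ j zero ℤ.* t)))
        (sym (det-cong (λ k i → off′ (punchIn j k) (FinP.punchInᵢ≢i j k) (suc i))))))
  term j (no j≢k) = trans
    (cong (sgn (toℕ j) ℤ.*_) (cong₂ ℤ._*_ (off″ j j≢k zero)
      (det-linear (punchOut j≢k) q (minor j c) (minor j c′) (minor j c″)
        (λ i → subst (λ l → c″ l (suc i) ≡ c l (suc i) ℤ.- q ℤ.* c′ l (suc i)) (sym (FinP.punchIn-punchOut j≢k)) (at (suc i)))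
        (λ l l≢ i → off″ (punchIn j l) (λ eq → l≢ (FinP.punchIn-injective j l _ (trans eq (sym (FinP.punchIn-punchOut j≢k))))) (suc i))
        (λ l l≢ i → off′ (punchIn j l) (λ eq → l≢ (FinP.punchIn-injective j l _ (trans eq (sym (FinP.punchIn-punchOut j≢k))))) (suc i)))))
    (trans (lin-minor (sgn (toℕ j)) (c j zero) q (det (minor j c)) (det (minor j c′)))
      (cong (λ t → sgn (toℕ j) ℤ.* (c j zero ℤ.* det (minor j c)) ℤ.- q ℤ.* (sgn (toℕ j) ℤ.* (t ℤ.* det (minor j c′))))
        (sym (off′ j j≢k zero))))

Σℤ-adjacent : ∀ {n} (i : Fin n) (f : Fin (suc n) → ℤ) → (∀ j → j ≢ inject₁ i → j ≢ suc i → f j ≡ + 0) →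
  f (inject₁ i) ℤ.+ f (suc i) ≡ + 0 → Σℤ f ≡ + 0
Σℤ-adjacent {suc n} zero f h e = trans (sym (ℤP.+-assoc (f zero) (f (suc zero)) (Σℤ (λ j → f (suc (suc j))))))
  (cong₂ ℤ._+_ e (Σℤ-0 (λ j → h (suc (suc j)) (λ ()) (λ ()))))
Σℤ-adjacent {suc n} (suc i) f h e = cong₂ ℤ._+_ (h zero (λ ()) (λ ()))
  (Σℤ-adjacent i (λ j → f (suc j)) (λ j p q → h (suc j) (λ eq → p (FinP.suc-injective eq)) (λ eq → q (FinP.suc-injective eq))) e)

punchIn-adjacent : ∀ {n} {X : Set} (i : Fin n) (c : Fin (suc n) → X) → c (inject₁ i) ≡ c (suc i) →
  ∀ k → c (punchIn (inject₁ i) k) ≡ c (punchIn (suc i) k)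
punchIn-adjacent zero c e zero = sym e
punchIn-adjacent zero c e (suc k) = refl
punchIn-adjacent (suc i) c e zero = refl
punchIn-adjacent (suc i) c e (suc k) = punchIn-adjacent i (λ j → c (suc j)) e k

adjacent-minor : ∀ {n} (i : Fin (suc n)) (j : Fin (suc (suc n))) → j ≢ inject₁ i → j ≢ suc i →
  ∃ λ (k : Fin n) → punchIn j (inject₁ k) ≡ inject₁ i × punchIn j (suc k) ≡ suc i
adjacent-minor zero zero p q = ⊥-elim (p refl)
adjacent-minor (suc i) zero p q = i , refl , refl
adjacent-minor zero (suc zero) p q = ⊥-elim (q refl)
adjacent-minor {suc n} zero (suc (suc j)) p q = zero , refl , refl
adjacent-minor {suc n} (suc i) (suc j) p q =
  let (k , e , e′) = adjacent-minor i j (λ eq → p (cong suc eq)) (λ eq → q (cong suc eq)) in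
  suc k , cong suc e , cong suc e′

sgn-cancel : ∀ s x → s ℤ.* x ℤ.+ (ℤ.- s) ℤ.* x ≡ + 0
sgn-cancel = ℤS.solve 2 (λ s x → s :* x :+ (:- s) :* x := con (+ 0)) refl
  where open ℤS

mul-0 : ∀ s x → s ℤ.* (x ℤ.* + 0) ≡ + 0
mul-0 = ℤS.solve 2 (λ s x → s :* (x :* con (+ 0)) := con (+ 0)) refl
  where open ℤS

mul-0′ : ∀ s x → s ℤ.* (+ 0 ℤ.* x) ≡ + 0
mul-0′ = ℤS.solve 2 (λ s x → s :* (con (+ 0) :* x) := con (+ 0)) refl
  where open ℤS

-- In the expansion, deleting a third column leaves the equal columns adjacent, so that term
-- vanishes by induction. The two terms left have equal minors and opposite signs.
det-alternating : ∀ {n} (i : Fin n) (c : Fin (suc n) → Fin (suc n) → ℤ) → (∀ r → c (inject₁ i) r ≡ c (suc i) r) → det c ≡ + 0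
det-alternating {suc n} i c e = Σℤ-adjacent i (λ j → sgn (toℕ j) ℤ.* (c j zero ℤ.* det (minor j c))) other pair-cancels
  where
  other : ∀ j → j ≢ inject₁ i → j ≢ suc i → sgn (toℕ j) ℤ.* (c j zero ℤ.* det (minor j c)) ≡ + 0
  other j p q = let (k , e₁ , e₂) = adjacent-minor i j p q in
    trans (cong (λ t → sgn (toℕ j) ℤ.* (c j zero ℤ.* t)) (det-alternating k (minor j c)
      (λ r → trans (cong (λ l → c l (suc r)) e₁) (trans (e (suc r)) (cong (λ l → c l (suc r)) (sym e₂))))))
    (mul-0 (sgn (toℕ j)) (c j zero))
  pair-cancels : sgn (toℕ (inject₁ i)) ℤ.* (c (inject₁ i) zero ℤ.* det (minor (inject₁ i) c)) ℤ.+
    sgn (toℕ (Fin.suc i)) ℤ.* (c (suc i) zero ℤ.* det (minor (suc i) c)) ≡ + 0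
  pair-cancels = trans (cong₂ (λ s t → s ℤ.+ ℤ.- sgn (toℕ i) ℤ.* t)
      (cong₂ (λ k t → sgn k ℤ.* t) (FinP.toℕ-inject₁ i) refl)
      (cong₂ ℤ._*_ (sym (e zero)) (det-cong (λ k r → sym (punchIn-adjacent i (λ j → c j (suc r)) (e (suc r)) k)))))
    (sgn-cancel (sgn (toℕ i)) _)

set₂ : ∀ {n} {R : Set} → Fin n → (u w : R → ℤ) → (Fin (suc n) → R → ℤ) → Fin (suc n) → R → ℤ
set₂ zero u w c zero = u
set₂ zero u w c (suc zero) = w
set₂ zero u w c (suc (suc j)) = c (suc (suc j))
set₂ (suc i) u w c zero = c zero
set₂ (suc i) u w c (suc j) = set₂ i u w (λ j → c (suc j)) j

set₂-fst : ∀ {n R} (i : Fin n) {u w : R → ℤ} {c} r → set₂ i u w c (inject₁ i) r ≡ u r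
set₂-fst zero r = refl
set₂-fst (suc i) r = set₂-fst i r

set₂-snd : ∀ {n R} (i : Fin n) {u w : R → ℤ} {c} r → set₂ i u w c (suc i) r ≡ w r
set₂-snd zero r = refl
set₂-snd (suc i) r = set₂-snd i r

set₂-off-fst : ∀ {n R} (i : Fin n) {u u′ w : R → ℤ} {c} j → j ≢ inject₁ i → ∀ r → set₂ i u w c j r ≡ set₂ i u′ w c j r
set₂-off-fst zero zero p r = ⊥-elim (p refl)
set₂-off-fst zero (suc zero) p r = refl
set₂-off-fst zero (suc (suc j)) p r = refl
set₂-off-fst (suc i) zero p r = refl
set₂-off-fst (suc i) (suc j) p r = set₂-off-fst i j (λ eq → p (cong suc eq)) r

set₂-off-snd : ∀ {n R} (i : Fin n) {u w w′ : R → ℤ} {c} j → j ≢ suc i → ∀ r → set₂ i u w c j r ≡ set₂ i u w′ c j r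
set₂-off-snd zero zero p r = refl
set₂-off-snd zero (suc zero) p r = ⊥-elim (p refl)
set₂-off-snd zero (suc (suc j)) p r = refl
set₂-off-snd (suc i) zero p r = refl
set₂-off-snd (suc i) (suc j) p r = set₂-off-snd i j (λ eq → p (cong suc eq)) r

set₂-self : ∀ {n R} (i : Fin n) (c : Fin (suc n) → R → ℤ) j r → set₂ i (c (inject₁ i)) (c (suc i)) c j r ≡ c j r
set₂-self zero c zero r = refl
set₂-self zero c (suc zero) r = refl
set₂-self zero c (suc (suc j)) r = refl
set₂-self (suc i) c zero r = refl
set₂-self (suc i) c (suc j) r = set₂-self i (λ j → c (suc j)) j r

-- One step of Euclid's algorithm, (a, b) ↦ (b, a - qb), in two adjacent places. Swap and
-- subtraction are fused, so this is the only column operation needed and each use changes the sign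
-- of the determinant.
Ts : ∀ {l} → Fin l → ℤ → (Fin (suc l) → ℤ) → Fin (suc l) → ℤ
Ts zero q a zero = a (suc zero)
Ts zero q a (suc zero) = a zero ℤ.- q ℤ.* a (suc zero)
Ts zero q a (suc (suc j)) = a (suc (suc j))
Ts (suc i) q a zero = a zero
Ts (suc i) q a (suc j) = Ts i q (λ j → a (suc j)) j

T : ∀ {l} {R : Set} → Fin l → ℤ → (Fin (suc l) → R → ℤ) → Fin (suc l) → R → ℤ
T i q c j r = Ts i q (λ j → c j r) j

T-set₂ : ∀ {n R} (i : Fin n) q (c : Fin (suc n) → R → ℤ) j r →
  T i q c j r ≡ set₂ i (c (suc i)) (λ r → c (inject₁ i) r ℤ.- q ℤ.* c (suc i) r) c j r
T-set₂ zero q c zero r = refl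
T-set₂ zero q c (suc zero) r = refl
T-set₂ zero q c (suc (suc j)) r = refl
T-set₂ (suc i) q c zero r = refl
T-set₂ (suc i) q c (suc j) r = T-set₂ i q (λ j → c (suc j)) j r

swap-identity : ∀ x y → + 0 ≡ ((+ 0) ℤ.- (+ 1) ℤ.* x) ℤ.- (+ 1) ℤ.* (y ℤ.- (+ 1) ℤ.* (+ 0)) → y ≡ ℤ.- x
swap-identity x y e = trans (ℤS.solve 2 (λ x y → y := :- x :- ((con (+ 0) :- con (+ 1) :* x) :- con (+ 1) :* (y :- con (+ 1) :* con (+ 0)))) refl x y)
  (trans (cong (λ t → ℤ.- x ℤ.- t) (sym e)) (ℤP.+-identityʳ (ℤ.- x)))
  where open ℤS

det-T : ∀ {n} (i : Fin n) q (c : Fin (suc n) → Fin (suc n) → ℤ) → det (T i q c) ≡ ℤ.- det c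
det-T {n} i q c = begin
  det (T i q c)                          ≡⟨ det-cong (T-set₂ i q c) ⟩
  S b (λ r → a r ℤ.- q ℤ.* b r)          ≡⟨ lin₂ q b a b ⟩
  S b a ℤ.- q ℤ.* S b b                  ≡⟨ cong (λ t → S b a ℤ.- q ℤ.* t) (alt b) ⟩
  S b a ℤ.- q ℤ.* + 0                    ≡⟨ trans (cong (λ t → S b a ℤ.- t) (ℤP.*-zeroʳ q)) (ℤP.+-identityʳ (S b a)) ⟩
  S b a                                  ≡⟨ swap-identity (S a b) (S b a) expanded ⟩
  ℤ.- S a b                              ≡⟨ cong ℤ.-_ (det-cong (set₂-self i c)) ⟩
  ℤ.- det c                              ∎
  where
  open ≡-Reasoning
  a b : Fin (suc n) → ℤ
  a = c (inject₁ i)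
  b = c (suc i)
  S : (u w : Fin (suc n) → ℤ) → ℤ
  S u w = det (set₂ i u w c)
  alt : ∀ u → S u u ≡ + 0
  alt u = det-alternating i (set₂ i u u c) (λ r → trans (set₂-fst i r) (sym (set₂-snd i r)))
  lin₁ : ∀ q w u u′ → S (λ r → u r ℤ.- q ℤ.* u′ r) w ≡ S u w ℤ.- q ℤ.* S u′ w
  lin₁ q w u u′ = det-linear (inject₁ i) q (set₂ i u w c) (set₂ i u′ w c) (set₂ i (λ r → u r ℤ.- q ℤ.* u′ r) w c)
    (λ r → trans (set₂-fst i r) (cong₂ (λ x y → x ℤ.- q ℤ.* y) (sym (set₂-fst i r)) (sym (set₂-fst i r))))
    (λ j p → set₂-off-fst i j p) (λ j p → set₂-off-fst i j p)
  lin₂ : ∀ q u w w′ → S u (λ r → w r ℤ.- q ℤ.* w′ r) ≡ S u w ℤ.- q ℤ.* S u w′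
  lin₂ q u w w′ = det-linear (suc i) q (set₂ i u w c) (set₂ i u w′ c) (set₂ i u (λ r → w r ℤ.- q ℤ.* w′ r) c)
    (λ r → trans (set₂-snd i r) (cong₂ (λ x y → x ℤ.- q ℤ.* y) (sym (set₂-snd i r)) (sym (set₂-snd i r))))
    (λ j p → set₂-off-snd i j p) (λ j p → set₂-off-snd i j p)
  -- Polarisation with d = a - b: expanding S d d = 0 leaves S a b + S b a = 0.
  d : Fin (suc n) → ℤ
  d r = a r ℤ.- (+ 1) ℤ.* b r
  expanded : + 0 ≡ ((+ 0) ℤ.- (+ 1) ℤ.* S a b) ℤ.- (+ 1) ℤ.* (S b a ℤ.- (+ 1) ℤ.* (+ 0))
  expanded = trans (sym (alt d)) (trans (lin₁ (+ 1) d a b) (cong₂ (λ x y → x ℤ.- (+ 1) ℤ.* y)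
    (trans (lin₂ (+ 1) a a b) (cong (λ t → t ℤ.- (+ 1) ℤ.* S a b) (alt a)))
    (trans (lin₂ (+ 1) b a b) (cong (λ t → S b a ℤ.- (+ 1) ℤ.* t) (alt b)))))

det-first-row : ∀ {n} (c : Fin (suc n) → Fin (suc n) → ℤ) → (∀ j → c (suc j) zero ≡ + 0) → det c ≡ c zero zero ℤ.* det (minor zero c)
det-first-row c h = trans (cong₂ ℤ._+_ (ℤP.*-identityˡ (c zero zero ℤ.* det (minor zero c)))
  (Σℤ-0 (λ j → trans (cong (λ t → sgn (suc (toℕ j)) ℤ.* (t ℤ.* det (minor (suc j) c))) (h j)) (mul-0′ (sgn (suc (toℕ j))) (det (minor (suc j) c))))))
  (ℤP.+-identityʳ (c zero zero ℤ.* det (minor zero c)))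

-- Congruences

infix 4 _≡_[mod_]

record _≡_[mod_] (a b m : ℤ) : Set where
  constructor modulo
  field
    quotient : ℤ
    equation : a ≡ b ℤ.+ quotient ℤ.* m

mod-refl : ∀ {a b m} → a ≡ b → a ≡ b [mod m ]
mod-refl {a} {b} {m} e = modulo (+ 0) (trans e (sym (trans (cong (λ t → b ℤ.+ t) (ℤP.*-zeroˡ m)) (ℤP.+-identityʳ b))))

mod-+ : ∀ {a b c d m} → a ≡ b [mod m ] → c ≡ d [mod m ] → a ℤ.+ c ≡ b ℤ.+ d [mod m ]
mod-+ {a} {b} {c} {d} {m} (modulo k e) (modulo l f) = modulo (k ℤ.+ l) (trans (cong₂ ℤ._+_ e f)
  (ℤS.solve 5 (λ b k m d l → (b :+ k :* m) :+ (d :+ l :* m) := (b :+ d) :+ (k :+ l) :* m) refl b k m d l))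
  where open ℤS

mod-* : ∀ {a b c d m} → a ≡ b [mod m ] → c ≡ d [mod m ] → a ℤ.* c ≡ b ℤ.* d [mod m ]
mod-* {a} {b} {c} {d} {m} (modulo k e) (modulo l f) = modulo (k ℤ.* d ℤ.+ (b ℤ.* l ℤ.+ k ℤ.* m ℤ.* l)) (trans (cong₂ ℤ._*_ e f)
  (ℤS.solve 5 (λ b k m d l → (b :+ k :* m) :* (d :+ l :* m) := b :* d :+ (k :* d :+ (b :* l :+ k :* m :* l)) :* m) refl b k m d l))
  where open ℤS

mod-Σ : ∀ {n m} {f g : Fin n → ℤ} → (∀ i → f i ≡ g i [mod m ]) → Σℤ f ≡ Σℤ g [mod m ]
mod-Σ {zero} h = mod-refl refl
mod-Σ {suc n} h = mod-+ (h zero) (mod-Σ (λ i → h (suc i)))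

mod-det : ∀ {n m} {c c′ : Fin n → Fin n → ℤ} → (∀ j i → c j i ≡ c′ j i [mod m ]) → det c ≡ det c′ [mod m ]
mod-det {zero} h = mod-refl refl
mod-det {suc n} h = mod-Σ (λ j → mod-* (mod-refl {sgn (toℕ j)} refl) (mod-* (h j zero) (mod-det (λ k i → h (punchIn j k) (suc i)))))

mod-evalP : ∀ {x y m} → x ≡ y [mod m ] → ∀ p → evalP p x ≡ evalP p y [mod m ]
mod-evalP h [] = mod-refl refl
mod-evalP h (a ∷ p) = mod-+ (mod-refl {a} refl) (mod-* h (mod-evalP h p))

-- Evaluation of polynomials

evalP-+ : ∀ p q x → evalP (p +P q) x ≡ evalP p x ℤ.+ evalP q x
evalP-+ [] q x = sym (ℤP.+-identityˡ _)
evalP-+ (a ∷ p) [] x = sym (ℤP.+-identityʳ _)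
evalP-+ (a ∷ p) (b ∷ q) x = trans (cong (λ t → (a ℤ.+ b) ℤ.+ x ℤ.* t) (evalP-+ p q x))
  (ℤS.solve 5 (λ a b x p q → (a :+ b) :+ x :* (p :+ q) := (a :+ x :* p) :+ (b :+ x :* q)) refl a b x (evalP p x) (evalP q x))
  where open ℤS

evalP-scale : ∀ c p x → evalP (scaleP c p) x ≡ c ℤ.* evalP p x
evalP-scale c [] x = sym (ℤP.*-zeroʳ c)
evalP-scale c (a ∷ p) x = trans (cong (λ t → c ℤ.* a ℤ.+ x ℤ.* t) (evalP-scale c p x))
  (ℤS.solve 4 (λ c a x p → c :* a :+ x :* (c :* p) := c :* (a :+ x :* p)) refl c a x (evalP p x))
  where open ℤS

evalP-* : ∀ p q x → evalP (p *P q) x ≡ evalP p x ℤ.* evalP q x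
evalP-* [] q x = sym (ℤP.*-zeroˡ (evalP q x))
evalP-* (a ∷ p) q x = trans (evalP-+ (scaleP a q) (+ 0 ∷ (p *P q)) x)
  (trans (cong₂ (λ s t → s ℤ.+ (+ 0 ℤ.+ x ℤ.* t)) (evalP-scale a q x) (evalP-* p q x))
    (ℤS.solve 4 (λ a x p q → a :* q :+ (con (+ 0) :+ x :* (p :* q)) := (a :+ x :* p) :* q) refl a x (evalP p x) (evalP q x)))
  where open ℤS

evalP-const : ∀ c x → evalP (constP c) x ≡ c
evalP-const c x = trans (cong (λ t → c ℤ.+ t) (ℤP.*-zeroʳ x)) (ℤP.+-identityʳ c)

evalP-neg : ∀ p x → evalP (negP p) x ≡ ℤ.- evalP p x
evalP-neg p x = trans (evalP-scale (ℤ.- (+ 1)) p x) (ℤP.-1*i≡-i (evalP p x))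

evalP-X : ∀ x → evalP XP x ≡ x
evalP-X x = trans (ℤP.+-identityˡ _) (trans (cong (x ℤ.*_) (trans (cong (λ t → + 1 ℤ.+ t) (ℤP.*-zeroʳ x)) refl)) (ℤP.*-identityʳ x))

evalP-^ : ∀ p k x → evalP (p ^P k) x ≡ evalP p x ℤ.^ k
evalP-^ p zero x = evalP-const (+ 1) x
evalP-^ p (suc k) x = trans (evalP-* p (p ^P k) x) (cong (evalP p x ℤ.*_) (evalP-^ p k x))

evalP-≈0 : ∀ p x → (∀ k → coeff p k ≡ + 0) → evalP p x ≡ + 0
evalP-≈0 [] x h = refl
evalP-≈0 (a ∷ p) x h = trans (cong₂ (λ s t → s ℤ.+ x ℤ.* t) (h 0) (evalP-≈0 p x (λ k → h (suc k)))) (trans (ℤP.+-identityˡ _) (ℤP.*-zeroʳ x))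

evalP-≈ : ∀ p q x → p ≈P q → evalP p x ≡ evalP q x
evalP-≈ [] q x h = sym (evalP-≈0 q x (λ k → sym (h k)))
evalP-≈ (a ∷ p) [] x h = evalP-≈0 (a ∷ p) x h
evalP-≈ (a ∷ p) (b ∷ q) x h = cong₂ (λ s t → s ℤ.+ x ℤ.* t) (h 0) (evalP-≈ p q x (λ k → h (suc k)))

evalP-Σ : ∀ {n} (f : Fin n → Poly) x → evalP (ΣP f) x ≡ Σℤ (λ i → evalP (f i) x)
evalP-Σ {zero} f x = refl
evalP-Σ {suc n} f x = trans (evalP-+ (f zero) (ΣP (λ i → f (suc i))) x) (cong (λ t → evalP (f zero) x ℤ.+ t) (evalP-Σ (λ i → f (suc i)) x))

signP-even : ∀ k p → k ℕ.% 2 ≡ 0 → signP k p ≡ p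
signP-even k p e with k ℕ.% 2 | e
... | zero | refl = refl

signP-odd : ∀ k p → k ℕ.% 2 ≡ 1 → signP k p ≡ negP p
signP-odd k p e with k ℕ.% 2 | e
... | suc zero | refl = refl

[2+k]%2≡k%2 : ∀ k → suc (suc k) ℕ.% 2 ≡ k ℕ.% 2
[2+k]%2≡k%2 k = trans (cong (ℕ._% 2) (ℕP.+-comm 2 k)) (ℕDM.[m+n]%n≡m%n k 2)

sgn-parity : ∀ k → (k ℕ.% 2 ≡ 0 × sgn k ≡ + 1) ⊎ (k ℕ.% 2 ≡ 1 × sgn k ≡ -[1+ 0 ])
sgn-parity zero = inj₁ (refl , refl)
sgn-parity (suc zero) = inj₂ (refl , refl)
sgn-parity (suc (suc k)) with sgn-parity k
... | inj₁ (e , s) = inj₁ (trans ([2+k]%2≡k%2 k) e , trans (ℤP.neg-involutive (sgn k)) s)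
... | inj₂ (e , s) = inj₂ (trans ([2+k]%2≡k%2 k) e , trans (ℤP.neg-involutive (sgn k)) s)

evalP-sign : ∀ k p x → evalP (signP k p) x ≡ sgn k ℤ.* evalP p x
evalP-sign k p x with sgn-parity k
... | inj₁ (e , s) = trans (cong (λ t → evalP t x) (signP-even k p e)) (sym (trans (cong (ℤ._* evalP p x) s) (ℤP.*-identityˡ _)))
... | inj₂ (e , s) = trans (cong (λ t → evalP t x) (signP-odd k p e)) (trans (evalP-scale (ℤ.- (+ 1)) p x) (cong (ℤ._* evalP p x) (sym s)))

evalP-det : ∀ {n} (M : Fin n → Fin n → Poly) x → evalP (detP M) x ≡ det (λ j i → evalP (M i j) x)
evalP-det {zero} M x = evalP-const (+ 1) x
evalP-det {suc n} M x = trans (evalP-Σ (λ j → signP (toℕ j) (M zero j *P detP (λ r c → M (suc r) (punchIn j c)))) x) (Σℤ-cong (λ j →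
  trans (evalP-sign (toℕ j) (M zero j *P detP (λ r c → M (suc r) (punchIn j c))) x)
    (cong (sgn (toℕ j) ℤ.*_) (trans (evalP-* (M zero j) (detP (λ r c → M (suc r) (punchIn j c))) x)
      (cong (evalP (M zero j) x ℤ.*_) (evalP-det (λ r c → M (suc r) (punchIn j c)) x))))))

evalP-charPoly : ∀ {n} (F : IMat n) x → evalP (charPoly F) x ≡ det (λ j i → x ℤ.* idI i j ℤ.- F i j)
evalP-charPoly F x = trans (evalP-det (λ i j → (XP *P constP (idI i j)) +P negP (constP (F i j))) x) (det-cong (λ j i → trans (evalP-+ (XP *P constP (idI i j)) (negP (constP (F i j))) x)
  (cong₂ ℤ._+_ (trans (evalP-* XP (constP (idI i j)) x) (cong₂ ℤ._*_ (evalP-X x) (evalP-const (idI i j) x)))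
    (trans (evalP-neg (constP (F i j)) x) (cong ℤ.-_ (evalP-const (F i j) x))))))

-- Column reduction

lc : ∀ {l} {R : Set} → (Fin l → ℤ) → (Fin l → R → ℤ) → R → ℤ
lc a c r = Σℤ (λ j → a j ℤ.* c j r)

Σℤ-+ : ∀ {n} (f g : Fin n → ℤ) → Σℤ (λ i → f i ℤ.+ g i) ≡ Σℤ f ℤ.+ Σℤ g
Σℤ-+ {zero} f g = refl
Σℤ-+ {suc n} f g = trans (cong (λ t → (f zero ℤ.+ g zero) ℤ.+ t) (Σℤ-+ (λ i → f (suc i)) (λ i → g (suc i))))
  (interchange (f zero) (g zero) (Σℤ (λ i → f (suc i))) (Σℤ (λ i → g (suc i))))
  where
  open ℤS
  interchange : ∀ a b c d → (a ℤ.+ b) ℤ.+ (c ℤ.+ d) ≡ (a ℤ.+ c) ℤ.+ (b ℤ.+ d)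
  interchange = ℤS.solve 4 (λ a b c d → (a :+ b) :+ (c :+ d) := (a :+ c) :+ (b :+ d)) refl

Σℤ-*ˡ : ∀ {n} q (f : Fin n → ℤ) → Σℤ (λ i → q ℤ.* f i) ≡ q ℤ.* Σℤ f
Σℤ-*ˡ {zero} q f = sym (ℤP.*-zeroʳ q)
Σℤ-*ˡ {suc n} q f = trans (cong (λ t → q ℤ.* f zero ℤ.+ t) (Σℤ-*ˡ q (λ i → f (suc i)))) (sym (ℤP.*-distribˡ-+ q (f zero) (Σℤ (λ i → f (suc i)))))

Σℤ-swap : ∀ {m n} (f : Fin m → Fin n → ℤ) → Σℤ (λ i → Σℤ (f i)) ≡ Σℤ (λ j → Σℤ (λ i → f i j))
Σℤ-swap {zero} {n} f = sym (Σℤ-0 {n} (λ _ → refl))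
Σℤ-swap {suc m} f = trans (cong (λ t → Σℤ (f zero) ℤ.+ t) (Σℤ-swap (λ i → f (suc i)))) (sym (Σℤ-+ (f zero) (λ j → Σℤ (λ i → f (suc i) j))))

lc-cong : ∀ {l R} {a a′ : Fin l → ℤ} {c c′ : Fin l → R → ℤ} r → (∀ j → a j ≡ a′ j) → (∀ j → c j r ≡ c′ j r) → lc a c r ≡ lc a′ c′ r
lc-cong r ha hc = Σℤ-cong (λ j → cong₂ ℤ._*_ (ha j) (hc j))

lc-0 : ∀ {l R} {a : Fin l → ℤ} {c : Fin l → R → ℤ} r → (∀ j → a j ≡ + 0) → lc a c r ≡ + 0
lc-0 {c = c} r h = Σℤ-0 (λ j → trans (cong (ℤ._* c j r) (h j)) (ℤP.*-zeroˡ (c j r)))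

lc-sub : ∀ {l R} q (a b : Fin l → ℤ) (c : Fin l → R → ℤ) r → lc (λ j → a j ℤ.- q ℤ.* b j) c r ≡ lc a c r ℤ.- q ℤ.* lc b c r
lc-sub q a b c r = trans (Σℤ-cong (λ j → dist (a j) q (b j) (c j r))) (Σℤ-sub q (λ j → a j ℤ.* c j r) (λ j → b j ℤ.* c j r))
  where
  open ℤS
  dist : ∀ a q b c → (a ℤ.- q ℤ.* b) ℤ.* c ≡ a ℤ.* c ℤ.- q ℤ.* (b ℤ.* c)
  dist = ℤS.solve 4 (λ a q b c → (a :- q :* b) :* c := a :* c :- q :* (b :* c)) refl

-- The matrix of the step, with rows (0, 1) and (1, -q), is symmetric, so coefficients transform by
-- the same operation as columns.
Ts-adjoint : ∀ {l} (i : Fin l) q (a x : Fin (suc l) → ℤ) → Σℤ (λ j → a j ℤ.* Ts i q x j) ≡ Σℤ (λ j → Ts i q a j ℤ.* x j)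
Ts-adjoint zero q a x = identity (a zero) (a (suc zero)) (x zero) (x (suc zero)) q (Σℤ (λ j → a (suc (suc j)) ℤ.* x (suc (suc j))))
  where
  open ℤS
  identity : ∀ a b x y q s → a ℤ.* y ℤ.+ (b ℤ.* (x ℤ.- q ℤ.* y) ℤ.+ s) ≡ b ℤ.* x ℤ.+ ((a ℤ.- q ℤ.* b) ℤ.* y ℤ.+ s)
  identity = ℤS.solve 6 (λ a b x y q s → a :* y :+ (b :* (x :- q :* y) :+ s) := b :* x :+ ((a :- q :* b) :* y :+ s)) refl
Ts-adjoint (suc i) q a x = cong (λ t → a zero ℤ.* x zero ℤ.+ t) (Ts-adjoint i q (λ j → a (suc j)) (λ j → x (suc j)))

Ts⁻ : ∀ {l} → Fin l → ℤ → (Fin (suc l) → ℤ) → Fin (suc l) → ℤ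
Ts⁻ zero q a zero = a (suc zero) ℤ.+ q ℤ.* a zero
Ts⁻ zero q a (suc zero) = a zero
Ts⁻ zero q a (suc (suc j)) = a (suc (suc j))
Ts⁻ (suc i) q a zero = a zero
Ts⁻ (suc i) q a (suc j) = Ts⁻ i q (λ j → a (suc j)) j

Ts-Ts⁻ : ∀ {l} (i : Fin l) q a j → Ts i q (Ts⁻ i q a) j ≡ a j
Ts-Ts⁻ zero q a zero = refl
Ts-Ts⁻ zero q a (suc zero) = identity (a (suc zero)) (a zero) q
  where
  open ℤS
  identity : ∀ x y q → (x ℤ.+ q ℤ.* y) ℤ.- q ℤ.* y ≡ x
  identity = ℤS.solve 3 (λ x y q → (x :+ q :* y) :- q :* y := x) refl
Ts-Ts⁻ zero q a (suc (suc j)) = refl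
Ts-Ts⁻ (suc i) q a zero = refl
Ts-Ts⁻ (suc i) q a (suc j) = Ts-Ts⁻ i q (λ j → a (suc j)) j

Ts-0 : ∀ {l} (i : Fin l) q a → (∀ j → a j ≡ + 0) → ∀ j → Ts i q a j ≡ + 0
Ts-0 zero q a h zero = h (suc zero)
Ts-0 zero q a h (suc zero) = trans (cong₂ (λ x y → x ℤ.- q ℤ.* y) (h zero) (h (suc zero))) (trans (ℤP.+-identityˡ (ℤ.- (q ℤ.* + 0))) (cong ℤ.-_ (ℤP.*-zeroʳ q)))
Ts-0 zero q a h (suc (suc j)) = h (suc (suc j))
Ts-0 (suc i) q a h zero = h zero
Ts-0 (suc i) q a h (suc j) = Ts-0 i q (λ j → a (suc j)) (λ j → h (suc j)) j

Ts-0⁻ : ∀ {l} (i : Fin l) q a → (∀ j → Ts i q a j ≡ + 0) → ∀ j → a j ≡ + 0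
Ts-0⁻ zero q a h zero = trans (sym (trans (cong (λ t → a zero ℤ.- q ℤ.* t) (h zero)) (trans (cong (λ t → a zero ℤ.- t) (ℤP.*-zeroʳ q)) (ℤP.+-identityʳ (a zero))))) (h (suc zero))
Ts-0⁻ zero q a h (suc zero) = h zero
Ts-0⁻ zero q a h (suc (suc j)) = h (suc (suc j))
Ts-0⁻ (suc i) q a h zero = h zero
Ts-0⁻ (suc i) q a h (suc j) = Ts-0⁻ i q (λ j → a (suc j)) (λ j → h (suc j)) j

infix 4 _⇝_

data _⇝_ {R : Set} : ∀ {l} → (Fin l → R → ℤ) → (Fin l → R → ℤ) → Set where
  done : ∀ {l} {c c′ : Fin l → R → ℤ} → (∀ j r → c j r ≡ c′ j r) → c ⇝ c′
  step : ∀ {l} {c c′ : Fin (suc l) → R → ℤ} (i : Fin l) (q : ℤ) → T i q c ⇝ c′ → c ⇝ c′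

cons : ∀ {l} {X : Set} → X → (Fin l → X) → Fin (suc l) → X
cons x c zero = x
cons x c (suc j) = c j

T-cong : ∀ {l R} (i : Fin l) q {c c′ : Fin (suc l) → R → ℤ} → (∀ j r → c j r ≡ c′ j r) → ∀ j r → T i q c j r ≡ T i q c′ j r
T-cong zero q h zero r = h (suc zero) r
T-cong zero q h (suc zero) r = cong₂ (λ x y → x ℤ.- q ℤ.* y) (h zero r) (h (suc zero) r)
T-cong zero q h (suc (suc j)) r = h (suc (suc j)) r
T-cong (suc i) q h zero r = h zero r
T-cong (suc i) q h (suc j) r = T-cong i q (λ j r → h (suc j) r) j r

⇝-resp : ∀ {l R} {c d c′ : Fin l → R → ℤ} → (∀ j r → d j r ≡ c j r) → c ⇝ c′ → d ⇝ c′
⇝-resp h (done e) = done (λ j r → trans (h j r) (e j r))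
⇝-resp h (step i q s) = step i q (⇝-resp (T-cong i q h) s)

⇝-trans : ∀ {l R} {c d e : Fin l → R → ℤ} → c ⇝ d → d ⇝ e → c ⇝ e
⇝-trans (done h) t = ⇝-resp h t
⇝-trans (step i q s) t = step i q (⇝-trans s t)

⇝-cons : ∀ {l R} {c : Fin (suc l) → R → ℤ} {d : Fin l → R → ℤ} → (λ j → c (suc j)) ⇝ d → c ⇝ cons (c zero) d
⇝-cons {c = c} {d} (done h) = done λ { zero r → refl ; (suc j) r → h j r }
⇝-cons {c = c} {d} (step i q s) = step (suc i) q (⇝-trans (⇝-cons {c = T (suc i) q c} s) (done λ { zero r → refl ; (suc j) r → refl }))

-- Rewrites a combination of the reduced columns as one of the original columns; `push` goes the
-- other way. Together they carry spans and linear relations across a reduction.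
pull : ∀ {l R} {c c′ : Fin l → R → ℤ} → c ⇝ c′ → (Fin l → ℤ) → Fin l → ℤ
pull (done h) a = a
pull (step i q s) a = Ts i q (pull s a)

pull-lc : ∀ {l R} {c c′ : Fin l → R → ℤ} (s : c ⇝ c′) a r → lc a c′ r ≡ lc (pull s a) c r
pull-lc (done h) a r = Σℤ-cong (λ j → cong (a j ℤ.*_) (sym (h j r)))
pull-lc {c = c} (step i q s) a r = trans (pull-lc s a r) (Ts-adjoint i q (pull s a) (λ j → c j r))

pull-0 : ∀ {l R} {c c′ : Fin l → R → ℤ} (s : c ⇝ c′) a → (∀ j → pull s a j ≡ + 0) → ∀ j → a j ≡ + 0
pull-0 (done h) a z = z
pull-0 (step i q s) a z = pull-0 s a (Ts-0⁻ i q (pull s a) z)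

push : ∀ {l R} {c c′ : Fin l → R → ℤ} → c ⇝ c′ → (Fin l → ℤ) → Fin l → ℤ
push (done h) a = a
push (step i q s) a = push s (Ts⁻ i q a)

push-lc : ∀ {l R} {c c′ : Fin l → R → ℤ} (s : c ⇝ c′) a r → lc a c r ≡ lc (push s a) c′ r
push-lc (done h) a r = Σℤ-cong (λ j → cong (a j ℤ.*_) (h j r))
push-lc {c = c} (step i q s) a r = trans (sym (trans (Ts-adjoint i q (Ts⁻ i q a) (λ j → c j r)) (Σℤ-cong (λ j → cong (ℤ._* c j r) (Ts-Ts⁻ i q a j)))))
  (push-lc s (Ts⁻ i q a) r)

push-0 : ∀ {l R} {c c′ : Fin l → R → ℤ} (s : c ⇝ c′) a → (∀ j → push s a j ≡ + 0) → ∀ j → a j ≡ + 0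
push-0 (done h) a z = z
push-0 (step i q s) a z j = trans (sym (Ts-Ts⁻ i q a j)) (Ts-0 i q (Ts⁻ i q a) (push-0 s (Ts⁻ i q a) z) j)

⇝-det : ∀ {n} {c c′ : Fin n → Fin n → ℤ} → c ⇝ c′ → ∣ det c ∣ ≡ ∣ det c′ ∣
⇝-det (done h) = cong ∣_∣ (det-cong h)
⇝-det {c = c} (step i q s) = trans (sym (trans (cong ∣_∣ (det-T i q c)) (ℤP.∣-i∣≡∣i∣ (det c)))) (⇝-det s)

record Functional {R : Set} (φ : (R → ℤ) → ℤ) : Set where
  field
    ext : ∀ {u v} → (∀ r → u r ≡ v r) → φ u ≡ φ v
    lin : ∀ u q v → φ (λ r → u r ℤ.- q ℤ.* v r) ≡ φ u ℤ.- q ℤ.* φ v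

open Functional

remainder : ∀ x y .{{_ : ℤ.NonZero y}} → x ℤ.- (x ℤDM./ y) ℤ.* y ≡ + (x ℤDM.% y)
remainder x y = trans (cong (λ t → t ℤ.- (x ℤDM./ y) ℤ.* y) (ℤDM.a≡a%n+[a/n]*n x y)) (identity (+ (x ℤDM.% y)) ((x ℤDM./ y) ℤ.* y))
  where
  open ℤS
  identity : ∀ a b → (a ℤ.+ b) ℤ.- b ≡ a
  identity = ℤS.solve 2 (λ a b → (a :+ b) :- b := a) refl

Reduced : ∀ {l} {R : Set} → ((R → ℤ) → ℤ) → (Fin (suc l) → R → ℤ) → Set
Reduced {l} {R} φ c = Σ (Fin (suc l) → R → ℤ) λ c′ → c ⇝ c′ × (∀ j → φ (c′ (suc j)) ≡ + 0)

-- Only the first two columns may have nonzero φ; the step replaces φ of the second by its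
-- remainder, so the absolute value drops until it is 0.
euclid : ∀ {l R} {φ : (R → ℤ) → ℤ} → Functional φ → (c : Fin (suc (suc l)) → R → ℤ) → (∀ j → φ (c (suc (suc j))) ≡ + 0) →
  Acc ℕ._<_ ∣ φ (c (suc zero)) ∣ → Reduced φ c
euclid {l} {R} {φ} Φ c h (acc rec) = cases (φ (c (suc zero)) ℤ.≟ + 0)
  where
  cases : Dec (φ (c (suc zero)) ≡ + 0) → Reduced φ c
  cases (yes e) = c , done (λ _ _ → refl) , λ { zero → e ; (suc j) → h j }
  cases (no ne) = let (c′ , s , z) = euclid Φ (T zero q c) h (rec smaller) in c′ , step zero q s , z
    where
    instance
      nz : ℤ.NonZero (φ (c (suc zero)))
      nz = ℤ.≢-nonZero ne
    q : ℤ
    q = φ (c zero) ℤDM./ φ (c (suc zero))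
    smaller : ∣ φ (T zero q c (suc zero)) ∣ ℕ.< ∣ φ (c (suc zero)) ∣
    smaller = subst (λ t → ∣ t ∣ ℕ.< ∣ φ (c (suc zero)) ∣) (sym (trans (lin Φ (c zero) q (c (suc zero))) (remainder (φ (c zero)) (φ (c (suc zero))))))
      (ℤDM.n%d<d (φ (c zero)) (φ (c (suc zero))))

reduce : ∀ {l R} {φ : (R → ℤ) → ℤ} → Functional φ → (c : Fin (suc l) → R → ℤ) → Reduced φ c
reduce {zero} Φ c = c , done (λ _ _ → refl) , λ ()
reduce {suc l} Φ c =
  let (d , s , z) = reduce Φ (λ j → c (suc j))
      (c′ , s′ , z′) = euclid Φ (cons (c zero) d) z (<-wellFounded _)
  in c′ , ⇝-trans (⇝-cons s) s′ , z′

head-functional : ∀ {n} → Functional {Fin (suc n)} (λ u → u zero)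
head-functional = record { ext = λ h → h zero ; lin = λ u q v → refl }

Independent : ∀ {l} {R : Set} → (Fin l → R → ℤ) → Set
Independent c = ∀ a → (∀ r → lc a c r ≡ + 0) → ∀ j → a j ≡ + 0

Dependent : ∀ {l} {R : Set} → (Fin l → R → ℤ) → Set
Dependent c = ∃ λ a → (∀ r → lc a c r ≡ + 0) × ¬ (∀ j → a j ≡ + 0)

⇝-independent : ∀ {l R} {c c′ : Fin l → R → ℤ} → c ⇝ c′ → Independent c′ → Independent c
⇝-independent s ind a h = push-0 s a (ind (push s a) (λ r → trans (sym (push-lc s a r)) (h r)))

⇝-independent′ : ∀ {l R} {c c′ : Fin l → R → ℤ} → c ⇝ c′ → Independent c → Independent c′
⇝-independent′ s ind a h = pull-0 s a (ind (pull s a) (λ r → trans (sym (pull-lc s a r)) (h r)))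

⇝-dependent : ∀ {l R} {c c′ : Fin l → R → ℤ} → c ⇝ c′ → Dependent c′ → Dependent c
⇝-dependent s (a , h , nz) = pull s a , (λ r → trans (sym (pull-lc s a r)) (h r)) , λ z → nz (pull-0 s a z)

dependent-cons : ∀ {l n} (c : Fin (suc l) → Fin (suc n) → ℤ) → (∀ j → c (suc j) zero ≡ + 0) →
  Dependent (λ j i → c (suc j) (suc i)) → Dependent c
dependent-cons c z (a , h , nz) = cons (+ 0) a , rel , λ z → nz (λ j → z (suc j))
  where
  rel : ∀ r → lc (cons (+ 0) a) c r ≡ + 0
  rel zero = trans (cong₂ ℤ._+_ (ℤP.*-zeroˡ (c zero zero)) (Σℤ-0 (λ j → trans (cong (a j ℤ.*_) (z j)) (ℤP.*-zeroʳ (a j))))) refl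
  rel (suc r) = trans (cong₂ ℤ._+_ (ℤP.*-zeroˡ (c zero (suc r))) (h r)) refl

more-vectors-dependent : ∀ {l n} → n ℕ.≤ l → (c : Fin (suc l) → Fin n → ℤ) → Dependent c
-- In dimension 0 every relation holds, and there is at least one vector to give a nonzero
-- coefficient.
more-vectors-dependent {n = zero} _ c = (λ _ → + 1) , (λ ()) , λ z → one≢0 (z zero)
  where
  one≢0 : + 1 ≢ + 0
  one≢0 ()
more-vectors-dependent {suc l} {suc n} (ℕ.s≤s n≤l) c =
  let (c′ , s , z) = reduce head-functional c in
  ⇝-dependent s (dependent-cons c′ z (more-vectors-dependent n≤l (λ j i → c′ (suc j) (suc i))))

-- After reduction the determinant is the corner entry times a minor. If the minor vanishes, induct;
-- if the corner does, all n + 1 columns live in n dimensions.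
det≡0⇒dependent : ∀ {n} (c : Fin n → Fin n → ℤ) → det c ≡ + 0 → Dependent c
det≡0⇒dependent {zero} c ()
det≡0⇒dependent {suc n} c e = let (c′ , s , z) = reduce head-functional c in ⇝-dependent s (reduced c′ z (det-c′ s))
  where
  det-c′ : ∀ {c′ : Fin (suc n) → Fin (suc n) → ℤ} → c ⇝ c′ → det c′ ≡ + 0
  det-c′ s = ℤP.∣i∣≡0⇒i≡0 (trans (sym (⇝-det s)) (cong ∣_∣ e))
  reduced : ∀ (c′ : Fin (suc n) → Fin (suc n) → ℤ) → (∀ j → c′ (suc j) zero ≡ + 0) → det c′ ≡ + 0 → Dependent c′
  reduced c′ z e′ with ℤP.i*j≡0⇒i≡0∨j≡0 (c′ zero zero) (trans (sym (det-first-row c′ z)) e′)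
  ... | inj₂ e″ = dependent-cons c′ z (det≡0⇒dependent (minor zero c′) e″)
  ... | inj₁ h≡0 = let (a , h , nz) = more-vectors-dependent ℕP.≤-refl (λ j i → c′ j (suc i)) in a , rel a h , nz
    where
    col0 : ∀ j → c′ j zero ≡ + 0
    col0 zero = h≡0
    col0 (suc j) = z j
    rel : ∀ a → (∀ i → Σℤ (λ j → a j ℤ.* c′ j (suc i)) ≡ + 0) → ∀ r → lc a c′ r ≡ + 0
    rel a h zero = Σℤ-0 (λ j → trans (cong (a j ℤ.*_) (col0 j)) (ℤP.*-zeroʳ (a j)))
    rel a h (suc r) = h r

-- The index of a full column span

ι : ∀ {I : Set} → (I → ℤ) → W I
ι x i = toℚ (x i)

Span : ∀ {l} {R : Set} → (Fin l → R → ℤ) → Pred (W R)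
Span c v = ∃ λ a → v ≐ ι (lc a c)

Λ-subgroup : ∀ {n} → Subgroup (Λ {n})
Λ-subgroup = record { resp = λ e h i → int-resp (e i) (h i) ; zer = λ i → int-0 ; sub = λ p q i → int-- (p i) (q i) }

Span-subgroup : ∀ {l R} (c : Fin l → R → ℤ) → Subgroup (Span c)
Span-subgroup c = record
  { resp = λ e (a , h) → a , λ i → trans (sym (e i)) (h i)
  ; zer = (λ _ → + 0) , λ i → cong toℚ (sym (lc-0 {c = c} i (λ _ → refl)))
  ; sub = λ (a , h) (b , k) → (λ j → a j ℤ.- (+ 1) ℤ.* b j) , λ i → trans (cong₂ ℚ._-_ (h i) (k i))
      (trans (sym (toℚ-- (lc a c i) (lc b c i))) (cong toℚ (sym (trans (lc-sub (+ 1) a b c i) (cong (λ t → lc a c i ℤ.- t) (ℤP.*-identityˡ (lc b c i))))))) }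

Λ-ι : ∀ {n} (x : Fin n → ℤ) → Λ (ι x)
Λ-ι x i = int-toℚ (x i)

HeadMultiple : ∀ {n} → ℤ → Pred (V (suc n))
HeadMultiple h v = Λ v × ∃ λ z → v zero ≡ toℚ (z ℤ.* h)

HeadMultiple-subgroup : ∀ {n} h → Subgroup (HeadMultiple {n} h)
HeadMultiple-subgroup h = record
  { resp = λ e (p , z , q) → resp Λ-subgroup e p , z , trans (sym (e zero)) q
  ; zer = zer Λ-subgroup , + 0 , cong toℚ (sym (ℤP.*-zeroˡ h))
  ; sub = λ (p , z , q) (p′ , z′ , q′) → sub Λ-subgroup p p′ , z ℤ.- z′ ,
      trans (cong₂ ℚ._-_ q q′) (trans (sym (toℚ-- (z ℤ.* h) (z′ ℤ.* h))) (cong toℚ (sym (dist z z′ h)))) }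
  where
  open ℤS
  dist : ∀ z z′ h → (z ℤ.- z′) ℤ.* h ≡ z ℤ.* h ℤ.- z′ ℤ.* h
  dist = ℤS.solve 3 (λ z z′ h → (z :- z′) :* h := z :* h :- z′ :* h) refl

small-multiple : ∀ a b z h → a ℕ.< b → b ℕ.< ∣ h ∣ → + b ℤ.- + a ≡ z ℤ.* h → ⊥
small-multiple a b z h a<b b<h e = ℕP.<⇒≱ (ℕP.≤-<-trans (ℕP.m∸n≤m b a) b<h) (ℕD.∣⇒≤ {{ℕ.>-nonZero (ℕP.m<n⇒0<n∸m a<b)}} (divides ∣ z ∣ eq))
  where
  eq : b ℕ.∸ a ≡ ∣ z ∣ ℕ.* ∣ h ∣
  eq = trans (sym (cong ∣_∣ (trans (ℤP.m-n≡m⊖n b a) (ℤP.⊖-≥ (ℕP.<⇒≤ a<b))))) (trans (cong ∣_∣ e) (ℤP.abs-* z h))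

HeadMultiple-card : ∀ {n} h → h ≢ + 0 → Card Λ (HeadMultiple {n} h) ∣ h ∣
HeadMultiple-card {n} h h≢0 = card rep (λ i → rep∈ i) cov inj
  where
  instance
    nz : ℤ.NonZero h
    nz = ℤ.≢-nonZero h≢0
  rep : Fin ∣ h ∣ → V (suc n)
  rep i zero = ℕtoℚ (toℕ i)
  rep i (suc _) = 0ℚ
  rep∈ : ∀ i → Λ (rep i)
  rep∈ i zero = int-toℚ (+ toℕ i)
  rep∈ i (suc _) = int-0
  cov : ∀ v → Λ v → ∃ λ i → HeadMultiple h (v ⊖ rep i)
  cov v hv = i , sub Λ-subgroup hv (rep∈ i) , a ℤDM./ h , (begin
      v zero ℚ.- ℕtoℚ (toℕ i)      ≡⟨ cong₂ ℚ._-_ (proj₂ (hv zero)) (cong ℕtoℚ (FinP.toℕ-fromℕ< (ℤDM.n%d<d a h))) ⟩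
      toℚ a ℚ.- ℕtoℚ (a ℤDM.% h)   ≡⟨ toℚ-- a (+ (a ℤDM.% h)) ⟨
      toℚ (a ℤ.- + (a ℤDM.% h))    ≡⟨ cong toℚ eq ⟩
      toℚ (a ℤDM./ h ℤ.* h)        ∎)
    where
    open ≡-Reasoning
    a : ℤ
    a = proj₁ (hv zero)
    i : Fin ∣ h ∣
    i = Fin.fromℕ< (ℤDM.n%d<d a h)
    eq : a ℤ.- + (a ℤDM.% h) ≡ a ℤDM./ h ℤ.* h
    eq = trans (cong (λ t → t ℤ.- + (a ℤDM.% h)) (ℤDM.a≡a%n+[a/n]*n a h)) (identity (+ (a ℤDM.% h)) (a ℤDM./ h ℤ.* h))
      where
      open ℤS
      identity : ∀ a b → (a ℤ.+ b) ℤ.- a ≡ b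
      identity = ℤS.solve 2 (λ a b → (a :+ b) :- a := b) refl
  lt : ∀ (i j : Fin ∣ h ∣) → toℕ i ℕ.< toℕ j → HeadMultiple h (rep j ⊖ rep i) → ⊥
  lt i j i<j (_ , z , e) = small-multiple (toℕ i) (toℕ j) z h i<j (FinP.toℕ<n j) (toℚ-injective (trans (toℚ-- (+ toℕ j) (+ toℕ i)) e))
  inj : ∀ v i j → HeadMultiple h (v ⊖ rep i) → HeadMultiple h (v ⊖ rep j) → i ≡ j
  inj v i j p q = cases (ℕP.<-cmp (toℕ i) (toℕ j))
    where
    sM : Subgroup (HeadMultiple h)
    sM = HeadMultiple-subgroup h
    cases : Tri (toℕ i ℕ.< toℕ j) (toℕ i ≡ toℕ j) (toℕ i ℕ.> toℕ j) → i ≡ j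
    cases (tri≈ _ eq _) = FinP.toℕ-injective eq
    cases (tri< l _ _) = ⊥-elim (lt i j l (chain sM (rep j) v (rep i) (flip sM v (rep j) q) p))
    cases (tri> _ _ g) = ⊥-elim (lt j i g (chain sM (rep i) v (rep j) (flip sM v (rep i) p) q))

-- Reduction makes the zeroth coordinates (h, 0, ..., 0) without changing the span. The lattice
-- `HeadMultiple h` lies between: it has index ∣h∣ in ℤⁿ, and modulo the first column it is ℤⁿ⁻¹
-- modulo the span of the minor. Independence rests on the same triangular shape.
span-card : ∀ {n} (c : Fin n → Fin n → ℤ) → det c ≢ + 0 → Card Λ (Span c) ∣ det c ∣ × Independent c
span-card {zero} c _ = card (λ _ → 𝟎) (λ _ ()) (λ v _ → zero , (λ ()) , λ ()) (λ { _ zero zero _ _ → refl }) , λ _ _ ()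
span-card {suc n} c det≢0 = finish (reduce head-functional c)
  where
  finish : Reduced (λ u → u zero) c → Card Λ (Span c) ∣ det c ∣ × Independent c
  finish (c′ , s , z) = subst (Card Λ (Span c)) (trans (sym (ℤP.abs-* h (det d))) (trans (sym (cong ∣_∣ det≡)) (sym (⇝-det s))))
      (card-cong (Span-subgroup c′) (Span-subgroup c) (λ p → p) (λ p → p)
        (λ (a , e) → pull s a , λ i → trans (e i) (cong toℚ (pull-lc s a i)))
        (λ (a , e) → push s a , λ i → trans (e i) (cong toℚ (push-lc s a i)))
        (card-tower Λ-subgroup (HeadMultiple-subgroup h) (Span-subgroup c′) proj₁ Span⊆ (HeadMultiple-card h h≢0) bottom)) ,
      ⇝-independent s ind
    where
    h : ℤ
    h = c′ zero zero
    d : Fin n → Fin n → ℤ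
    d = minor zero c′
    det≡ : det c′ ≡ h ℤ.* det d
    det≡ = det-first-row c′ z
    det′≢0 : det c′ ≢ + 0
    det′≢0 e = det≢0 (ℤP.∣i∣≡0⇒i≡0 (trans (⇝-det s) (cong ∣_∣ e)))
    h≢0 : h ≢ + 0
    h≢0 e = det′≢0 (trans det≡ (trans (cong (ℤ._* det d) e) (ℤP.*-zeroˡ (det d))))
    d≢0 : det d ≢ + 0
    d≢0 e = det′≢0 (trans det≡ (trans (cong (h ℤ.*_) e) (ℤP.*-zeroʳ h)))
    ih : Card Λ (Span d) ∣ det d ∣ × Independent d
    ih = span-card d d≢0
    lc-head : ∀ a → lc a c′ zero ≡ a zero ℤ.* h
    lc-head a = trans (cong (λ t → a zero ℤ.* h ℤ.+ t) (Σℤ-0 (λ j → trans (cong (a (suc j) ℤ.*_) (z j)) (ℤP.*-zeroʳ (a (suc j)))))) (ℤP.+-identityʳ (a zero ℤ.* h))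
    lc-tail : ∀ a → a zero ≡ + 0 → ∀ i → lc a c′ (suc i) ≡ lc (λ j → a (suc j)) d i
    lc-tail a a0 i = trans (cong (λ t → t ℤ.* c′ zero (suc i) ℤ.+ lc (λ j → a (suc j)) d i) a0) (trans (cong (ℤ._+ lc (λ j → a (suc j)) d i) (ℤP.*-zeroˡ (c′ zero (suc i)))) (ℤP.+-identityˡ (lc (λ j → a (suc j)) d i)))
    head≡0 : ∀ a → lc a c′ zero ≡ + 0 → a zero ≡ + 0
    head≡0 a e with ℤP.i*j≡0⇒i≡0∨j≡0 (a zero) (trans (sym (lc-head a)) e)
    ... | inj₁ a0 = a0
    ... | inj₂ h0 = ⊥-elim (h≢0 h0)
    ind : Independent c′
    ind a e zero = head≡0 a (e zero)
    ind a e (suc j) = proj₂ ih (λ j → a (suc j)) (λ r → trans (sym (lc-tail a (head≡0 a (e zero)) r)) (e (suc r))) j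
    Span⊆ : ∀ {v} → Span c′ v → HeadMultiple h v
    Span⊆ (a , e) = (λ i → lc a c′ i , e i) , a zero , trans (e zero) (cong toℚ (lc-head a))
    g : ∀ (w : V n) → Λ w → V (suc n)
    g w _ = cons 0ℚ w
    sur : ∀ v → HeadMultiple h v → ∃ λ w → Σ (Λ w) λ a → Span c′ (v ⊖ g w a)
    sur v (hv , y , e) = w , (λ i → int-- (hv (suc i)) (int-toℚ (y ℤ.* c′ zero (suc i)))) , cons y (λ _ → + 0) , eq
      where
      w : V n
      w i = v (suc i) ℚ.- toℚ (y ℤ.* c′ zero (suc i))
      only : ∀ r → lc (cons y (λ _ → + 0)) c′ r ≡ y ℤ.* c′ zero r
      only r = trans (cong (λ t → y ℤ.* c′ zero r ℤ.+ t) (Σℤ-0 (λ j → ℤP.*-zeroˡ (c′ (suc j) r)))) (ℤP.+-identityʳ (y ℤ.* c′ zero r))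
      eq : ∀ r → v r ℚ.- cons 0ℚ w r ≡ toℚ (lc (cons y (λ _ → + 0)) c′ r)
      eq zero = trans (cong (λ t → t ℚ.- 0ℚ) e) (trans (ℚP.+-identityʳ (toℚ (y ℤ.* h))) (cong toℚ (sym (only zero))))
      eq (suc i) = trans (x-[x-y]≡y (v (suc i)) (toℚ (y ℤ.* c′ zero (suc i)))) (cong toℚ (sym (only (suc i))))
    bottom : Card (HeadMultiple h) (Span c′) ∣ det d ∣
    bottom = card-transfer (Span-subgroup d) (Span-subgroup c′) g
      (λ w hw → (λ { zero → int-0 ; (suc i) → hw i }) , + 0 , cong toℚ (sym (ℤP.*-zeroˡ h)))
      (λ x y _ _ (a , e) → cons (+ 0) a , λ { zero → sym (cong toℚ (trans (lc-head (cons (+ 0) a)) (ℤP.*-zeroˡ h))) ; (suc i) → trans (e i) (cong toℚ (sym (lc-tail (cons (+ 0) a) refl i))) })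
      (λ x y _ _ (a , e) → (λ j → a (suc j)) , λ i → trans (e (suc i)) (cong toℚ (lc-tail a (head≡0 a (toℚ-injective (sym (e zero)))) i)))
      sur
      (proj₁ ih)

-- A basis of ℤⁿ adapted to ker D

functional-0 : ∀ {R} {φ : (R → ℤ) → ℤ} → Functional φ → φ (λ _ → + 0) ≡ + 0
functional-0 {φ = φ} Φ = trans (lin Φ (λ _ → + 0) (+ 1) (λ _ → + 0)) (trans (cong (λ t → φ (λ _ → + 0) ℤ.- t) (ℤP.*-identityˡ (φ (λ _ → + 0)))) (ℤP.+-inverseʳ (φ (λ _ → + 0))))

functional-lc : ∀ {l R} {φ : (R → ℤ) → ℤ} → Functional φ → (a : Fin l → ℤ) (c : Fin l → R → ℤ) → φ (lc a c) ≡ Σℤ (λ j → a j ℤ.* φ (c j))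
functional-lc {zero} Φ a c = functional-0 Φ
functional-lc {suc l} {φ = φ} Φ a c = begin
  φ (lc a c)                                            ≡⟨ ext Φ (λ r → rearrange (a zero) (c zero r) (lc a′ c′ r)) ⟩
  φ (λ r → lc a′ c′ r ℤ.- (ℤ.- a zero) ℤ.* c zero r)    ≡⟨ lin Φ (lc a′ c′) (ℤ.- a zero) (c zero) ⟩
  φ (lc a′ c′) ℤ.- (ℤ.- a zero) ℤ.* φ (c zero)          ≡⟨ rearrange (a zero) (φ (c zero)) (φ (lc a′ c′)) ⟨
  a zero ℤ.* φ (c zero) ℤ.+ φ (lc a′ c′)                ≡⟨ cong (λ t → a zero ℤ.* φ (c zero) ℤ.+ t) (functional-lc Φ a′ c′) ⟩
  Σℤ (λ j → a j ℤ.* φ (c j))                            ∎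
  where
  open ≡-Reasoning
  a′ = λ j → a (suc j)
  c′ = λ j → c (suc j)
  rearrange : ∀ x y s → x ℤ.* y ℤ.+ s ≡ s ℤ.- (ℤ.- x) ℤ.* y
  rearrange = ℤS.solve 3 (λ x y s → x :* y :+ s := s :- (:- x) :* y) refl
    where open ℤS

functional-lc-0 : ∀ {l R} {φ : (R → ℤ) → ℤ} → Functional φ → (a : Fin l → ℤ) (c : Fin l → R → ℤ) → (∀ j → φ (c j) ≡ + 0) → φ (lc a c) ≡ + 0
functional-lc-0 Φ a c h = trans (functional-lc Φ a c) (Σℤ-0 (λ j → trans (cong (a j ℤ.*_) (h j)) (ℤP.*-zeroʳ (a j))))

functional-+ : ∀ {R} {φ : (R → ℤ) → ℤ} → Functional φ → ∀ u v → φ (λ r → u r ℤ.+ v r) ≡ φ u ℤ.+ φ v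
functional-+ {φ = φ} Φ u v = trans (ext Φ (λ r → minus-neg (u r) (v r))) (trans (lin Φ u (ℤ.- + 1) v) (sym (minus-neg (φ u) (φ v))))
  where
  open ℤS
  minus-neg : ∀ x y → x ℤ.+ y ≡ x ℤ.- (ℤ.- + 1) ℤ.* y
  minus-neg = ℤS.solve 2 (λ x y → x :+ y := x :- con (ℤ.- + 1) :* y) refl

idI-suc : ∀ {n} (i j : Fin n) → idI (suc i) (suc j) ≡ idI i j
idI-suc i j with i FinP.≟ j
... | yes _ = refl
... | no _ = refl

Σℤ-idI : ∀ {n} (x : Fin n → ℤ) r → Σℤ (λ j → x j ℤ.* idI j r) ≡ x r
Σℤ-idI {suc n} x zero = trans (cong₂ ℤ._+_ (ℤP.*-identityʳ (x zero)) (Σℤ-0 (λ j → ℤP.*-zeroʳ (x (suc j))))) (ℤP.+-identityʳ (x zero))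
Σℤ-idI {suc n} x (suc r) = trans (cong₂ ℤ._+_ (ℤP.*-zeroʳ (x zero)) (trans (Σℤ-cong (λ j → cong (x (suc j) ℤ.*_) (idI-suc j r))) (Σℤ-idI (λ j → x (suc j)) r))) (ℤP.+-identityˡ (x (suc r)))

idI-sym : ∀ {n} (i j : Fin n) → idI i j ≡ idI j i
idI-sym zero zero = refl
idI-sym zero (suc j) = refl
idI-sym (suc i) zero = refl
idI-sym (suc i) (suc j) = trans (idI-suc i j) (trans (idI-sym i j) (sym (idI-suc j i)))

-- The vectors b and z together form a ℤ-basis of ℤⁿ, with z a basis of the common kernel of the
-- functionals. Since these vanish on z, `indb` says that b is independent modulo that kernel.
record Adapted {n s} (Φ : Fin s → (Fin n → ℤ) → ℤ) : Set where
  field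
    ρ k  : ℕ
    b    : Fin ρ → Fin n → ℤ
    z    : Fin k → Fin n → ℤ
    span : ∀ (x : Fin n → ℤ) → ∃ λ a → ∃ λ c → ∀ r → x r ≡ lc a b r ℤ.+ lc c z r
    van  : ∀ i j → Φ i (z j) ≡ + 0
    indb : ∀ a → (∀ i → Φ i (lc a b) ≡ + 0) → ∀ j → a j ≡ + 0
    indz : Independent z

-- Induction on the number of functionals: the current kernel basis is reduced until at most its
-- first vector has nonzero value under the new functional, and that vector, if the value is
-- nonzero, moves to b.
adapted : ∀ {n s} (Φ : Fin s → (Fin n → ℤ) → ℤ) → (∀ i → Functional (Φ i)) → Adapted Φ
adapted {n} {zero} Φ _ = record
  { ρ = 0 ; k = n ; b = λ () ; z = idI
  ; span = λ x → (λ ()) , x , λ r → sym (trans (ℤP.+-identityˡ (lc x idI r)) (Σℤ-idI x r))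
  ; van = λ () ; indb = λ _ _ () ; indz = λ a h j → trans (sym (Σℤ-idI a j)) (h j) }
adapted {n} {suc s} Φ F = extend (adapted (λ i → Φ (suc i)) (λ i → F (suc i)))
  where
  φ = Φ zero
  extend : Adapted (λ i → Φ (suc i)) → Adapted Φ
  extend record { ρ = ρ ; k = zero ; b = b ; z = z ; span = span ; van = van ; indb = indb ; indz = indz } = record
    { ρ = ρ ; k = 0 ; b = b ; z = z ; span = span ; van = λ _ () ; indb = λ a h → indb a (λ i → h (suc i)) ; indz = indz }
  extend record { ρ = ρ ; k = suc k ; b = b ; z = z ; span = span ; van = van ; indb = indb ; indz = indz } = cases (reduce (F zero) z)
    where
    span′ : ∀ {z′} → z ⇝ z′ → ∀ (x : Fin n → ℤ) → ∃ λ a → ∃ λ c → ∀ r → x r ≡ lc a b r ℤ.+ lc c z′ r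
    span′ s x = let (a , c , h) = span x in a , push s c , λ r → trans (h r) (cong (λ t → lc a b r ℤ.+ t) (push-lc s c r))
    van′ : ∀ {z′} → z ⇝ z′ → ∀ i j → Φ (suc i) (z′ j) ≡ + 0
    van′ {z′} s i j = trans (ext (F (suc i)) (λ r → trans (sym (Σℤ-unit z′ j r)) (pull-lc s (idI j) r)))
        (functional-lc-0 (F (suc i)) (pull s (idI j)) z (van i))
      where
      Σℤ-unit : ∀ (c : Fin (suc k) → Fin n → ℤ) j r → lc (idI j) c r ≡ c j r
      Σℤ-unit c j r = trans (Σℤ-cong (λ i → trans (ℤP.*-comm (idI j i) (c i r)) (cong (c i r ℤ.*_) (idI-sym j i)))) (Σℤ-idI (λ i → c i r) j)
    cases : Reduced φ z → Adapted Φ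
    cases (z′ , s , w) with φ (z′ zero) ℤ.≟ + 0
    ... | yes e = record { ρ = ρ ; k = suc k ; b = b ; z = z′ ; span = span′ s
      ; van = λ { zero zero → e ; zero (suc j) → w j ; (suc i) j → van′ s i j }
      ; indb = λ a h → indb a (λ i → h (suc i)) ; indz = ⇝-independent′ s indz }
    ... | no ne = record { ρ = suc ρ ; k = k ; b = cons (z′ zero) b ; z = λ j → z′ (suc j)
      ; span = λ x → let (a , c , h) = span′ s x in cons (c zero) a , (λ j → c (suc j)) ,
          λ r → trans (h r) (move (lc a b r) (c zero ℤ.* z′ zero r) (lc (λ j → c (suc j)) (λ j → z′ (suc j)) r))
      ; van = λ { zero j → w j ; (suc i) j → van′ s i (suc j) }
      ; indb = indb′
      ; indz = λ a h j → ⇝-independent′ s indz (cons (+ 0) a) (λ r → trans (cong (ℤ._+ lc a (λ j → z′ (suc j)) r) (ℤP.*-zeroˡ (z′ zero r))) (trans (ℤP.+-identityˡ _) (h r))) (suc j) }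
      where
      move : ∀ x y t → x ℤ.+ (y ℤ.+ t) ≡ (y ℤ.+ x) ℤ.+ t
      move = ℤS.solve 3 (λ x y t → x :+ (y :+ t) := (y :+ x) :+ t) refl
        where open ℤS
      indb′ : ∀ a → (∀ i → Φ i (lc a (cons (z′ zero) b)) ≡ + 0) → ∀ j → a j ≡ + 0
      indb′ a h = λ { zero → a0 ; (suc j) → tail j }
        where
        parts : ∀ i → Φ i (lc a (cons (z′ zero) b)) ≡ a zero ℤ.* Φ i (z′ zero) ℤ.+ Φ i (lc (λ j → a (suc j)) b)
        parts i = trans (functional-lc (F i) a (cons (z′ zero) b)) (cong (λ t → a zero ℤ.* Φ i (z′ zero) ℤ.+ t) (sym (functional-lc (F i) (λ j → a (suc j)) b)))
        tail : ∀ j → a (suc j) ≡ + 0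
        tail = indb (λ j → a (suc j)) (λ i → trans (sym (ℤP.+-identityˡ _))
          (trans (cong (ℤ._+ Φ (suc i) (lc (λ j → a (suc j)) b)) (sym (trans (cong (a zero ℤ.*_) (van′ s i zero)) (ℤP.*-zeroʳ (a zero)))))
            (trans (sym (parts (suc i))) (h (suc i)))))
        a0 : a zero ≡ + 0
        a0 with ℤP.i*j≡0⇒i≡0∨j≡0 (a zero) (trans (sym (trans (parts zero) (trans (cong (λ t → a zero ℤ.* φ (z′ zero) ℤ.+ t)
              (trans (ext (F zero) (λ r → lc-0 {c = b} r tail)) (functional-0 (F zero)))) (ℤP.+-identityʳ (a zero ℤ.* φ (z′ zero)))))) (h zero))
        ... | inj₁ e = e
        ... | inj₂ e = ⊥-elim (ne e)

scalar-det : ∀ n m → det {n} (λ j i → m ℤ.* idI j i) ≡ m ℤ.^ n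
scalar-det zero m = refl
scalar-det (suc n) m = trans (det-first-row {n} (λ j i → m ℤ.* idI j i) (λ j → ℤP.*-zeroʳ m))
  (cong₂ ℤ._*_ (ℤP.*-identityʳ m) (trans (det-cong {n} (λ j i → cong (m ℤ.*_) (idI-suc j i))) (scalar-det n m)))

lc-scalar : ∀ {n} m (a : Fin n → ℤ) r → lc a (λ j i → m ℤ.* idI j i) r ≡ m ℤ.* a r
lc-scalar m a r = trans (Σℤ-cong (λ j → comm (a j) m (idI j r))) (trans (Σℤ-*ˡ m (λ j → a j ℤ.* idI j r)) (cong (m ℤ.*_) (Σℤ-idI a r)))
  where
  open ℤS
  comm : ∀ a m d → a ℤ.* (m ℤ.* d) ≡ m ℤ.* (a ℤ.* d)
  comm = ℤS.solve 3 (λ a m d → a :* (m :* d) := m :* (a :* d)) refl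

Multiples : ∀ {n} → ℤ → Pred (V n)
Multiples {n} m v = ∃ λ (x : Fin n → ℤ) → v ≐ ι (λ i → m ℤ.* x i)

Multiples-subgroup : ∀ {n} m → Subgroup (Multiples {n} m)
Multiples-subgroup m = record
  { resp = λ e (x , h) → x , λ i → trans (sym (e i)) (h i)
  ; zer = (λ _ → + 0) , λ i → cong toℚ (sym (ℤP.*-zeroʳ m))
  ; sub = λ (x , h) (y , k) → (λ i → x i ℤ.- y i) , λ i → trans (cong₂ ℚ._-_ (h i) (k i))
      (trans (sym (toℚ-- (m ℤ.* x i) (m ℤ.* y i))) (cong toℚ (dist m (x i) (y i)))) }
  where
  open ℤS
  dist : ∀ m x y → m ℤ.* x ℤ.- m ℤ.* y ≡ m ℤ.* (x ℤ.- y)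
  dist = ℤS.solve 3 (λ m x y → m :* x :- m :* y := m :* (x :- y)) refl

^-≢0 : ∀ m n → m ≢ + 0 → m ℤ.^ n ≢ + 0
^-≢0 m zero m≢0 ()
^-≢0 m (suc n) m≢0 e with ℤP.i*j≡0⇒i≡0∨j≡0 m e
... | inj₁ e′ = m≢0 e′
... | inj₂ e′ = ^-≢0 m n m≢0 e′

abs-^ : ∀ m n → ∣ m ℤ.^ n ∣ ≡ ∣ m ∣ ^ n
abs-^ m zero = refl
abs-^ m (suc n) = trans (ℤP.abs-* m (m ℤ.^ n)) (cong (∣ m ∣ ℕ.*_) (abs-^ m n))

Multiples-card : ∀ {n} m → m ≢ + 0 → Card Λ (Multiples {n} m) (∣ m ∣ ^ n)
Multiples-card {n} m m≢0 = subst (Card Λ (Multiples m)) (trans (cong ∣_∣ (scalar-det n m)) (abs-^ m n))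
  (card-cong (Span-subgroup c) (Multiples-subgroup m) (λ p → p) (λ p → p)
    (λ (a , e) → a , λ i → trans (e i) (cong toℚ (lc-scalar m a i)))
    (λ (a , e) → a , λ i → trans (e i) (cong toℚ (sym (lc-scalar m a i))))
    (proj₁ (span-card c (λ e → ^-≢0 m n m≢0 (trans (sym (scalar-det n m)) e)))))
  where
  c : Fin n → Fin n → ℤ
  c j i = m ℤ.* idI j i

-- The operator D = F - 1

Dℤ : ∀ {n} → IMat n → (Fin n → ℤ) → Fin n → ℤ
Dℤ F x i = Σℤ (λ j → F i j ℤ.* x j) ℤ.- x i

Dℤ-functional : ∀ {n} (F : IMat n) i → Functional (λ x → Dℤ F x i)
Dℤ-functional F i = record
  { ext = λ h → cong₂ ℤ._-_ (Σℤ-cong (λ j → cong (F i j ℤ.*_) (h j))) (h i)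
  ; lin = λ u q v → trans (cong (λ t → t ℤ.- (u i ℤ.- q ℤ.* v i))
        (trans (Σℤ-cong (λ j → dist (F i j) (u j) q (v j))) (Σℤ-sub q (λ j → F i j ℤ.* u j) (λ j → F i j ℤ.* v j))))
      (regroup (Σℤ (λ j → F i j ℤ.* u j)) q (Σℤ (λ j → F i j ℤ.* v j)) (u i) (v i)) }
  where
  open ℤS
  dist : ∀ f u q v → f ℤ.* (u ℤ.- q ℤ.* v) ≡ f ℤ.* u ℤ.- q ℤ.* (f ℤ.* v)
  dist = ℤS.solve 4 (λ f u q v → f :* (u :- q :* v) := f :* u :- q :* (f :* v)) refl
  regroup : ∀ s q t u v → (s ℤ.- q ℤ.* t) ℤ.- (u ℤ.- q ℤ.* v) ≡ (s ℤ.- u) ℤ.- q ℤ.* (t ℤ.- v)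
  regroup = ℤS.solve 5 (λ s q t u v → (s :- q :* t) :- (u :- q :* v) := (s :- u) :- q :* (t :- v)) refl

Ker : ∀ {n} → IMat n → (Fin n → ℤ) → Set
Ker F x = ∀ i → Dℤ F x i ≡ + 0

Ker-ext : ∀ {n} (F : IMat n) {u v : Fin n → ℤ} → (∀ r → u r ≡ v r) → Ker F u → Ker F v
Ker-ext F h k i = trans (sym (ext (Dℤ-functional F i) h)) (k i)

0-q0 : ∀ {a b} q → a ≡ + 0 → b ≡ + 0 → a ℤ.- q ℤ.* b ≡ + 0
0-q0 q e f = trans (cong₂ (λ x y → x ℤ.- q ℤ.* y) e f) (sym (ℤ-0-q0 q))

Ker-sub : ∀ {n} (F : IMat n) {u v : Fin n → ℤ} q → Ker F u → Ker F v → Ker F (λ r → u r ℤ.- q ℤ.* v r)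
Ker-sub F {u} {v} q k l i = trans (lin (Dℤ-functional F i) u q v) (0-q0 q (k i) (l i))

Ker-lc : ∀ {n l} (F : IMat n) (a : Fin l → ℤ) {c : Fin l → Fin n → ℤ} → (∀ i j → Dℤ F (c j) i ≡ + 0) → Ker F (lc a c)
Ker-lc F a {c} h i = functional-lc-0 (Dℤ-functional F i) a c (h i)

lc-lc : ∀ {l m R} (a : Fin l → ℤ) (M : Fin l → Fin m → ℤ) (b : Fin m → R → ℤ) r →
  Σℤ (λ j → a j ℤ.* lc (M j) b r) ≡ lc (lc a M) b r
lc-lc a M b r = begin
  Σℤ (λ j → a j ℤ.* lc (M j) b r)                        ≡⟨ Σℤ-cong (λ j → sym (Σℤ-*ˡ (a j) (λ i → M j i ℤ.* b i r))) ⟩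
  Σℤ (λ j → Σℤ (λ i → a j ℤ.* (M j i ℤ.* b i r)))        ≡⟨ Σℤ-swap (λ j i → a j ℤ.* (M j i ℤ.* b i r)) ⟩
  Σℤ (λ i → Σℤ (λ j → a j ℤ.* (M j i ℤ.* b i r)))        ≡⟨ Σℤ-cong (λ i → trans (Σℤ-cong (λ j → comm (a j) (M j i) (b i r)))
                                                              (trans (Σℤ-*ˡ (b i r) (λ j → a j ℤ.* M j i)) (ℤP.*-comm (b i r) (lc a M i)))) ⟩
  lc (lc a M) b r ∎
  where
  open ≡-Reasoning
  comm : ∀ a m b → a ℤ.* (m ℤ.* b) ≡ b ℤ.* (a ℤ.* m)
  comm = ℤS.solve 3 (λ a m b → a :* (m :* b) := b :* (a :* m)) refl
    where open ℤS

ι-sub : ∀ {I : Set} (u v : I → ℤ) → (ι u ⊖ ι v) ≐ ι (λ i → u i ℤ.- (+ 1) ℤ.* v i)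
ι-sub u v i = trans (sym (toℚ-- (u i) (v i))) (cong (λ t → toℚ (u i ℤ.- t)) (sym (ℤP.*-identityˡ (v i))))

_∙-D[_]_ : ∀ {n} → ℤ → IMat n → (Fin n → ℤ) → Fin n → ℤ
(m ∙-D[ F ] x) i = m ℤ.* x i ℤ.- Dℤ F x i

-- Images of m - D on ℤⁿ, the second enlarged by the integral kernel of D. For large m the first is
-- the column lattice of (1 + m) - F; for m = 0 the second is DΛ + Λ^F.
Im ImK : ∀ {n} → IMat n → ℤ → Pred (V n)
Im {n} F m v = ∃ λ (x : Fin n → ℤ) → v ≐ ι (m ∙-D[ F ] x)
ImK {n} F m v = ∃ λ (x : Fin n → ℤ) → ∃ λ (κ : Fin n → ℤ) → Ker F κ × v ≐ ι (λ i → (m ∙-D[ F ] x) i ℤ.+ κ i)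

∙-D-functional : ∀ {n} (F : IMat n) m i → Functional (λ x → (m ∙-D[ F ] x) i)
∙-D-functional F m i = record
  { ext = λ h → cong₂ ℤ._-_ (cong (m ℤ.*_) (h i)) (ext (Dℤ-functional F i) h)
  ; lin = λ u q v → trans (cong (λ t → m ℤ.* (u i ℤ.- q ℤ.* v i) ℤ.- t) (lin (Dℤ-functional F i) u q v))
      (regroup m (u i) q (v i) (Dℤ F u i) (Dℤ F v i)) }
  where
  open ℤS
  regroup : ∀ m u q v s t → m ℤ.* (u ℤ.- q ℤ.* v) ℤ.- (s ℤ.- q ℤ.* t) ≡ (m ℤ.* u ℤ.- s) ℤ.- q ℤ.* (m ℤ.* v ℤ.- t)
  regroup = ℤS.solve 6 (λ m u q v s t → m :* (u :- q :* v) :- (s :- q :* t) := (m :* u :- s) :- q :* (m :* v :- t)) refl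

Im-subgroup : ∀ {n} (F : IMat n) m → Subgroup (Im F m)
Im-subgroup F m = record
  { resp = λ e (x , h) → x , λ i → trans (sym (e i)) (h i)
  ; zer = (λ _ → + 0) , λ i → cong toℚ (sym (functional-0 (∙-D-functional F m i)))
  ; sub = λ {u} {v} (x , h) (y , k) → (λ i → x i ℤ.- (+ 1) ℤ.* y i) , λ i → trans (cong₂ ℚ._-_ (h i) (k i))
      (trans (ι-sub (m ∙-D[ F ] x) (m ∙-D[ F ] y) i) (cong toℚ (sym (lin (∙-D-functional F m i) x (+ 1) y)))) }

ImK-subgroup : ∀ {n} (F : IMat n) m → Subgroup (ImK F m)
ImK-subgroup F m = record
  { resp = λ e (x , κ , k , h) → x , κ , k , λ i → trans (sym (e i)) (h i)
  ; zer = (λ _ → + 0) , (λ _ → + 0) , (λ i → functional-0 (Dℤ-functional F i)) ,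
      λ i → cong toℚ (sym (trans (cong (ℤ._+ + 0) (functional-0 (∙-D-functional F m i))) refl))
  ; sub = λ {u} {v} (x , κ , k , h) (x′ , κ′ , k′ , h′) → (λ i → x i ℤ.- (+ 1) ℤ.* x′ i) , (λ i → κ i ℤ.- (+ 1) ℤ.* κ′ i) , Ker-sub F (+ 1) k k′ ,
      λ i → trans (cong₂ ℚ._-_ (h i) (h′ i)) (trans (ι-sub (λ i → (m ∙-D[ F ] x) i ℤ.+ κ i) (λ i → (m ∙-D[ F ] x′) i ℤ.+ κ′ i) i)
        (cong toℚ (trans (sym (ℤ-sub-interchange ((m ∙-D[ F ] x) i) ((m ∙-D[ F ] x′) i) (κ i) (κ′ i) (+ 1)))
          (cong (λ t → t ℤ.+ (κ i ℤ.- (+ 1) ℤ.* κ′ i)) (sym (lin (∙-D-functional F m i) x (+ 1) x′)))))) }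

-- In the basis b, z the operator D is block triangular, since it kills z: D′ is its action modulo
-- ker D and C its component into ker D. So m - D has diagonal blocks `A′ m` and the scalar m on k
-- coordinates.
module AdaptedBasis {n : ℕ} (F : IMat n) (ad : Adapted (λ i x → Dℤ F x i)) where
  open Adapted ad

  D′ : Fin ρ → Fin ρ → ℤ
  D′ j = proj₁ (span (Dℤ F (b j)))

  C : Fin ρ → Fin k → ℤ
  C j = proj₁ (proj₂ (span (Dℤ F (b j))))

  A′ : ℤ → Fin ρ → Fin ρ → ℤ
  A′ m j i = m ℤ.* idI j i ℤ.- D′ j i

  κ-of : (Fin ρ → ℤ) → Fin n → ℤ
  κ-of a = lc (lc a C) z

  Ker-z : ∀ c → Ker F (lc c z)
  Ker-z c = Ker-lc F c (λ i j → van i j)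

  D-b : ∀ a r → Dℤ F (lc a b) r ≡ lc (lc a D′) b r ℤ.+ κ-of a r
  D-b a r = begin
    Dℤ F (lc a b) r                                              ≡⟨ functional-lc (Dℤ-functional F r) a b ⟩
    Σℤ (λ j → a j ℤ.* Dℤ F (b j) r)                              ≡⟨ Σℤ-cong (λ j → trans (cong (a j ℤ.*_) (proj₂ (proj₂ (span (Dℤ F (b j)))) r)) (ℤP.*-distribˡ-+ (a j) (lc (D′ j) b r) (lc (C j) z r))) ⟩
    Σℤ (λ j → a j ℤ.* lc (D′ j) b r ℤ.+ a j ℤ.* lc (C j) z r)    ≡⟨ Σℤ-+ (λ j → a j ℤ.* lc (D′ j) b r) (λ j → a j ℤ.* lc (C j) z r) ⟩
    Σℤ (λ j → a j ℤ.* lc (D′ j) b r) ℤ.+ Σℤ (λ j → a j ℤ.* lc (C j) z r) ≡⟨ cong₂ ℤ._+_ (lc-lc a D′ b r) (lc-lc a C z r) ⟩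
    lc (lc a D′) b r ℤ.+ κ-of a r ∎
    where open ≡-Reasoning

  lc-A′ : ∀ m a i → lc a (A′ m) i ≡ m ℤ.* a i ℤ.- (+ 1) ℤ.* lc a D′ i
  lc-A′ m a i = trans (Σℤ-cong (λ j → dist (a j) m (idI j i) (D′ j i)))
    (trans (Σℤ-sub (+ 1) (λ j → a j ℤ.* (m ℤ.* idI j i)) (λ j → a j ℤ.* D′ j i)) (cong (λ t → t ℤ.- (+ 1) ℤ.* lc a D′ i) (lc-scalar m a i)))
    where
    open ℤS
    dist : ∀ a m d e → a ℤ.* (m ℤ.* d ℤ.- e) ≡ a ℤ.* (m ℤ.* d) ℤ.- (+ 1) ℤ.* (a ℤ.* e)
    dist = ℤS.solve 4 (λ a m d e → a :* (m :* d :- e) := a :* (m :* d) :- con (+ 1) :* (a :* e)) refl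

  A-b : ∀ m a r → lc (lc a (A′ m)) b r ≡ (m ∙-D[ F ] (lc a b)) r ℤ.+ κ-of a r
  A-b m a r = begin
    lc (lc a (A′ m)) b r                                    ≡⟨ lc-cong {c = b} {c′ = b} r (lc-A′ m a) (λ _ → refl) ⟩
    lc (λ i → m ℤ.* a i ℤ.- (+ 1) ℤ.* lc a D′ i) b r        ≡⟨ lc-sub (+ 1) (λ i → m ℤ.* a i) (lc a D′) b r ⟩
    lc (λ i → m ℤ.* a i) b r ℤ.- (+ 1) ℤ.* lc (lc a D′) b r ≡⟨ cong (λ t → t ℤ.- (+ 1) ℤ.* lc (lc a D′) b r) (trans (Σℤ-cong (λ j → ℤP.*-assoc m (a j) (b j r))) (Σℤ-*ˡ m (λ j → a j ℤ.* b j r))) ⟩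
    m ℤ.* lc a b r ℤ.- (+ 1) ℤ.* lc (lc a D′) b r           ≡⟨ regroup (m ℤ.* lc a b r) (lc (lc a D′) b r) (κ-of a r) ⟩
    (m ℤ.* lc a b r ℤ.- (lc (lc a D′) b r ℤ.+ κ-of a r)) ℤ.+ κ-of a r ≡⟨ cong (λ t → (m ℤ.* lc a b r ℤ.- t) ℤ.+ κ-of a r) (sym (D-b a r)) ⟩
    (m ∙-D[ F ] (lc a b)) r ℤ.+ κ-of a r ∎
    where
    open ≡-Reasoning
    regroup : ∀ x y k → x ℤ.- (+ 1) ℤ.* y ≡ (x ℤ.- (y ℤ.+ k)) ℤ.+ k
    regroup = ℤS.solve 3 (λ x y k → x :- con (+ 1) :* y := (x :- (y :+ k)) :+ k) refl
      where open ℤS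

  coords : ∀ {l} {v : V l} → Λ v → Fin l → ℤ
  coords h i = proj₁ (h i)

  coords-diff : ∀ {l} {x y : V l} (hx : Λ x) (hy : Λ y) t → (x ⊖ y) ≐ ι t → ∀ i → coords hx i ℤ.- (+ 1) ℤ.* coords hy i ≡ t i
  coords-diff hx hy t e i = toℚ-injective (trans (sym (ι-sub (coords hx) (coords hy) i)) (trans (cong₂ ℚ._-_ (sym (proj₂ (hx i))) (sym (proj₂ (hy i)))) (e i)))

  lc-diff : ∀ {l} {x y : V l} (hx : Λ x) (hy : Λ y) (c : Fin l → Fin n → ℤ) →
    (ι (lc (coords hx) c) ⊖ ι (lc (coords hy) c)) ≐ ι (lc (λ j → coords hx j ℤ.- (+ 1) ℤ.* coords hy j) c)
  lc-diff hx hy c r = trans (ι-sub (lc (coords hx) c) (lc (coords hy) c) r) (cong toℚ (sym (lc-sub (+ 1) (coords hx) (coords hy) c r)))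

  -- Modulo `ImK` the vectors z vanish, so Λ is represented by its b-coordinates, and by `A-b` the
  -- relations left among them are the columns of `A′ m`.
  ImK-card : ∀ m → det (A′ m) ≢ + 0 → Card Λ (ImK F m) ∣ det (A′ m) ∣
  ImK-card m d≢0 = card-transfer (Span-subgroup (A′ m)) (ImK-subgroup F m)
      (λ w hw → ι (lc (coords hw) b)) (λ w hw → Λ-ι (lc (coords hw) b)) to from sur (proj₁ (span-card (A′ m) d≢0))
    where
    to : ∀ x y (hx : Λ x) (hy : Λ y) → Span (A′ m) (x ⊖ y) → ImK F m (ι (lc (coords hx) b) ⊖ ι (lc (coords hy) b))
    to x y hx hy (a , e) = lc a b , κ-of a , Ker-z (lc a C) , λ r → trans (lc-diff hx hy b r)
      (cong toℚ (trans (lc-cong {c = b} {c′ = b} r (coords-diff hx hy (lc a (A′ m)) e) (λ _ → refl)) (A-b m a r)))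
    from : ∀ x y (hx : Λ x) (hy : Λ y) → ImK F m (ι (lc (coords hx) b) ⊖ ι (lc (coords hy) b)) → Span (A′ m) (x ⊖ y)
    from x y hx hy (u , κ , kκ , e) = a , λ i → trans (cong₂ ℚ._-_ (proj₂ (hx i)) (proj₂ (hy i)))
        (trans (ι-sub (coords hx) (coords hy) i) (cong toℚ (X≡ i)))
      where
      open ≡-Reasoning
      a = proj₁ (span u)
      c = proj₁ (proj₂ (span u))
      X : Fin ρ → ℤ
      X j = coords hx j ℤ.- (+ 1) ℤ.* coords hy j
      -- The discrepancy between the coordinates and the predicted column combination: its
      -- b-combination lies in ker D, so `indb` forces it to be 0.
      err : Fin ρ → ℤ
      err j = X j ℤ.- (+ 1) ℤ.* lc a (A′ m) j
      u≡ : ∀ r → u r ≡ lc a b r ℤ.+ lc c z r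
      u≡ = proj₂ (proj₂ (span u))
      Au : ∀ r → (m ∙-D[ F ] u) r ≡ (m ∙-D[ F ] (lc a b)) r ℤ.+ m ℤ.* lc c z r
      Au r = trans (ext (∙-D-functional F m r) u≡) (trans (functional-+ (∙-D-functional F m r) (lc a b) (lc c z))
        (cong (λ t → (m ∙-D[ F ] (lc a b)) r ℤ.+ t) (trans (cong (λ t → m ℤ.* lc c z r ℤ.- t) (Ker-z c r)) (ℤP.+-identityʳ (m ℤ.* lc c z r)))))
      lc-err : ∀ r → lc err b r ≡ (κ r ℤ.- (ℤ.- m) ℤ.* lc c z r) ℤ.- (+ 1) ℤ.* κ-of a r
      lc-err r = begin
        lc err b r ≡⟨ lc-sub (+ 1) X (lc a (A′ m)) b r ⟩
        lc X b r ℤ.- (+ 1) ℤ.* lc (lc a (A′ m)) b r ≡⟨ cong₂ (λ s t → s ℤ.- (+ 1) ℤ.* t) (toℚ-injective {lc X b r} {(m ∙-D[ F ] u) r ℤ.+ κ r} (trans (sym (lc-diff hx hy b r)) (e r))) (A-b m a r) ⟩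
        ((m ∙-D[ F ] u) r ℤ.+ κ r) ℤ.- (+ 1) ℤ.* ((m ∙-D[ F ] (lc a b)) r ℤ.+ κ-of a r) ≡⟨ cong (λ t → (t ℤ.+ κ r) ℤ.- (+ 1) ℤ.* ((m ∙-D[ F ] (lc a b)) r ℤ.+ κ-of a r)) (Au r) ⟩
        (((m ∙-D[ F ] (lc a b)) r ℤ.+ m ℤ.* lc c z r) ℤ.+ κ r) ℤ.- (+ 1) ℤ.* ((m ∙-D[ F ] (lc a b)) r ℤ.+ κ-of a r) ≡⟨ regroup ((m ∙-D[ F ] (lc a b)) r) m (lc c z r) (κ r) (κ-of a r) ⟩
        (κ r ℤ.- (ℤ.- m) ℤ.* lc c z r) ℤ.- (+ 1) ℤ.* κ-of a r ∎
        where
        regroup : ∀ p m q s t → ((p ℤ.+ m ℤ.* q) ℤ.+ s) ℤ.- (+ 1) ℤ.* (p ℤ.+ t) ≡ (s ℤ.- (ℤ.- m) ℤ.* q) ℤ.- (+ 1) ℤ.* t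
        regroup = ℤS.solve 5 (λ p m q s t → ((p :+ m :* q) :+ s) :- con (+ 1) :* (p :+ t) := (s :- (:- m) :* q) :- con (+ 1) :* t) refl
          where open ℤS
      err≡0 : ∀ j → err j ≡ + 0
      err≡0 = indb err (Ker-ext F (λ r → sym (lc-err r)) (Ker-sub F (+ 1) (Ker-sub F (ℤ.- m) kκ (Ker-z c)) (Ker-z (lc a C))))
      X≡ : ∀ i → X i ≡ lc a (A′ m) i
      X≡ i = trans (ℤP.i-j≡0⇒i≡j (X i) ((+ 1) ℤ.* lc a (A′ m) i) (err≡0 i)) (ℤP.*-identityˡ (lc a (A′ m) i))
    sur : ∀ v → Λ v → ∃ λ w → Σ (Λ w) λ hw → ImK F m (v ⊖ ι (lc (coords hw) b))
    sur v hv = ι a , Λ-ι a , (λ _ → + 0) , lc c z , Ker-z c , eq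
      where
      x = coords hv
      a = proj₁ (span x)
      c = proj₁ (proj₂ (span x))
      eq : ∀ r → v r ℚ.- toℚ (lc a b r) ≡ toℚ ((m ∙-D[ F ] (λ _ → + 0)) r ℤ.+ lc c z r)
      eq r = trans (cong (λ t → t ℚ.- toℚ (lc a b r)) (trans (proj₂ (hv r)) (cong toℚ (proj₂ (proj₂ (span x)) r))))
        (trans (sym (toℚ-- (lc a b r ℤ.+ lc c z r) (lc a b r))) (cong toℚ (trans (cancel (lc a b r) (lc c z r))
          (sym (trans (cong (ℤ._+ lc c z r) (functional-0 (∙-D-functional F m r))) (ℤP.+-identityˡ (lc c z r)))))))
        where
        cancel : ∀ a b → (a ℤ.+ b) ℤ.- a ≡ b
        cancel = ℤS.solve 2 (λ a b → (a :+ b) :- a := b) refl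
          where open ℤS

  KerΛ : Pred (V n)
  KerΛ v = ∃ λ (x : Fin n → ℤ) → Ker F x × v ≐ ι x

  kernel-coords : ∀ x → Ker F x → ∃ λ c → ∀ r → x r ≡ lc c z r
  kernel-coords x kx = c , λ r → trans (x≡ r) (trans (cong (ℤ._+ lc c z r) (lc-0 {c = b} r a≡0)) (ℤP.+-identityˡ (lc c z r)))
    where
    a = proj₁ (span x)
    c = proj₁ (proj₂ (span x))
    x≡ : ∀ r → x r ≡ lc a b r ℤ.+ lc c z r
    x≡ = proj₂ (proj₂ (span x))
    a≡0 : ∀ j → a j ≡ + 0
    a≡0 = indb a (Ker-ext F (λ r → trans (cong (λ t → t ℤ.- (+ 1) ℤ.* lc c z r) (x≡ r)) (cancel (lc a b r) (lc c z r))) (Ker-sub F (+ 1) kx (Ker-z c)))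
      where
      cancel : ∀ a b → (a ℤ.+ b) ℤ.- (+ 1) ℤ.* b ≡ a
      cancel = ℤS.solve 2 (λ a b → (a :+ b) :- con (+ 1) :* b := a) refl
        where open ℤS

  z-injective : ∀ X Y → (∀ r → lc X z r ≡ lc Y z r) → ∀ j → X j ≡ Y j
  z-injective X Y h j = trans (ℤP.i-j≡0⇒i≡j (X j) ((+ 1) ℤ.* Y j) (indz (λ j → X j ℤ.- (+ 1) ℤ.* Y j)
    (λ r → trans (lc-sub (+ 1) X Y z r) (trans (cong₂ (λ s t → s ℤ.- t) (h r) (ℤP.*-identityˡ (lc Y z r))) (ℤP.+-inverseʳ (lc Y z r)))) j)) (ℤP.*-identityˡ (Y j))

  lc-mult : ∀ m c r → lc (λ j → m ℤ.* c j) z r ≡ m ℤ.* lc c z r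
  lc-mult m c r = trans (Σℤ-cong (λ j → ℤP.*-assoc m (c j) (z j r))) (Σℤ-*ˡ m (λ j → c j ℤ.* z j r))

  MultK : ℤ → Pred (V n)
  MultK m v = ∃ λ (x : Fin n → ℤ) → Ker F x × v ≐ ι (λ i → m ℤ.* x i)

  MultK-subgroup : ∀ m → Subgroup (MultK m)
  MultK-subgroup m = record
    { resp = λ e (x , k , h) → x , k , λ i → trans (sym (e i)) (h i)
    ; zer = (λ _ → + 0) , (λ i → functional-0 (Dℤ-functional F i)) , λ i → cong toℚ (sym (ℤP.*-zeroʳ m))
    ; sub = λ (x , k , h) (y , l , h′) → (λ i → x i ℤ.- (+ 1) ℤ.* y i) , Ker-sub F (+ 1) k l , λ i → trans (cong₂ ℚ._-_ (h i) (h′ i))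
        (trans (sym (toℚ-- (m ℤ.* x i) (m ℤ.* y i))) (cong toℚ (dist m (x i) (y i)))) }
    where
    open ℤS
    dist : ∀ m x y → m ℤ.* x ℤ.- m ℤ.* y ≡ m ℤ.* (x ℤ.- (+ 1) ℤ.* y)
    dist = ℤS.solve 3 (λ m x y → m :* x :- m :* y := m :* (x :- con (+ 1) :* y)) refl

  MultK-card : ∀ m → m ≢ + 0 → Card KerΛ (MultK m) (∣ m ∣ ^ k)
  MultK-card m m≢0 = card-transfer (Multiples-subgroup m) (MultK-subgroup m)
      (λ w hw → ι (lc (coords hw) z)) (λ w hw → lc (coords hw) z , Ker-z (coords hw) , λ _ → refl) to from sur (Multiples-card m m≢0)
    where
    to : ∀ x y (hx : Λ x) (hy : Λ y) → Multiples m (x ⊖ y) → MultK m (ι (lc (coords hx) z) ⊖ ι (lc (coords hy) z))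
    to x y hx hy (c , e) = lc c z , Ker-z c , λ r → trans (lc-diff hx hy z r)
      (cong toℚ (trans (lc-cong {c = z} {c′ = z} r (coords-diff hx hy (λ i → m ℤ.* c i) e) (λ _ → refl)) (lc-mult m c r)))
    from : ∀ x y (hx : Λ x) (hy : Λ y) → MultK m (ι (lc (coords hx) z) ⊖ ι (lc (coords hy) z)) → Multiples m (x ⊖ y)
    from x y hx hy (u , ku , e) = let (c , u≡) = kernel-coords u ku in c , λ i → trans (cong₂ ℚ._-_ (proj₂ (hx i)) (proj₂ (hy i)))
      (trans (ι-sub (coords hx) (coords hy) i) (cong toℚ (z-injective (λ j → coords hx j ℤ.- (+ 1) ℤ.* coords hy j) (λ j → m ℤ.* c j)
        (λ r → trans (toℚ-injective (trans (sym (lc-diff hx hy z r)) (e r))) (trans (cong (m ℤ.*_) (u≡ r)) (sym (lc-mult m c r)))) i)))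
    sur : ∀ v → KerΛ v → ∃ λ w → Σ (Λ w) λ hw → MultK m (v ⊖ ι (lc (coords hw) z))
    sur v (x , kx , e) = let (c , x≡) = kernel-coords x kx in ι c , Λ-ι c , (λ _ → + 0) , (λ i → functional-0 (Dℤ-functional F i)) ,
      λ r → trans (cong (λ t → t ℚ.- toℚ (lc c z r)) (trans (e r) (cong toℚ (x≡ r)))) (trans (ℚP.+-inverseʳ (toℚ (lc c z r))) (cong toℚ (sym (ℤP.*-zeroʳ m))))

  Injective-D : ℤ → Set
  Injective-D m = ∀ x → (∀ i → (m ∙-D[ F ] x) i ≡ + 0) → ∀ i → x i ≡ + 0

  -- On ker D the operator m - D is multiplication by m, so the quotient is ker D / m ker D once the
  -- image meets ker D only in m ker D.
  ImK-Im-card : ∀ m → m ≢ + 0 → Injective-D m → Card (ImK F m) (Im F m) (∣ m ∣ ^ k)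
  ImK-Im-card m m≢0 inj = card-transfer (MultK-subgroup m) (Im-subgroup F m) (λ v _ → v)
      (λ v (x , kx , e) → (λ _ → + 0) , x , kx , λ i → trans (e i) (cong toℚ (sym (trans (cong (ℤ._+ x i) (functional-0 (∙-D-functional F m i))) (ℤP.+-identityˡ (x i))))))
      to from sur (MultK-card m m≢0)
    where
    A-ker : ∀ x → Ker F x → ∀ i → (m ∙-D[ F ] x) i ≡ m ℤ.* x i
    A-ker x kx i = trans (cong (λ t → m ℤ.* x i ℤ.- t) (kx i)) (ℤP.+-identityʳ (m ℤ.* x i))
    to : ∀ x y (hx : KerΛ x) (hy : KerΛ y) → MultK m (x ⊖ y) → Im F m (x ⊖ y)
    to x y _ _ (u , ku , e) = u , λ i → trans (e i) (cong toℚ (sym (A-ker u ku i)))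
    from : ∀ x y (hx : KerΛ x) (hy : KerΛ y) → Im F m (x ⊖ y) → MultK m (x ⊖ y)
    from x y (x′ , kx , ex) (y′ , ky , ey) (u , e) = u , ku , λ i → trans (e i) (cong toℚ (A-ker u ku i))
      where
      Au≡ : ∀ i → (m ∙-D[ F ] u) i ≡ x′ i ℤ.- (+ 1) ℤ.* y′ i
      Au≡ i = toℚ-injective (trans (sym (e i)) (trans (cong₂ ℚ._-_ (ex i) (ey i)) (ι-sub x′ y′ i)))
      commute : ∀ i → Dℤ F (m ∙-D[ F ] u) i ≡ (m ∙-D[ F ] (Dℤ F u)) i
      commute i = trans (ext (Dℤ-functional F i) (λ r → shape m (u r) (Dℤ F u r)))
        (trans (lin (Dℤ-functional F i) (λ r → + 0 ℤ.- (ℤ.- m) ℤ.* u r) (+ 1) (Dℤ F u))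
          (trans (cong (λ t → t ℤ.- (+ 1) ℤ.* Dℤ F (Dℤ F u) i) (trans (lin (Dℤ-functional F i) (λ _ → + 0) (ℤ.- m) u) (cong (λ t → t ℤ.- (ℤ.- m) ℤ.* Dℤ F u i) (functional-0 (Dℤ-functional F i)))))
            (sym (shape m (Dℤ F u i) (Dℤ F (Dℤ F u) i)))))
        where
        shape : ∀ m u d → m ℤ.* u ℤ.- d ≡ (+ 0 ℤ.- (ℤ.- m) ℤ.* u) ℤ.- (+ 1) ℤ.* d
        shape = ℤS.solve 3 (λ m u d → m :* u :- d := (con (+ 0) :- (:- m) :* u) :- con (+ 1) :* d) refl
          where open ℤS
      -- If (m - D)u lies in ker D then (m - D)Du = D(m - D)u = 0, so Du = 0 by injectivity.
      ku : Ker F u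
      ku = inj (Dℤ F u) (λ i → trans (sym (commute i)) (Ker-ext F (λ r → sym (Au≡ r)) (Ker-sub F (+ 1) kx ky) i))
    sur : ∀ v → ImK F m v → ∃ λ x → Σ (KerΛ x) λ _ → Im F m (v ⊖ x)
    sur v (x , κ , kκ , e) = ι κ , (κ , kκ , λ _ → refl) , x , λ i → trans (cong (λ t → t ℚ.- toℚ (κ i)) (e i))
      (trans (sym (toℚ-- ((m ∙-D[ F ] x) i ℤ.+ κ i) (κ i))) (cong toℚ (cancel ((m ∙-D[ F ] x) i) (κ i))))
      where
      cancel : ∀ a b → (a ℤ.+ b) ℤ.- b ≡ a
      cancel = ℤS.solve 2 (λ a b → (a :+ b) :- b := a) refl
        where open ℤS

  columns : ℤ → Fin n → Fin n → ℤ
  columns m j i = (+ 1 ℤ.+ m) ℤ.* idI i j ℤ.- F i j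

  lc-columns : ∀ m x i → lc x (columns m) i ≡ (m ∙-D[ F ] x) i
  lc-columns m x i = trans (Σℤ-cong (λ j → trans (cong (λ t → x j ℤ.* ((+ 1 ℤ.+ m) ℤ.* t ℤ.- F i j)) (idI-sym i j)) (dist (x j) m (idI j i) (F i j))))
    (trans (Σℤ-sub (+ 1) (λ j → x j ℤ.* ((+ 1 ℤ.+ m) ℤ.* idI j i)) (λ j → F i j ℤ.* x j))
      (trans (cong (λ t → t ℤ.- (+ 1) ℤ.* Σℤ (λ j → F i j ℤ.* x j)) (lc-scalar (+ 1 ℤ.+ m) x i)) (regroup m (x i) (Σℤ (λ j → F i j ℤ.* x j)))))
    where
    open ℤS
    dist : ∀ x m d f → x ℤ.* ((+ 1 ℤ.+ m) ℤ.* d ℤ.- f) ≡ x ℤ.* ((+ 1 ℤ.+ m) ℤ.* d) ℤ.- (+ 1) ℤ.* (f ℤ.* x)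
    dist = ℤS.solve 4 (λ x m d f → x :* ((con (+ 1) :+ m) :* d :- f) := x :* ((con (+ 1) :+ m) :* d) :- con (+ 1) :* (f :* x)) refl
    regroup : ∀ m x s → (+ 1 ℤ.+ m) ℤ.* x ℤ.- (+ 1) ℤ.* s ≡ m ℤ.* x ℤ.- (s ℤ.- x)
    regroup = ℤS.solve 3 (λ m x s → (con (+ 1) :+ m) :* x :- con (+ 1) :* s := m :* x :- (s :- x)) refl

  Im⊆ImK : ∀ m {v} → Im F m v → ImK F m v
  Im⊆ImK m (x , e) = x , (λ _ → + 0) , (λ i → functional-0 (Dℤ-functional F i)) , λ i → trans (e i) (cong toℚ (sym (ℤP.+-identityʳ ((m ∙-D[ F ] x) i))))

  ImK⊆Λ : ∀ m {v} → ImK F m v → Λ v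
  ImK⊆Λ m (x , κ , _ , e) i = (m ∙-D[ F ] x) i ℤ.+ κ i , e i

  -- Both sides count Λ/(m - D)Λ, the right one through `ImK`; comparing indices replaces the
  -- expansion of a block-triangular determinant.
  det-factor : ∀ m → m ≢ + 0 → det (columns m) ≢ + 0 → det (A′ m) ≢ + 0 → ∣ det (columns m) ∣ ≡ ∣ det (A′ m) ∣ ℕ.* ∣ m ∣ ^ k
  det-factor m m≢0 d≢0 d′≢0 = card-unique (Im-subgroup F m)
      (card-cong (Span-subgroup (columns m)) (Im-subgroup F m) (λ p → p) (λ p → p)
        (λ (x , e) → x , λ i → trans (e i) (cong toℚ (lc-columns m x i)))
        (λ (x , e) → x , λ i → trans (e i) (cong toℚ (sym (lc-columns m x i))))
        (proj₁ full))
      (card-tower Λ-subgroup (ImK-subgroup F m) (Im-subgroup F m) (ImK⊆Λ m) (Im⊆ImK m) (ImK-card m d′≢0)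
        (ImK-Im-card m m≢0 (λ x h → proj₂ full x (λ i → trans (lc-columns m x i) (h i)))))
    where
    full : Card Λ (Span (columns m)) ∣ det (columns m) ∣ × Independent (columns m)
    full = span-card (columns m) d≢0

  -- A linear relation between the columns of -D′ is a b-combination x with Dx ∈ ker D. By
  -- hypothesis x ∈ ker D, so its b-coordinates vanish.
  D′-nonsingular : (∀ x → Ker F (Dℤ F x) → Ker F x) → det (A′ (+ 0)) ≢ + 0
  D′-nonsingular ker² e = let (a , h , nz) = det≡0⇒dependent (A′ (+ 0)) e in
    nz (indb a (ker² (lc a b) (Ker-ext F (λ r → sym (D≡κ a h r)) (Ker-z (lc a C)))))
    where
    D≡κ : ∀ a → (∀ i → lc a (A′ (+ 0)) i ≡ + 0) → ∀ r → Dℤ F (lc a b) r ≡ κ-of a r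
    D≡κ a h r = trans (shape (lc a b r) (Dℤ F (lc a b) r) (κ-of a r)) (trans (cong (λ t → κ-of a r ℤ.- t) (trans (sym (A-b (+ 0) a r)) (lc-0 {c = b} r h))) (ℤP.+-identityʳ (κ-of a r)))
      where
      shape : ∀ x d k → d ≡ k ℤ.- ((+ 0 ℤ.* x ℤ.- d) ℤ.+ k)
      shape = ℤS.solve 3 (λ x d k → d := k :- ((con (+ 0) :* x :- d) :+ k)) refl
        where open ℤS

-- Reading off p(1) from the characteristic polynomial modulo a large integer

mod-sym : ∀ {a b m} → a ≡ b [mod m ] → b ≡ a [mod m ]
mod-sym {a} {b} {m} (modulo k e) = modulo (ℤ.- k) (trans (shape b k m) (cong (λ t → t ℤ.+ (ℤ.- k) ℤ.* m) (sym e)))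
  where
  open ℤS
  shape : ∀ b k m → b ≡ (b ℤ.+ k ℤ.* m) ℤ.+ (ℤ.- k) ℤ.* m
  shape = ℤS.solve 3 (λ b k m → b := (b :+ k :* m) :+ (:- k) :* m) refl

mod-trans : ∀ {a b c m} → a ≡ b [mod m ] → b ≡ c [mod m ] → a ≡ c [mod m ]
mod-trans {a} {b} {c} {m} (modulo k e) (modulo l f) = modulo (l ℤ.+ k) (trans e (trans (cong (λ t → t ℤ.+ k ℤ.* m) f) (shape c k l m)))
  where
  open ℤS
  shape : ∀ c k l m → (c ℤ.+ l ℤ.* m) ℤ.+ k ℤ.* m ≡ c ℤ.+ (l ℤ.+ k) ℤ.* m
  shape = ℤS.solve 4 (λ c k l m → (c :+ l :* m) :+ k :* m := c :+ (l :+ k) :* m) refl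

mod-small : ∀ {a b m} → a ≡ b [mod + m ] → ∣ a ∣ ℕ.+ ∣ b ∣ ℕ.< m → a ≡ b
mod-small {a} {b} {m} (modulo k e) lt = ℤP.i-j≡0⇒i≡j a b (trans diff (trans (cong (ℤ._* + m) k≡0) (ℤP.*-zeroˡ (+ m))))
  where
  diff : a ℤ.- b ≡ k ℤ.* + m
  diff = trans (cong (λ t → t ℤ.- b) e) (shape b (k ℤ.* + m))
    where
    open ℤS
    shape : ∀ b x → (b ℤ.+ x) ℤ.- b ≡ x
    shape = ℤS.solve 2 (λ b x → (b :+ x) :- b := x) refl
  small : ∣ k ∣ ℕ.* m ℕ.< 1 ℕ.* m
  small = subst (∣ k ∣ ℕ.* m ℕ.<_) (sym (ℕP.*-identityˡ m))
    (ℕP.≤-<-trans (subst (ℕ._≤ ∣ a ∣ ℕ.+ ∣ b ∣) (trans (cong ∣_∣ diff) (ℤP.abs-* k (+ m))) (ℤP.∣i-j∣≤∣i∣+∣j∣ a b)) lt)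
  k≡0 : k ≡ + 0
  k≡0 = ℤP.∣i∣≡0⇒i≡0 (ℕP.n<1⇒n≡0 (ℕP.*-cancelʳ-< m ∣ k ∣ 1 small))

mod-divisible : ∀ {x a m} → x ≡ a [mod + m ] → m ∣ ∣ x ∣ → ∣ a ∣ ℕ.< m → a ≡ + 0
mod-divisible {x} {a} {m} e d lt = mod-small (mod-trans (mod-sym e) x≡0) (subst (ℕ._< m) (sym (ℕP.+-identityʳ ∣ a ∣)) lt)
  where
  x≡0 : x ≡ + 0 [mod + m ]
  x≡0 with ℤDS.∣ᵤ⇒∣ {+ m} {x} d
  ... | ℤDS.divides q eq = modulo q (trans eq (sym (ℤP.+-identityˡ (q ℤ.* + m))))

mod-neg : ∀ {a b m} → a ≡ b [mod m ] → ℤ.- a ≡ ℤ.- b [mod m ]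
mod-neg {a} {b} {m} (modulo k e) = modulo (ℤ.- k) (trans (cong ℤ.-_ e) (shape b k m))
  where
  open ℤS
  shape : ∀ b k m → ℤ.- (b ℤ.+ k ℤ.* m) ≡ ℤ.- b ℤ.+ (ℤ.- k) ℤ.* m
  shape = ℤS.solve 3 (λ b k m → :- (b :+ k :* m) := :- b :+ (:- k) :* m) refl

power-cancel : ∀ {r d m x y} → m ℕ.> 0 → m ^ r ℕ.* x ≡ y ℕ.* m ^ (r ℕ.+ suc d) → m ∣ x
power-cancel {r} {d} {m} {x} {y} m>0 e = divides (y ℕ.* m ^ d) (ℕP.*-cancelˡ-≡ x ((y ℕ.* m ^ d) ℕ.* m) (m ^ r) {{ℕP.m^n≢0 m r {{ℕ.>-nonZero m>0}}}}
  (trans e (trans (cong (y ℕ.*_) (ℕP.^-distribˡ-+-* m r (suc d))) (shape y (m ^ r) m (m ^ d)))))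
  where
  open ℕS
  shape : ∀ y a m b → y ℕ.* (a ℕ.* (m ℕ.* b)) ≡ a ℕ.* ((y ℕ.* b) ℕ.* m)
  shape = ℕS.solve 4 (λ y a m b → y :* (a :* (m :* b)) := a :* ((y :* b) :* m)) refl

abs-≡⇒± : ∀ i j → ∣ i ∣ ≡ ∣ j ∣ → i ≡ j ⊎ i ≡ ℤ.- j
abs-≡⇒± (+ a) (+ b) e = inj₁ (cong (λ t → + t) e)
abs-≡⇒± (+ a) -[1+ b ] e = inj₂ (cong (λ t → + t) e)
abs-≡⇒± -[1+ a ] (+ suc b) e = inj₂ (cong -[1+_] (ℕP.suc-injective e))
abs-≡⇒± -[1+ a ] -[1+ b ] e = inj₁ (cong -[1+_] (ℕP.suc-injective e))

-- P and δ are nonzero and smaller than m, so neither Pₘ nor δₘ is divisible by m and the powers of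
-- m must agree. Cancelling them gives Pₘ = ± δₘ, hence P ≡ ± δ modulo m, and the bound turns this
-- into equality.
compare-leading-terms : ∀ {r k m} {P Pₘ δ δₘ : ℤ} → Pₘ ≡ P [mod + m ] → δₘ ≡ δ [mod + m ] → P ≢ + 0 → δ ≢ + 0 →
  ∣ P ∣ ℕ.+ ∣ δ ∣ ℕ.< m → m ^ r ℕ.* ∣ Pₘ ∣ ≡ ∣ δₘ ∣ ℕ.* m ^ k → r ≡ k × ∣ P ∣ ≡ ∣ δ ∣
compare-leading-terms {r} {k} {m} {P} {Pₘ} {δ} {δₘ} eP eδ P≢0 δ≢0 lt e = cases (ℕP.<-cmp r k)
  where
  m>0 : m ℕ.> 0
  m>0 = ℕP.≤-<-trans ℕ.z≤n lt
  P<m : ∣ P ∣ ℕ.< m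
  P<m = ℕP.≤-<-trans (ℕP.m≤m+n ∣ P ∣ ∣ δ ∣) lt
  δ<m : ∣ δ ∣ ℕ.< m
  δ<m = ℕP.≤-<-trans (ℕP.m≤n+m ∣ δ ∣ ∣ P ∣) lt
  gap : ∀ {a b} → a ℕ.< b → b ≡ a ℕ.+ suc (b ℕ.∸ suc a)
  gap {a} {b} a<b = sym (trans (ℕP.+-suc a (b ℕ.∸ suc a)) (ℕP.m+[n∸m]≡n a<b))
  abs-eq : ∣ Pₘ ∣ ≡ ∣ δₘ ∣ → ∣ P ∣ ≡ ∣ δ ∣
  abs-eq h with abs-≡⇒± Pₘ δₘ h
  ... | inj₁ eq = cong ∣_∣ (mod-small (mod-trans (mod-sym eP) (mod-trans (mod-refl eq) eδ)) lt)
  ... | inj₂ eq = trans (cong ∣_∣ (mod-small (mod-trans (mod-sym eP) (mod-trans (mod-refl eq) (mod-neg eδ)))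
      (subst (λ t → ∣ P ∣ ℕ.+ t ℕ.< m) (sym (ℤP.∣-i∣≡∣i∣ δ)) lt))) (ℤP.∣-i∣≡∣i∣ δ)
  cases : Tri (r ℕ.< k) (r ≡ k) (r ℕ.> k) → r ≡ k × ∣ P ∣ ≡ ∣ δ ∣
  cases (tri< r<k _ _) = ⊥-elim (P≢0 (mod-divisible eP (power-cancel {r} {k ℕ.∸ suc r} {m} {∣ Pₘ ∣} {∣ δₘ ∣} m>0
    (trans e (cong (λ t → ∣ δₘ ∣ ℕ.* m ^ t) (gap r<k)))) P<m))
  cases (tri> _ _ k<r) = ⊥-elim (δ≢0 (mod-divisible eδ (power-cancel {k} {r ℕ.∸ suc k} {m} {∣ δₘ ∣} {∣ Pₘ ∣} m>0
    (trans (ℕP.*-comm (m ^ k) ∣ δₘ ∣) (trans (sym e) (trans (ℕP.*-comm (m ^ r) ∣ Pₘ ∣) (cong (λ t → ∣ Pₘ ∣ ℕ.* m ^ t) (gap k<r)))))) δ<m))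
  cases (tri≈ _ refl _) = refl , abs-eq (ℕP.*-cancelˡ-≡ ∣ Pₘ ∣ ∣ δₘ ∣ (m ^ r) {{ℕP.m^n≢0 m r {{ℕ.>-nonZero m>0}}}} (trans e (ℕP.*-comm ∣ δₘ ∣ (m ^ r))))

mod-nonzero : ∀ {x a m} → x ≡ a [mod + m ] → a ≢ + 0 → ∣ a ∣ ℕ.< m → x ≢ + 0
mod-nonzero {x} {a} {m} e a≢0 lt x≡0 = a≢0 (mod-divisible e (subst (λ t → m ∣ ∣ t ∣) (sym x≡0) (m ℕD.∣0)) lt)

module CharPoly {n : ℕ} (F : IMat n) (ad : Adapted (λ i x → Dℤ F x i)) (ker² : ∀ x → Ker F (Dℤ F x) → Ker F x)
  (s : ℤ) (r : ℕ) (p : Poly) (s-unit : s ≡ + 1 ⊎ s ≡ -[1+ 0 ])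
  (char : charPoly F ≈P (constP s *P (((XP +P constP -[1+ 0 ]) ^P r) *P p)))
  (p>0 : evalP p (+ 1) ℤ.> + 0) where

  open Adapted ad using (k; ρ)
  open AdaptedBasis F ad

  P δ : ℤ
  P = evalP p (+ 1)
  δ = det (A′ (+ 0))

  P≢0 : P ≢ + 0
  P≢0 e = ℤP.<-irrefl (sym e) p>0

  δ≢0 : δ ≢ + 0
  δ≢0 = D′-nonsingular ker²

  module _ (m : ℕ) (bound : ∣ P ∣ ℕ.+ ∣ δ ∣ ℕ.< m) where

    m>0 : m ℕ.> 0
    m>0 = ℕP.≤-<-trans ℕ.z≤n bound

    -- The polynomial is evaluated at t = 1 + m, where (t - 1)^r becomes m^r.
    det-columns : det (columns (+ m)) ≡ s ℤ.* ((+ m) ℤ.^ r ℤ.* evalP p (+ 1 ℤ.+ + m))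
    det-columns = trans (sym (evalP-charPoly F x)) (trans (evalP-≈ (charPoly F) (constP s *P (((XP +P constP -[1+ 0 ]) ^P r) *P p)) x char)
      (trans (evalP-* (constP s) (((XP +P constP -[1+ 0 ]) ^P r) *P p) x) (cong₂ ℤ._*_ (evalP-const s x)
        (trans (evalP-* ((XP +P constP -[1+ 0 ]) ^P r) p x) (cong (ℤ._* evalP p x)
          (trans (evalP-^ (XP +P constP -[1+ 0 ]) r x) (cong (ℤ._^ r) X-1)))))))
      where
      x : ℤ
      x = + 1 ℤ.+ + m
      shape : ∀ y → (+ 1 ℤ.+ y) ℤ.+ -[1+ 0 ] ≡ y
      shape = ℤS.solve 1 (λ y → (con (+ 1) :+ y) :+ con -[1+ 0 ] := y) refl
        where open ℤS
      X-1 : evalP (XP +P constP -[1+ 0 ]) x ≡ + m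
      X-1 = trans (evalP-+ XP (constP -[1+ 0 ]) x) (trans (cong₂ ℤ._+_ (evalP-X x) (evalP-const -[1+ 0 ] x)) (shape (+ m)))

    abs-s : ∣ s ∣ ≡ 1
    abs-s = [ cong ∣_∣ , cong ∣_∣ ]′ s-unit

    abs-det-columns : ∣ det (columns (+ m)) ∣ ≡ m ^ r ℕ.* ∣ evalP p (+ 1 ℤ.+ + m) ∣
    abs-det-columns = trans (cong ∣_∣ det-columns) (trans (ℤP.abs-* s ((+ m) ℤ.^ r ℤ.* evalP p (+ 1 ℤ.+ + m))) (trans (cong (ℕ._* ∣ (+ m) ℤ.^ r ℤ.* evalP p (+ 1 ℤ.+ + m) ∣) abs-s)
      (trans (ℕP.*-identityˡ ∣ (+ m) ℤ.^ r ℤ.* evalP p (+ 1 ℤ.+ + m) ∣) (trans (ℤP.abs-* ((+ m) ℤ.^ r) (evalP p (+ 1 ℤ.+ + m))) (cong (ℕ._* ∣ evalP p (+ 1 ℤ.+ + m) ∣) (abs-^ (+ m) r))))))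

    eP : evalP p (+ 1 ℤ.+ + m) ≡ P [mod + m ]
    eP = mod-evalP (modulo (+ 1) (cong (λ t → + 1 ℤ.+ t) (sym (ℤP.*-identityˡ (+ m))))) p

    eδ : det (A′ (+ m)) ≡ δ [mod + m ]
    eδ = mod-det (λ j i → modulo (idI j i) (shape (+ m) (idI j i) (D′ j i)))
      where
      open ℤS
      shape : ∀ m d e → m ℤ.* d ℤ.- e ≡ (+ 0 ℤ.* d ℤ.- e) ℤ.+ d ℤ.* m
      shape = ℤS.solve 3 (λ m d e → m :* d :- e := (con (+ 0) :* d :- e) :+ d :* m) refl

    Pₘ≢0 : evalP p (+ 1 ℤ.+ + m) ≢ + 0
    Pₘ≢0 = mod-nonzero eP P≢0 (ℕP.≤-<-trans (ℕP.m≤m+n ∣ P ∣ ∣ δ ∣) bound)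

    det-columns≢0 : det (columns (+ m)) ≢ + 0
    det-columns≢0 e with ℕP.m*n≡0⇒m≡0∨n≡0 (m ^ r) (trans (sym abs-det-columns) (cong ∣_∣ e))
    ... | inj₁ z = ℕ.≢-nonZero⁻¹ (m ^ r) {{ℕP.m^n≢0 m r {{ℕ.>-nonZero m>0}}}} z
    ... | inj₂ z = Pₘ≢0 (ℤP.∣i∣≡0⇒i≡0 z)

    leading-at : r ≡ k × ∣ P ∣ ≡ ∣ δ ∣
    leading-at = compare-leading-terms eP eδ P≢0 δ≢0 bound
      (trans (sym abs-det-columns) (det-factor (+ m) (λ eq → ℕP.<⇒≢ m>0 (sym (ℤP.+-injective eq))) det-columns≢0
        (mod-nonzero eδ δ≢0 (ℕP.≤-<-trans (ℕP.m≤n+m ∣ δ ∣ ∣ P ∣) bound))))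

  leading : r ≡ k × ∣ P ∣ ≡ ∣ δ ∣
  -- Any modulus above ∣P∣ + ∣δ∣ serves; this is the least.
  leading = leading-at (suc (∣ P ∣ ℕ.+ ∣ δ ∣)) ℕP.≤-refl

  image-card : Card Λ (ImK F (+ 0)) ∣ P ∣
  image-card = subst (Card Λ (ImK F (+ 0))) (sym (proj₂ leading)) (ImK-card (+ 0) δ≢0)

  kernel-card : ∀ e → e ℕ.> 0 → Card KerΛ (MultK (+ e)) (e ^ r)
  kernel-card e e>0 = subst (λ t → Card KerΛ (MultK (+ e)) (e ^ t)) (sym (proj₁ leading))
    (MultK-card (+ e) (λ eq → ℕP.<⇒≢ e>0 (sym (ℤP.+-injective eq))))

-- Linear operators and the pairing

Σℚ-cong : ∀ {n} {f g : Fin n → ℚ} → (∀ i → f i ≡ g i) → Σℚ f ≡ Σℚ g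
Σℚ-cong {zero} h = refl
Σℚ-cong {suc n} h = cong₂ ℚ._+_ (h zero) (Σℚ-cong (λ i → h (suc i)))

Σℚ-0 : ∀ {n} {f : Fin n → ℚ} → (∀ i → f i ≡ 0ℚ) → Σℚ f ≡ 0ℚ
Σℚ-0 {zero} h = refl
Σℚ-0 {suc n} h = cong₂ ℚ._+_ (h zero) (Σℚ-0 (λ i → h (suc i)))

Σℚ-+ : ∀ {n} (f g : Fin n → ℚ) → Σℚ (λ i → f i ℚ.+ g i) ≡ Σℚ f ℚ.+ Σℚ g
Σℚ-+ {zero} f g = refl
Σℚ-+ {suc n} f g = trans (cong (λ t → (f zero ℚ.+ g zero) ℚ.+ t) (Σℚ-+ (λ i → f (suc i)) (λ i → g (suc i))))
  (interchange-+ (f zero) (g zero) (Σℚ (λ i → f (suc i))) (Σℚ (λ i → g (suc i))))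

Σℚ-sub : ∀ {n} (f g : Fin n → ℚ) → Σℚ (λ i → f i ℚ.- g i) ≡ Σℚ f ℚ.- Σℚ g
Σℚ-sub {zero} f g = refl
Σℚ-sub {suc n} f g = trans (cong (λ t → (f zero ℚ.- g zero) ℚ.+ t) (Σℚ-sub (λ i → f (suc i)) (λ i → g (suc i))))
  (interchange-- (f zero) (g zero) (Σℚ (λ i → f (suc i))) (Σℚ (λ i → g (suc i))))

Σℚ-*ˡ : ∀ {n} c (f : Fin n → ℚ) → Σℚ (λ i → c ℚ.* f i) ≡ c ℚ.* Σℚ f
Σℚ-*ˡ {zero} c f = sym (ℚP.*-zeroʳ c)
Σℚ-*ˡ {suc n} c f = trans (cong (λ t → c ℚ.* f zero ℚ.+ t) (Σℚ-*ˡ c (λ i → f (suc i)))) (sym (ℚP.*-distribˡ-+ c (f zero) (Σℚ (λ i → f (suc i)))))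

Σℚ-swap : ∀ {m n} (f : Fin m → Fin n → ℚ) → Σℚ (λ i → Σℚ (f i)) ≡ Σℚ (λ j → Σℚ (λ i → f i j))
Σℚ-swap {zero} {n} f = sym (Σℚ-0 {n} (λ _ → refl))
Σℚ-swap {suc m} f = trans (cong (λ t → Σℚ (f zero) ℚ.+ t) (Σℚ-swap (λ i → f (suc i)))) (sym (Σℚ-+ (f zero) (λ j → Σℚ (λ i → f (suc i) j))))

toℚ-Σ : ∀ {n} (f : Fin n → ℤ) → toℚ (Σℤ f) ≡ Σℚ (λ i → toℚ (f i))
toℚ-Σ {zero} f = refl
toℚ-Σ {suc n} f = trans (toℚ-+ (f zero) (Σℤ (λ i → f (suc i)))) (cong (λ t → toℚ (f zero) ℚ.+ t) (toℚ-Σ (λ i → f (suc i))))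

int-Σ : ∀ {n} {f : Fin n → ℚ} → (∀ i → IsInt (f i)) → IsInt (Σℚ f)
int-Σ {zero} h = int-0
int-Σ {suc n} h = int-+ (h zero) (int-Σ (λ i → h (suc i)))

record Linear {n : ℕ} (f : V n → V n) : Set where
  field
    lresp : ∀ {u v} → u ≐ v → f u ≐ f v
    lsub  : ∀ u v → f (u ⊖ v) ≐ f u ⊖ f v
    lmul  : ∀ c u → f (c ⊙ u) ≐ c ⊙ f u

  lzero : f 𝟎 ≐ 𝟎
  lzero i = trans (lresp {𝟎} {0ℚ ⊙ 𝟎} (λ _ → refl) i) (trans (lmul 0ℚ 𝟎 i) (ℚP.*-zeroˡ (f 𝟎 i)))

  ladd : ∀ u v → f (u ⊕ v) ≐ f u ⊕ f v
  ladd u v i = trans (lresp {u ⊕ v} {u ⊖ (𝟎 ⊖ v)} (λ j → sym (x-[0-y]≡x+y (u j) (v j))) i)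
    (trans (lsub u (𝟎 ⊖ v) i) (trans (cong (λ t → f u i ℚ.- t) (trans (lsub 𝟎 v i) (cong (λ t → t ℚ.- f v i) (lzero i)))) (x-[0-y]≡x+y (f u i) (f v i))))

open Linear

id-linear : ∀ {n} → Linear {n} (λ v → v)
id-linear = record { lresp = λ e → e ; lsub = λ _ _ _ → refl ; lmul = λ _ _ _ → refl }

∘-linear : ∀ {n} {f g : V n → V n} → Linear f → Linear g → Linear (λ v → f (g v))
∘-linear {f = f} {g} F G = record
  { lresp = λ e → lresp F (lresp G e)
  ; lsub = λ u v i → trans (lresp F (lsub G u v) i) (lsub F (g u) (g v) i)
  ; lmul = λ c u i → trans (lresp F (lmul G c u) i) (lmul F c (g u) i) }

⊖-linear : ∀ {n} {f g : V n → V n} → Linear f → Linear g → Linear (λ v → f v ⊖ g v)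
⊖-linear {f = f} {g} F G = record
  { lresp = λ e i → cong₂ ℚ._-_ (lresp F e i) (lresp G e i)
  ; lsub = λ u v i → trans (cong₂ ℚ._-_ (lsub F u v i) (lsub G u v i)) ([a-b]-[c-d] (f u i) (f v i) (g u i) (g v i))
  ; lmul = λ c u i → trans (cong₂ ℚ._-_ (lmul F c u i) (lmul G c u i)) (sym (distribˡ-- c (f u i) (g u i))) }

⊕-linear : ∀ {n} {f g : V n → V n} → Linear f → Linear g → Linear (λ v → f v ⊕ g v)
⊕-linear {f = f} {g} F G = record
  { lresp = λ e i → cong₂ ℚ._+_ (lresp F e i) (lresp G e i)
  ; lsub = λ u v i → trans (cong₂ ℚ._+_ (lsub F u v i) (lsub G u v i)) (interchange-- (f u i) (f v i) (g u i) (g v i))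
  ; lmul = λ c u i → trans (cong₂ ℚ._+_ (lmul F c u i) (lmul G c u i)) (sym (ℚP.*-distribˡ-+ c (f u i) (g u i))) }

act-linear : ∀ {n} (M : IMat n) → Linear (act M)
act-linear M = record
  { lresp = λ e i → Σℚ-cong (λ j → cong (toℚ (M i j) ℚ.*_) (e j))
  ; lsub = λ u v i → trans (Σℚ-cong (λ j → distribˡ-- (toℚ (M i j)) (u j) (v j))) (Σℚ-sub (λ j → toℚ (M i j) ℚ.* u j) (λ j → toℚ (M i j) ℚ.* v j))
  ; lmul = λ c u i → trans (Σℚ-cong (λ j → x*[y*z]≡y*[x*z] (toℚ (M i j)) c (u j))) (Σℚ-*ˡ c (λ j → toℚ (M i j) ℚ.* u j)) }

actD-linear : ∀ {n} (M : IMat n) → Linear (actD M)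
actD-linear M = ⊖-linear (act-linear M) id-linear

actPow-linear : ∀ {n} (M : IMat n) k → Linear (actPow M k)
actPow-linear M zero = id-linear
actPow-linear M (suc k) = ∘-linear (act-linear M) (actPow-linear M k)

act-∘ : ∀ {n} (M N : IMat n) v → act M (act N v) ≐ act (M *I N) v
act-∘ M N v i = begin
  Σℚ (λ j → toℚ (M i j) ℚ.* Σℚ (λ k → toℚ (N j k) ℚ.* v k))        ≡⟨ Σℚ-cong (λ j → sym (Σℚ-*ˡ (toℚ (M i j)) (λ k → toℚ (N j k) ℚ.* v k))) ⟩
  Σℚ (λ j → Σℚ (λ k → toℚ (M i j) ℚ.* (toℚ (N j k) ℚ.* v k)))      ≡⟨ Σℚ-swap (λ j k → toℚ (M i j) ℚ.* (toℚ (N j k) ℚ.* v k)) ⟩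
  Σℚ (λ k → Σℚ (λ j → toℚ (M i j) ℚ.* (toℚ (N j k) ℚ.* v k)))      ≡⟨ Σℚ-cong (λ k → inner k) ⟩
  Σℚ (λ k → toℚ ((M *I N) i k) ℚ.* v k)                            ∎
  where
  open ≡-Reasoning
  inner : ∀ k → Σℚ (λ j → toℚ (M i j) ℚ.* (toℚ (N j k) ℚ.* v k)) ≡ toℚ ((M *I N) i k) ℚ.* v k
  inner k = trans (Σℚ-cong (λ j → trans ([x*y]*z≡z*[x*y] (toℚ (M i j)) (toℚ (N j k)) (v k)) (cong (v k ℚ.*_) (sym (toℚ-* (M i j) (N j k))))))
    (trans (Σℚ-*ˡ (v k) (λ j → toℚ (M i j ℤ.* N j k))) (trans (cong (v k ℚ.*_) (sym (toℚ-Σ (λ j → M i j ℤ.* N j k)))) (ℚP.*-comm (v k) (toℚ ((M *I N) i k)))))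

Σℚ-idI : ∀ {n} (v : V n) i → Σℚ (λ j → toℚ (idI i j) ℚ.* v j) ≡ v i
Σℚ-idI {suc n} v zero = trans (cong₂ ℚ._+_ (ℚP.*-identityˡ (v zero)) (Σℚ-0 (λ j → ℚP.*-zeroˡ (v (suc j))))) (ℚP.+-identityʳ (v zero))
Σℚ-idI {suc n} v (suc i) = trans (cong₂ ℚ._+_ (ℚP.*-zeroˡ (v zero)) (trans (Σℚ-cong (λ j → cong (λ t → toℚ t ℚ.* v (suc j)) (idI-suc i j))) (Σℚ-idI (λ j → v (suc j)) i))) (ℚP.+-identityˡ (v (suc i)))

act-inverse : ∀ {n} (M N : IMat n) → (∀ i j → (M *I N) i j ≡ idI i j) → ∀ v → act M (act N v) ≐ v
act-inverse M N h v i = trans (act-∘ M N v i) (trans (Σℚ-cong (λ j → cong (λ t → toℚ t ℚ.* v j) (h i j))) (Σℚ-idI v i))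

act-ι : ∀ {n} (M : IMat n) x → act M (ι x) ≐ ι (λ i → Σℤ (λ j → M i j ℤ.* x j))
act-ι M x i = trans (Σℚ-cong (λ j → sym (toℚ-* (M i j) (x j)))) (sym (toℚ-Σ (λ j → M i j ℤ.* x j)))

actD-ι : ∀ {n} (M : IMat n) x → actD M (ι x) ≐ ι (Dℤ M x)
actD-ι M x i = trans (cong (λ t → t ℚ.- toℚ (x i)) (act-ι M x i)) (sym (toℚ-- (Σℤ (λ j → M i j ℤ.* x j)) (x i)))

act-Λ : ∀ {n} (M : IMat n) v → Λ v → Λ (act M v)
act-Λ M v h i = int-Σ (λ j → int-* (int-toℚ (M i j)) (h j))

pair-bilinear : ∀ {n} (B : QMat n) → Bilinear (pair B)
pair-bilinear B = record
  { respˡ = λ {u} {v} {y} e → Σℚ-cong (λ i → Σℚ-cong (λ j → cong (λ t → t ℚ.* (B i j ℚ.* y j)) (e i)))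
  ; respʳ = λ {u} {y} {z} e → Σℚ-cong (λ i → Σℚ-cong (λ j → cong (λ t → u i ℚ.* (B i j ℚ.* t)) (e j)))
  ; subˡ = λ u v y → trans (Σℚ-cong (λ i → trans (Σℚ-cong (λ j → sym (factor-sub (u i) (v i) (B i j ℚ.* y j)))) (Σℚ-sub (λ j → u i ℚ.* (B i j ℚ.* y j)) (λ j → v i ℚ.* (B i j ℚ.* y j)))))
      (Σℚ-sub (λ i → Σℚ (λ j → u i ℚ.* (B i j ℚ.* y j))) (λ i → Σℚ (λ j → v i ℚ.* (B i j ℚ.* y j))))
  ; subʳ = λ u y z → trans (Σℚ-cong (λ i → trans (Σℚ-cong (λ j → trans (cong (u i ℚ.*_) (distribˡ-- (B i j) (y j) (z j))) (distribˡ-- (u i) (B i j ℚ.* y j) (B i j ℚ.* z j)))) (Σℚ-sub (λ j → u i ℚ.* (B i j ℚ.* y j)) (λ j → u i ℚ.* (B i j ℚ.* z j)))))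
      (Σℚ-sub (λ i → Σℚ (λ j → u i ℚ.* (B i j ℚ.* y j))) (λ i → Σℚ (λ j → u i ℚ.* (B i j ℚ.* z j))))
  ; mulˡ = λ c u y → trans (Σℚ-cong (λ i → trans (Σℚ-cong (λ j → ℚP.*-assoc c (u i) (B i j ℚ.* y j))) (Σℚ-*ˡ c (λ j → u i ℚ.* (B i j ℚ.* y j)))))
      (Σℚ-*ˡ c (λ i → Σℚ (λ j → u i ℚ.* (B i j ℚ.* y j))))
  ; mulʳ = λ c u y → trans (Σℚ-cong (λ i → trans (Σℚ-cong (λ j → trans (cong (u i ℚ.*_) (x*[y*z]≡y*[x*z] (B i j) c (y j))) (x*[y*z]≡y*[x*z] (u i) c (B i j ℚ.* y j)))) (Σℚ-*ˡ c (λ j → u i ℚ.* (B i j ℚ.* y j)))))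
      (Σℚ-*ˡ c (λ i → Σℚ (λ j → u i ℚ.* (B i j ℚ.* y j)))) }

bilinear-∘ : ∀ {n} {b : V n → V n → ℚ} {f g : V n → V n} c → Bilinear b → Linear f → Linear g → Bilinear (λ u v → c ℚ.* b (f u) (g v))
bilinear-∘ {b = b} {f} {g} c bl F G = record
  { respˡ = λ e → cong (c ℚ.*_) (respˡ bl (lresp F e))
  ; respʳ = λ e → cong (c ℚ.*_) (respʳ bl (lresp G e))
  ; subˡ = λ u v y → trans (cong (c ℚ.*_) (trans (respˡ bl (lsub F u v)) (subˡ bl (f u) (f v) (g y)))) (distribˡ-- c (b (f u) (g y)) (b (f v) (g y)))
  ; subʳ = λ u y z → trans (cong (c ℚ.*_) (trans (respʳ bl (lsub G y z)) (subʳ bl (f u) (g y) (g z)))) (distribˡ-- c (b (f u) (g y)) (b (f u) (g z)))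
  ; mulˡ = λ d u y → trans (cong (c ℚ.*_) (trans (respˡ bl (lmul F d u)) (mulˡ bl d (f u) (g y)))) (x*[y*z]≡y*[x*z] c d (b (f u) (g y)))
  ; mulʳ = λ d u y → trans (cong (c ℚ.*_) (trans (respʳ bl (lmul G d y)) (mulʳ bl d (f u) (g y)))) (x*[y*z]≡y*[x*z] c d (b (f u) (g y))) }

unit : ∀ {n} → Fin n → V n
unit j = ι (λ i → idI i j)

pair-unit : ∀ {n} (B : QMat n) v w → pair B v w ≡ Σℚ (λ j → w j ℚ.* pair B v (unit j))
pair-unit B v w = trans (Σℚ-cong (λ i → Σℚ-cong (λ j → [x*y]*z≡z*[x*y] (v i) (B i j) (w j))))
  (trans (Σℚ-swap (λ i j → w j ℚ.* (v i ℚ.* B i j)))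
    (Σℚ-cong (λ j → trans (Σℚ-*ˡ (w j) (λ i → v i ℚ.* B i j)) (cong (w j ℚ.*_) (Σℚ-cong (λ i → sym (entry i j)))))))
  where
  entry : ∀ i j → Σℚ (λ l → v i ℚ.* (B i l ℚ.* toℚ (idI l j))) ≡ v i ℚ.* B i j
  entry i j = trans (Σℚ-cong (λ l → trans ([x*y]*z≡z*[x*y] (v i) (B i l) (toℚ (idI l j))) (cong (λ t → toℚ t ℚ.* (v i ℚ.* B i l)) (idI-sym l j))))
    (Σℚ-idI (λ l → v i ℚ.* B i l) j)

Λdual-unit : ∀ {n} (B : QMat n) v → (∀ j → IsInt (pair B v (unit j))) → Λdual B v
Λdual-unit B v h l hl = int-resp (sym (pair-unit B v l)) (int-Σ (λ j → int-* (hl j) (h j)))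

-- Non-membership must produce a vector, as `wit` demands; by linearity it can be searched for among
-- the n unit vectors.
Λdual-witness : ∀ {n} (B : QMat n) v → ¬ Λdual B v → ∃ λ l → Λ l × ¬ IsInt (pair B v l)
Λdual-witness {n} B v ¬d = let (j , ¬i) = FinP.¬∀⟶∃¬ n _ (λ j → int? (pair B v (unit j))) (λ h → ¬d (Λdual-unit B v h)) in
  unit j , Λ-ι (λ i → idI i j) , ¬i

Λdual? : ∀ {n} (B : QMat n) v → Dec (Λdual B v)
Λdual? B v with FinP.all? (λ j → int? (pair B v (unit j)))
... | yes h = yes (Λdual-unit B v h)
... | no ¬h = no λ d → ¬h (λ j → d (unit j) (Λ-ι (λ i → idI i j)))

Λ? : ∀ {n} (v : V n) → Dec (Λ v)
Λ? v = FinP.all? (λ i → int? (v i))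

Λdual-subgroup : ∀ {n} (B : QMat n) → Subgroup (Λdual B)
Λdual-subgroup B = record
  { resp = λ e d l hl → int-resp (respˡ (pair-bilinear B) e) (d l hl)
  ; zer = λ l hl → int-resp (sym (trans (respˡ (pair-bilinear B) {𝟎} {0ℚ ⊙ 𝟎} (λ _ → refl)) (trans (mulˡ (pair-bilinear B) 0ℚ 𝟎 l) (ℚP.*-zeroˡ (pair B 𝟎 l))))) int-0
  ; sub = λ {u} {v} d d′ l hl → int-resp (sym (subˡ (pair-bilinear B) u v l)) (int-- (d l hl) (d′ l hl)) }

preimage-subgroup : ∀ {n} {A : Pred (V n)} {f : V n → V n} → Subgroup A → Linear f → Subgroup (λ v → A (f v))
preimage-subgroup {f = f} sA F = record
  { resp = λ e → resp sA (lresp F e)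
  ; zer = resp sA (λ i → sym (lzero F i)) (zer sA)
  ; sub = λ {u} {v} p q → resp sA (λ i → sym (lsub F u v i)) (sub sA p q) }

∩-subgroup : ∀ {I} {A B : Pred (W I)} → Subgroup A → Subgroup B → Subgroup (λ v → A v × B v)
∩-subgroup sA sB = record
  { resp = λ e (p , q) → resp sA e p , resp sB e q
  ; zer = zer sA , zer sB
  ; sub = λ (p , q) (p′ , q′) → sub sA p p′ , sub sB q q′ }

+-subgroup : ∀ {I} {A B : Pred (W I)} → Subgroup A → Subgroup B → Subgroup (λ v → ∃ λ a → ∃ λ c → A a × B c × v ≐ a ⊕ c)
+-subgroup {I} sA sB = record
  { resp = λ e (a , c , p , q , h) → a , c , p , q , λ i → trans (sym (e i)) (h i)
  ; zer = 𝟎 , 𝟎 , zer sA , zer sB , λ _ → refl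
  ; sub = λ {u} {v} (a , c , p , q , h) (a′ , c′ , p′ , q′ , h′) → a ⊖ a′ , c ⊖ c′ , sub sA p p′ , sub sB q q′ ,
      λ i → trans (cong₂ ℚ._-_ (h i) (h′ i)) ([a+b]-[c+d] (a i) (c i) (a′ i) (c′ i)) }

scale-subgroup : ∀ {I} {A : Pred (W I)} c → Subgroup A → Subgroup (λ v → ∃ λ w → A w × v ≐ c ⊙ w)
scale-subgroup c sA = record
  { resp = λ e (w , p , h) → w , p , λ i → trans (sym (e i)) (h i)
  ; zer = 𝟎 , zer sA , λ i → sym (ℚP.*-zeroʳ c)
  ; sub = λ {u} {v} (w , p , h) (w′ , p′ , h′) → w ⊖ w′ , sub sA p p′ , λ i → trans (cong₂ ℚ._-_ (h i) (h′ i)) (sym (distribˡ-- c (w i) (w′ i))) }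

≐0-subgroup : ∀ {I} → Subgroup (λ (v : W I) → v ≐ 𝟎)
≐0-subgroup = record
  { resp = λ e h i → trans (sym (e i)) (h i) ; zer = λ _ → refl ; sub = λ p q i → cong₂ ℚ._-_ (p i) (q i) }

clear : ∀ {n} (v : V n) → ∃ λ m → m ℕ.> 0 × Λ (ℕtoℚ m ⊙ v)
clear {zero} v = 1 , ℕ.s≤s ℕ.z≤n , λ ()
clear {suc n} v = let (m , m>0 , h) = clear (λ i → v (suc i)) in d ℕ.* m , ℕP.*-mono-≤ d>0 m>0 ,
    λ { zero → int-resp (trans (sym (ℚP.*-assoc (ℕtoℚ m) (ℕtoℚ d) (v zero))) (cong (ℚ._* v zero) (trans (sym (ℕtoℚ-* m d)) (cong ℕtoℚ (ℕP.*-comm m d))))) (int-* (int-toℚ (+ m)) dv)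
      ; (suc i) → int-resp (trans (sym (ℚP.*-assoc (ℕtoℚ d) (ℕtoℚ m) (v (suc i)))) (cong (ℚ._* v (suc i)) (sym (ℕtoℚ-* d m)))) (int-* (int-toℚ (+ d)) (h i)) }
  where
  d : ℕ
  d = ℚ.↧ₙ (v zero)
  d>0 : d ℕ.> 0
  d>0 = ℕ.s≤s ℕ.z≤n
  dv : IsInt (ℕtoℚ d ℚ.* v zero)
  dv = ℚ.↥ (v zero) , denominator-clears (v zero)

-- The lattice, its dual and the kernel of D

module Lattice {n : ℕ} (F : IMat n) (B : QMat n) (G : IMat n)
  (FG : ∀ v → act F (act G v) ≐ v)
  (kerD² : KerDEqKerD² F) (symB : SymmetricForm B) (invB : FInvariant F B)
  (dual⊆ : ∀ (v : V n) → Λdual B v → Λ v) where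

  D : V n → V n
  D = actD F

  Ft : V n → V n
  Ft = act F

  bl : Bilinear (pair B)
  bl = pair-bilinear B

  linD : Linear D
  linD = actD-linear F

  linF : Linear Ft
  linF = act-linear F

  sΛ : Subgroup (Λ {n})
  sΛ = Λ-subgroup

  sΛ∨ : Subgroup (Λdual B)
  sΛ∨ = Λdual-subgroup B

  K : Pred (V n)
  K v = D v ≐ 𝟎

  sK : Subgroup K
  sK = preimage-subgroup ≐0-subgroup linD

  D-Λ : ∀ v → Λ v → Λ (D v)
  D-Λ v h = sub sΛ {act F v} {v} (act-Λ F v h) h

  F-Λ∨ : ∀ v → Λdual B v → Λdual B (Ft v)
  F-Λ∨ v d l hl = int-resp (trans (sym (invB v (act G l))) (respʳ bl {u = Ft v} (FG l))) (d (act G l) (act-Λ G l hl))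

  D-Λ∨ : ∀ v → Λdual B v → Λdual B (D v)
  D-Λ∨ v d = sub sΛ∨ {Ft v} {v} (F-Λ∨ v d) d

  K⇒fixed : ∀ {c} → K c → Ft c ≐ c
  K⇒fixed {c} h i = trans (sym ([x-y]+y≡x (Ft c i) (c i))) (trans (cong (ℚ._+ c i) (h i)) (ℚP.+-identityˡ (c i)))

  fixed⇒K : ∀ {c} → Ft c ≐ c → K c
  fixed⇒K {c} h i = trans (cong (λ t → t ℚ.- c i) (h i)) (ℚP.+-inverseʳ (c i))

  D⊥K : ∀ u c → K c → pair B (D u) c ≡ 0ℚ
  D⊥K u c h = trans (subˡ bl (Ft u) u c) (trans (cong (λ t → t ℚ.- pair B u c)
    (trans (respʳ bl {u = Ft u} (λ i → sym (K⇒fixed h i))) (invB u c))) (ℚP.+-inverseʳ (pair B u c)))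

  -- The adjoint of D is F⁻¹ - 1 = -DF⁻¹; an extra F on the second argument keeps the inverse out of
  -- the formula.
  D-adjoint : ∀ v u → pair B v (D u) ≡ (ℚ.- 1ℚ) ℚ.* pair B (D v) (Ft u)
  D-adjoint v u = trans (subʳ bl v (Ft u) u) (trans (cong (λ t → pair B v (Ft u) ℚ.- t) (sym (invB v u)))
    (trans (x-y≡-[y-x] (pair B v (Ft u)) (pair B (Ft v) (Ft u))) (cong ((ℚ.- 1ℚ) ℚ.*_) (sym (subˡ bl (Ft v) v (Ft u))))))

  D-square : ∀ u → pair B (D u) (D u) ≡ (ℚ.- 1ℚ) ℚ.* ((1ℚ ℚ.+ 1ℚ) ℚ.* pair B u (D u))
  D-square u = begin
    pair B (D u) (D u)                                       ≡⟨ subˡ bl (Ft u) u (D u) ⟩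
    pair B (Ft u) (D u) ℚ.- pair B u (D u)                   ≡⟨ cong₂ ℚ._-_ (trans (subʳ bl (Ft u) (Ft u) u) (cong₂ ℚ._-_ (invB u u) (symB (Ft u) u))) (subʳ bl u (Ft u) u) ⟩
    (pair B u u ℚ.- pair B u (Ft u)) ℚ.- (pair B u (Ft u) ℚ.- pair B u u) ≡⟨ D-square-identity (pair B u u) (pair B u (Ft u)) (pair B u u) ⟩
    (ℚ.- 1ℚ) ℚ.* ((pair B u (Ft u) ℚ.- pair B u u) ℚ.+ (pair B u (Ft u) ℚ.- pair B u u)) ≡⟨ cong (λ t → (ℚ.- 1ℚ) ℚ.* (t ℚ.+ t)) (sym (subʳ bl u (Ft u) u)) ⟩
    (ℚ.- 1ℚ) ℚ.* (pair B u (D u) ℚ.+ pair B u (D u))         ≡⟨ cong ((ℚ.- 1ℚ) ℚ.*_) (double (pair B u (D u))) ⟩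
    (ℚ.- 1ℚ) ℚ.* ((1ℚ ℚ.+ 1ℚ) ℚ.* pair B u (D u))            ∎
    where open ≡-Reasoning

  -- The hypothesis concerns lattice vectors only; clearing denominators extends it to V.
  D²-kernel : ∀ v → K (D v) → K v
  D²-kernel v h = cleared (clear v)
    where
    cleared : (∃ λ m → m ℕ.> 0 × Λ (ℕtoℚ m ⊙ v)) → K v
    cleared (m , m>0 , hm) i = cancelˡ (ℕtoℚ m) (ℕtoℚ-≢0 m>0) (trans (sym (lmul linD (ℕtoℚ m) v i))
      (trans (proj₂ (kerD² (ℕtoℚ m ⊙ v) hm) (λ j → trans (lresp linD (lmul linD (ℕtoℚ m) v) j) (trans (lmul linD (ℕtoℚ m) (D v) j) (trans (cong (ℕtoℚ m ℚ.*_) (h j)) (ℚP.*-zeroʳ (ℕtoℚ m))))) i) (sym (ℚP.*-zeroʳ (ℕtoℚ m)))))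

  Ker-D² : ∀ x → Ker F (Dℤ F x) → Ker F x
  Ker-D² x h i = toℚ-injective {Dℤ F x i} {+ 0} (trans (sym (actD-ι F x i))
    (D²-kernel (ι x) (λ j → trans (lresp linD (actD-ι F x) j) (trans (actD-ι F (Dℤ F x) j) (cong toℚ (h j)))) i))

  _+K : Pred (V n) → Pred (V n)
  (A +K) v = ∃ λ (a : V n) → ∃ λ (c : V n) → A a × K c × v ≐ a ⊕ c

  s+K : ∀ {A} → Subgroup A → Subgroup (A +K)
  s+K sA = +-subgroup sA sK

  +K-base : ∀ {A : Pred (V n)} {v} → A v → (A +K) v
  +K-base {v = v} p = v , 𝟎 , p , zer sK , λ i → sym (ℚP.+-identityʳ (v i))

  infixr 7 _·_
  _·_ : ℕ → Pred (V n) → Pred (V n)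
  (m · A) v = ∃ λ (w : V n) → A w × v ≐ ℕtoℚ m ⊙ w

  s· : ∀ m {A} → Subgroup A → Subgroup (m · A)
  s· m sA = scale-subgroup (ℕtoℚ m) sA

  ·-⊆ : ∀ m {A} → Subgroup A → ∀ {v} → (m · A) v → A v
  ·-⊆ m sA {v} (w , p , h) = resp sA {ℕtoℚ m ⊙ w} {v} (λ i → sym (h i)) (mulℕ sA m p)

  -- These are the preimages D⁻¹Λ and D⁻¹Λ∨ in V, not images under D; both contain all of ker D.
  DΛ DΛ∨ : Pred (V n)
  DΛ v = Λ (D v)
  DΛ∨ v = Λdual B (D v)

  sDΛ : Subgroup DΛ
  sDΛ = preimage-subgroup sΛ linD

  sDΛ∨ : Subgroup DΛ∨
  sDΛ∨ = preimage-subgroup sΛ∨ linD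

  DΛ∨⊆DΛ : ∀ {v} → DΛ∨ v → DΛ v
  DΛ∨⊆DΛ {v} d = dual⊆ (D v) d

  D-+K : ∀ {v a c : V n} → K c → v ≐ a ⊕ c → D v ≐ D a
  D-+K {v} {a} {c} kc h i = trans (lresp linD h i) (trans (ladd linD a c i) (trans (cong (λ t → D a i ℚ.+ t) (kc i)) (ℚP.+-identityʳ (D a i))))

  Λ+K⊆DΛ : ∀ {v} → (Λ +K) v → DΛ v
  Λ+K⊆DΛ {v} (a , c , ha , kc , h) = resp sΛ {D a} {D v} (λ i → sym (D-+K kc h i)) (D-Λ a ha)

  Λ∨+K⊆Λ+K : ∀ {v} → (Λdual B +K) v → (Λ +K) v
  Λ∨+K⊆Λ+K (a , c , ha , kc , h) = a , c , dual⊆ a ha , kc , h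

  Λ∨+K⊆DΛ∨ : ∀ {v} → (Λdual B +K) v → DΛ∨ v
  Λ∨+K⊆DΛ∨ {v} (a , c , ha , kc , h) = resp sΛ∨ {D a} {D v} (λ i → sym (D-+K kc h i)) (D-Λ∨ a ha)

  DImage : Pred (V n)
  DImage v = ∃ λ (u : V n) → ∃ λ (c : V n) → Λ u × (Λ c × K c) × v ≐ D u ⊕ c

  sDImage : Subgroup DImage
  sDImage = record
    { resp = λ e (u , c , p , q , h) → u , c , p , q , λ i → trans (sym (e i)) (h i)
    ; zer = 𝟎 , 𝟎 , zer sΛ , (zer sΛ , zer sK) , λ i → sym (trans (ℚP.+-identityʳ (D 𝟎 i)) (lzero linD i))
    ; sub = λ {v} {v′} (u , c , p , (q , r) , h) (u′ , c′ , p′ , (q′ , r′) , h′) → u ⊖ u′ , c ⊖ c′ , sub sΛ {u} {u′} p p′ , (sub sΛ {c} {c′} q q′ , sub sK {c} {c′} r r′) ,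
        λ i → trans (cong₂ ℚ._-_ (h i) (h′ i)) (trans ([a+b]-[c+d] (D u i) (c i) (D u′ i) (c′ i)) (cong (λ t → t ℚ.+ (c i ℚ.- c′ i)) (sym (lsub linD u u′ i)))) }

  sTD : Subgroup (TDsub F)
  sTD = +-subgroup sU (∩-subgroup sΛ sK)
    where
    sU : Subgroup (λ a → Λ a × ∃ (λ (u : V n) → a ≐ D u))
    sU = record
      { resp = λ e (p , u , h) → resp sΛ e p , u , λ i → trans (sym (e i)) (h i)
      ; zer = zer sΛ , 𝟎 , λ i → sym (lzero linD i)
      ; sub = λ {a} {a′} (p , u , h) (p′ , u′ , h′) → sub sΛ {a} {a′} p p′ , u ⊖ u′ , λ i → trans (cong₂ ℚ._-_ (h i) (h′ i)) (sym (lsub linD u u′ i)) }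

  TD⊆Λ : ∀ {v} → TDsub F v → Λ v
  TD⊆Λ {v} (a , b , (p , _) , (q , _) , h) = resp sΛ {a ⊕ b} {v} (λ i → sym (h i)) (add sΛ {a} {b} p q)

  DImage⊆TD : ∀ {v} → DImage v → TDsub F v
  DImage⊆TD (u , c , p , q , h) = D u , c , (D-Λ u p , u , λ _ → refl) , q , h

  -- Both quotients are (Λ ∩ DV)/DΛ: on the left the summand Λ ∩ ker D cancels, and D maps D⁻¹Λ onto
  -- Λ ∩ DV with kernel ker D. The map sends Du + b to u.
  DΛ/[Λ+K] : ∀ {J} → Card (TDsub F) DImage J → Card DΛ (Λ +K) J
  DΛ/[Λ+K] = card-transfer sDImage (s+K sΛ) g g∈ to from sur
    where
    g : ∀ v → TDsub F v → V n
    g v (a , b , (_ , u , _) , _) = u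
    g∈ : ∀ v p → DΛ (g v p)
    g∈ v (a , b , (p , u , h) , _) = resp sΛ {a} {D u} h p
    diff : ∀ v v′ (p : TDsub F v) (p′ : TDsub F v′) → let b = proj₁ (proj₂ p) ; b′ = proj₁ (proj₂ p′) in
      v ⊖ v′ ≐ D (g v p ⊖ g v′ p′) ⊕ (b ⊖ b′)
    diff v v′ (a , b , (_ , u , e) , _ , h) (a′ , b′ , (_ , u′ , e′) , _ , h′) i =
      trans (cong₂ ℚ._-_ (h i) (h′ i)) (trans ([a+b]-[c+d] (a i) (b i) (a′ i) (b′ i))
        (cong (λ t → t ℚ.+ (b i ℚ.- b′ i)) (trans (cong₂ ℚ._-_ (e i) (e′ i)) (sym (lsub linD u u′ i)))))
    kb : ∀ v v′ (p : TDsub F v) (p′ : TDsub F v′) → K (proj₁ (proj₂ p) ⊖ proj₁ (proj₂ p′))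
    kb v v′ (a , b , _ , (_ , k) , _) (a′ , b′ , _ , (_ , k′) , _) = sub sK {b} {b′} k k′
    Λb : ∀ v v′ (p : TDsub F v) (p′ : TDsub F v′) → Λ (proj₁ (proj₂ p) ⊖ proj₁ (proj₂ p′))
    Λb v v′ (a , b , _ , (q , _) , _) (a′ , b′ , _ , (q′ , _) , _) = sub sΛ {b} {b′} q q′
    to : ∀ v v′ p p′ → DImage (v ⊖ v′) → (Λ +K) (g v p ⊖ g v′ p′)
    -- From DU + β = Dw + c with β, c ∈ ker D one gets D(U - w) ∈ ker D, and ker D² = ker D gives U
    -- - w ∈ ker D.
    to v v′ p p′ (w , c , hw , (_ , kc) , e) = w , t , hw , D²-kernel t (resp sK {c ⊖ β} {D t} Dt≐ (sub sK {c} {β} kc (kb v v′ p p′))) , split-t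
      where
      U β t : V n
      U = g v p ⊖ g v′ p′
      β = proj₁ (proj₂ p) ⊖ proj₁ (proj₂ p′)
      t = U ⊖ w
      Dt≐ : c ⊖ β ≐ D t
      Dt≐ i = sym (trans (lsub linD U w i) (cross-diff (D U i) (β i) (D w i) (c i) (trans (sym (diff v v′ p p′ i)) (e i))))
      split-t : U ≐ w ⊕ t
      split-t i = trans (sym ([x-y]+y≡x (U i) (w i))) (ℚP.+-comm (U i ℚ.- w i) (w i))
    from : ∀ v v′ p p′ → (Λ +K) (g v p ⊖ g v′ p′) → DImage (v ⊖ v′)
    from v v′ p p′ (w , t , hw , kt , e) = w , β , hw , (Λb v v′ p p′ , kb v v′ p p′) ,
      λ i → trans (diff v v′ p p′ i) (cong (λ s → s ℚ.+ β i) (D-+K kt e i))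
      where
      β : V n
      β = proj₁ (proj₂ p) ⊖ proj₁ (proj₂ p′)
    sur : ∀ u → DΛ u → ∃ λ v → Σ (TDsub F v) λ p → (Λ +K) (u ⊖ g v p)
    sur u h = D u , (D u , 𝟎 , (h , u , λ _ → refl) , (zer sΛ , zer sK) , λ i → sym (ℚP.+-identityʳ (D u i))) , self (s+K sΛ) u

  all : Pred (V n)
  all _ = ⊤

  s-all : Subgroup all
  s-all = record { resp = λ _ _ → tt ; zer = tt ; sub = λ _ _ → tt }

  Λ∨-radical : Radical all Λ (pair B) (Λdual B)
  Λ∨-radical = record { sound = λ {v} {y} d hy → d y hy ; wit = λ {v} _ ¬d → Λdual-witness B v ¬d }

  -- Biduality for Λ over its finite-index subgroup Λ∨: a vector outside Λ is separated from Λ by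
  -- some y ∈ Λ that pairs integrally with Λ, that is y ∈ Λ∨.
  Λ∨∨⊆Λ : ∀ {c} → Card Λ (Λdual B) c → ∀ u → (∀ a → Λdual B a → IsInt (pair B a u)) → Λ u
  Λ∨∨⊆Λ cΛ u h = cases (Λ? u)
    where
    cases : Dec (Λ u) → Λ u
    cases (yes p) = p
    cases (no ¬p) =
      let (y , hy , int , ¬i) = biduality {H = Λ} s-all sΛ∨ sΛ sΛ bl Λ∨-radical (λ {v} → dual⊆ v) (λ _ → tt) cΛ u tt ¬p in
      ⊥-elim (¬i (int-resp (symB y u) (h y (λ l hl → int-resp (symB l y) (int l hl)))))

scale-linear : ∀ {n} c → Linear {n} (λ v → c ⊙ v)
scale-linear c = record
  { lresp = λ e i → cong (c ℚ.*_) (e i)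
  ; lsub = λ u v i → distribˡ-- c (u i) (v i)
  ; lmul = λ d u i → x*[y*z]≡y*[x*z] c d (u i) }

-- Indices between the lattices Λ∨ + ker D ⊆ Λ + ker D ⊆ D⁻¹Λ and D⁻¹Λ∨

module Indices {n : ℕ} (F : IMat n) (B : QMat n) (G : IMat n)
  (FG : ∀ v → act F (act G v) ≐ v)
  (kerD² : KerDEqKerD² F) (symB : SymmetricForm B) (invB : FInvariant F B)
  (dual⊆ : ∀ (v : V n) → Λdual B v → Λ v) where

  open Lattice F B G FG kerD² symB invB dual⊆

  int-neg : ∀ {q} → IsInt q → IsInt ((ℚ.- 1ℚ) ℚ.* q)
  int-neg = int-* (-[1+ 0 ] , refl)

  cancel-τ : ∀ {t τ} → τ ℚ.* t ≡ 1ℚ → ∀ x → τ ℚ.* (t ℚ.* x) ≡ x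
  cancel-τ {t} {τ} e x = trans (sym (ℚP.*-assoc τ t x)) (trans (cong (ℚ._* x) e) (ℚP.*-identityˡ x))

  cancel-t : ∀ {t τ} → τ ℚ.* t ≡ 1ℚ → ∀ x → t ℚ.* (τ ℚ.* x) ≡ x
  cancel-t {t} {τ} e x = trans (x*[y*z]≡y*[x*z] t τ x) (cancel-τ {t} {τ} e x)

  ·Λ-card : ∀ m → m ℕ.> 0 → Card Λ (m · Λ) (m ^ n)
  ·Λ-card m m>0 = card-cong (Multiples-subgroup (+ m)) (s· m sΛ) (λ p → p) (λ p → p)
    (λ (x , e) → ι x , Λ-ι x , λ i → trans (e i) (toℚ-* (+ m) (x i)))
    (λ (w , hw , e) → (λ i → proj₁ (hw i)) , λ i → trans (e i) (trans (cong (ℕtoℚ m ℚ.*_) (proj₂ (hw i))) (sym (toℚ-* (+ m) (proj₁ (hw i))))))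
    (Multiples-card (+ m) (λ eq → ℕP.<⇒≢ m>0 (sym (ℤP.+-injective eq))))

  MK : ℕ → Pred (V n)
  MK m = (m · Λ) +K

  sMK : ∀ m → Subgroup (MK m)
  sMK m = s+K (s· m sΛ)

  MK⊆Λ+K : ∀ m {v} → MK m v → (Λ +K) v
  MK⊆Λ+K m (a , c , p , kc , e) = a , c , ·-⊆ m sΛ {a} p , kc , e

  pair-+K : ∀ u v {a c : V n} → K c → v ≐ a ⊕ c → pair B (D u) v ≡ pair B (D u) a
  pair-+K u v {a} {c} kc h = trans (respʳ bl {u = D u} (λ i → trans (h i) (sym (x-[0-y]≡x+y (a i) (c i)))))
    (trans (subʳ bl (D u) a (𝟎 ⊖ c)) (trans (cong (λ t → pair B (D u) a ℚ.- t) (D⊥K u (𝟎 ⊖ c) (neg sK {c} kc))) (x-0≡x (pair B (D u) a))))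

  module Finite {J cLL cFix : ℕ} (cJ : Card DΛ (Λ +K) J) (cΛ : Card Λ (Λdual B) cLL) (cardFix : Card (ΛF F) (ΛdualF F B) cFix) where

    -- Outside D⁻¹Λ the answer is no; inside, the finite quotient D⁻¹Λ/(Λ + ker D) decides.
    Λ+K? : ∀ v → Dec ((Λ +K) v)
    Λ+K? v = cases (Λ? (D v))
      where
      cases : Dec (Λ (D v)) → Dec ((Λ +K) v)
      cases (yes h) = card-dec sDΛ (s+K sΛ) cJ v h
      cases (no ¬h) = no λ p → ¬h (Λ+K⊆DΛ p)

    MK? : ∀ m → m ℕ.> 0 → ∀ v → Dec (MK m v)
    MK? m m>0 v = cases (inverse (ℕtoℚ m) (ℕtoℚ-≢0 m>0))
      where
      cases : (∃ λ τ → τ ℚ.* ℕtoℚ m ≡ 1ℚ) → Dec (MK m v)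
      cases (τ , e) = cases′ (Λ+K? (τ ⊙ v))
        where
        cases′ : Dec ((Λ +K) (τ ⊙ v)) → Dec (MK m v)
        cases′ (yes (a , c , ha , kc , h)) = yes (ℕtoℚ m ⊙ a , ℕtoℚ m ⊙ c , (a , ha , λ _ → refl) , mulℕ sK {c} m kc ,
          λ i → trans (sym (cancel-t {ℕtoℚ m} {τ} e (v i))) (trans (cong (ℕtoℚ m ℚ.*_) (h i)) (ℚP.*-distribˡ-+ (ℕtoℚ m) (a i) (c i))))
        cases′ (no ¬p) = no λ { (a , c , (w , hw , ea) , kc , h) → ¬p (w , τ ⊙ c , hw ,
          (λ i → trans (lmul linD τ c i) (trans (cong (τ ℚ.*_) (kc i)) (ℚP.*-zeroʳ τ))) ,
          λ i → trans (cong (τ ℚ.*_) (trans (h i) (cong (ℚ._+ c i) (ea i)))) (trans (ℚP.*-distribˡ-+ τ (ℕtoℚ m ℚ.* w i) (c i)) (cong (ℚ._+ τ ℚ.* c i) (cancel-τ {ℕtoℚ m} {τ} e (w i))))) }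

    [Λ+K]/MK : ∀ {k} m → m ℕ.> 0 → Card Λ (m · Λ) k → ∃ λ l → Card (Λ +K) (MK m) l
    [Λ+K]/MK m m>0 (card r r∈ cover _) = card-cover {A = Λ +K} {B = MK m} (sMK m) r (λ i → +K-base {Λ} {r i} (r∈ i)) cov (λ u v _ _ → MK? m m>0 (u ⊖ v))
      where
      cov : ∀ v → (Λ +K) v → ∃ λ i → MK m (v ⊖ r i)
      cov v (a , κ , ha , kκ , h) = let (i , p) = cover a ha in
        i , a ⊖ r i , κ , p , kκ , λ j → trans (cong (λ t → t ℚ.- r i j) (h j)) (a+c-r (a j) (κ j) (r i j))

    DΛ/MK : ∀ m → m ℕ.> 0 → ∃ λ k → Card DΛ (MK m) k
    DΛ/MK m m>0 = let (k , c) = [Λ+K]/MK m m>0 (·Λ-card m m>0) in J ℕ.* k , card-tower sDΛ (s+K sΛ) (sMK m) Λ+K⊆DΛ (MK⊆Λ+K m) cJ c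

    -- For v = a + c with a ∈ Λ and c ∈ ker D, membership means that a is congruent modulo Λ∨ to an
    -- F-fixed vector of Λ. Only the finitely many classes of Λ^F/(Λ∨)^F have to be tried.
    Λ∨+K? : ∀ v → Dec ((Λdual B +K) v)
    Λ∨+K? v = cases (Λ+K? v)
      where
      cases : Dec ((Λ +K) v) → Dec ((Λdual B +K) v)
      cases (no ¬p) = no λ p → ¬p (Λ∨+K⊆Λ+K p)
      cases (yes (a , c , ha , kc , h)) = cases′ (FinP.any? (λ i → Λdual? B (a ⊖ r i)))
        where
        r : Fin cFix → V n
        r = Card.rep cardFix
        cases′ : Dec (∃ λ i → Λdual B (a ⊖ r i)) → Dec ((Λdual B +K) v)
        cases′ (yes (i , d)) = yes (a ⊖ r i , r i ⊕ c , d , add sK {r i} {c} (fixed⇒K (proj₂ (Card.rep∈ cardFix i))) kc ,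
          λ j → trans (h j) (a+c≡[a-r]+[r+c] (a j) (c j) (r i j)))
        cases′ (no ¬d) = no λ { (a′ , c′ , ha′ , kc′ , h′) →
          let diff : a ⊖ a′ ≐ c′ ⊖ c
              diff = λ j → cross-diff (a j) (c j) (a′ j) (c′ j) (trans (sym (h j)) (h′ j))
              (i , d , _) = Card.cover cardFix (a ⊖ a′) (sub sΛ {a} {a′} ha (dual⊆ a′ ha′) , K⇒fixed (resp sK {c′ ⊖ c} {a ⊖ a′} (λ j → sym (diff j)) (sub sK {c′} {c} kc′ kc)))
          in ¬d (i , resp sΛ∨ {((a ⊖ a′) ⊖ r i) ⊕ a′} {a ⊖ r i} (λ j → sym (peel (a j) (a′ j) (r i j))) (add sΛ∨ {(a ⊖ a′) ⊖ r i} {a′} d ha′)) }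

    M : ℕ
    M = cLL !

    M>0 : M ℕ.> 0
    M>0 = ℕ.>-nonZero⁻¹ (cLL !) {{cLL ℕP.!≢0}}

    M-kills : ∀ a → Λ a → Λdual B (ℕtoℚ M ⊙ a)
    M-kills = card-kills sΛ sΛ∨ cΛ

    MK⊆Λ∨+K : ∀ {v} → MK M v → (Λdual B +K) v
    MK⊆Λ∨+K (a , c , (w , hw , e) , kc , h) = a , c , resp sΛ∨ {ℕtoℚ M ⊙ w} {a} (λ i → sym (e i)) (M-kills w hw) , kc , h

    -- Under (v, Dy) with y ∈ Λ the radical is D⁻¹Λ∨, in general too large to lie in H. Dividing the
    -- form by t shrinks it to R = t·D⁻¹Λ∨ ⊆ H, so biduality applies; the separating vector is then
    -- y/t, for the undivided form.
    module Biduality (H : Pred (V n)) (sH : Subgroup H) (H⊆DΛ : ∀ {v} → H v → DΛ v) (H? : ∀ v → DΛ v → Dec (H v))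
      (t : ℕ) (t>0 : t ℕ.> 0) (t-kills : ∀ u → DΛ∨ u → H (ℕtoℚ t ⊙ u)) where

      τ : ℚ
      τ = proj₁ (inverse (ℕtoℚ t) (ℕtoℚ-≢0 t>0))

      τt : τ ℚ.* ℕtoℚ t ≡ 1ℚ
      τt = proj₂ (inverse (ℕtoℚ t) (ℕtoℚ-≢0 t>0))

      b : V n → V n → ℚ
      b v y = τ ℚ.* pair B v (D y)

      bl′ : Bilinear b
      bl′ = bilinear-∘ τ bl id-linear linD

      R : Pred (V n)
      R v = Λdual B (D (τ ⊙ v))

      sR : Subgroup R
      sR = preimage-subgroup sΛ∨ (∘-linear linD (scale-linear τ))

      b-R : ∀ v y → b v y ≡ (ℚ.- 1ℚ) ℚ.* pair B (D (τ ⊙ v)) (Ft y)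
      b-R v y = trans (cong (τ ℚ.*_) (D-adjoint v y)) (trans (x*[y*z]≡y*[x*z] τ (ℚ.- 1ℚ) (pair B (D v) (Ft y)))
        (cong ((ℚ.- 1ℚ) ℚ.*_) (sym (trans (respˡ bl {y = Ft y} (lmul linD τ v)) (mulˡ bl τ (D v) (Ft y))))))

      rad : Radical all Λ b R
      rad = record
        { sound = λ {v} {y} d hy → int-resp (sym (b-R v y)) (int-neg (d (Ft y) (act-Λ F y hy)))
        -- `b-R` pairs with Fy, so y = Gl is chosen to make Fy the vector l on which duality fails.
        ; wit = λ {v} _ ¬d → let (l , hl , ¬i) = Λdual-witness B (D (τ ⊙ v)) ¬d in
            act G l , act-Λ G l hl , λ i → ¬i (int-resp (trans (cong ((ℚ.- 1ℚ) ℚ.*_) (trans (b-R v (act G l)) (cong ((ℚ.- 1ℚ) ℚ.*_) (respʳ bl {u = D (τ ⊙ v)} (FG l))))) (neg-neg (pair B (D (τ ⊙ v)) l))) (int-neg i)) }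

      R⊆H : ∀ {v} → R v → H v
      R⊆H {v} d = resp sH {ℕtoℚ t ⊙ (τ ⊙ v)} {v} (λ i → cancel-t {ℕtoℚ t} {τ} τt (v i)) (t-kills (τ ⊙ v) d)

      MK⊆R : ∀ {v} → MK (t ℕ.* M) v → R v
      MK⊆R {v} (a , c , (w , hw , e) , kc , h) = resp sΛ∨ {ℕtoℚ M ⊙ D w} {D (τ ⊙ v)} (λ i → sym (eq i)) (M-kills (D w) (D-Λ w hw))
        where
        eq : ∀ i → D (τ ⊙ v) i ≡ ℕtoℚ M ℚ.* D w i
        eq i = trans (lmul linD τ v i) (trans (cong (τ ℚ.*_) (trans (D-+K kc h i) (trans (lresp linD e i) (trans (lmul linD (ℕtoℚ (t ℕ.* M)) w i)
          (trans (cong (ℚ._* D w i) (ℕtoℚ-* t M)) (ℚP.*-assoc (ℕtoℚ t) (ℕtoℚ M) (D w i))))))) (cancel-τ {ℕtoℚ t} {τ} τt (ℕtoℚ M ℚ.* D w i)))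

      -- Finiteness is squeezed out of (tM)Λ + ker D ⊆ R ⊆ H ⊆ D⁻¹Λ, whose outer index is finite.
      H/R : ∃ λ k → Card H R k
      H/R = let (_ , c) = DΛ/MK (t ℕ.* M) (ℕP.*-mono-≤ t>0 M>0)
                (_ , _ , _ , c₁ , _) = card-between sDΛ sH (sMK (t ℕ.* M)) H⊆DΛ (λ p → R⊆H (MK⊆R p)) H? c
                (k , _ , c₂ , _ , _) = card-between sH sR (sMK (t ℕ.* M)) R⊆H MK⊆R (λ v _ → Λdual? B (D (τ ⊙ v))) c₁
            in k , c₂

      bidual : ∀ w → ¬ H w → ∃ λ y → (∀ v → H v → IsInt (pair B v (D y))) × ¬ IsInt (pair B w (D y))
      bidual w ¬Hw = let (y , _ , int , ¬i) = biduality s-all sR sH sΛ bl′ rad R⊆H (λ _ → tt) (proj₂ H/R) w tt ¬Hw in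
        τ ⊙ y , (λ v Hv → int-resp (scale v y) (int v Hv)) , λ i → ¬i (int-resp (sym (scale w y)) i)
        where
        scale : ∀ v y → b v y ≡ pair B v (D (τ ⊙ y))
        scale v y = sym (trans (respʳ bl {u = v} (lmul linD τ y)) (mulʳ bl τ v (D y)))

    !>0 : ∀ k → (k !) ℕ.> 0
    !>0 k = ℕ.>-nonZero⁻¹ (k !) {{k ℕP.!≢0}}

    -- A separating y pairs Dy integrally with Λ, which says Dy ∈ Λ∨. The scaling t = J! is an
    -- exponent of D⁻¹Λ/(Λ + ker D).
    Λ+K-bidual : ∀ w → ¬ (Λ +K) w → ∃ λ y → DΛ∨ y × ¬ IsInt (pair B w (D y))
    Λ+K-bidual w ¬p = let (y , int , ¬i) = bidual w ¬p in
        y , (λ l hl → int-resp (symB l (D y)) (int l (+K-base {Λ} {l} hl))) , ¬i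
      where
      open Biduality (Λ +K) (s+K sΛ) Λ+K⊆DΛ (λ v _ → Λ+K? v) (J !) (!>0 J) (λ u h → card-kills sDΛ (s+K sΛ) cJ u (DΛ∨⊆DΛ h))

    DΛ/[Λ∨+K] : ∃ λ k → Card DΛ (Λdual B +K) k
    DΛ/[Λ∨+K] = let (_ , c) = DΛ/MK M M>0
                    (k , _ , c₁ , _) = card-between sDΛ (s+K sΛ∨) (sMK M) (λ p → Λ+K⊆DΛ (Λ∨+K⊆Λ+K p)) MK⊆Λ∨+K (λ v _ → Λ∨+K? v) c
                in k , c₁

    DΛ∨/[Λ∨+K] : ∃ λ y → ∃ λ k → Card DΛ DΛ∨ y × Card DΛ∨ (Λdual B +K) k × proj₁ DΛ/[Λ∨+K] ≡ y ℕ.* k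
    DΛ∨/[Λ∨+K] = card-between sDΛ sDΛ∨ (s+K sΛ∨) DΛ∨⊆DΛ Λ∨+K⊆DΛ∨ (λ v _ → Λdual? B (D v)) (proj₂ DΛ/[Λ∨+K])

    [Λ+K]/[Λ∨+K] : ∃ λ j → ∃ λ x → Card DΛ (Λ +K) j × Card (Λ +K) (Λdual B +K) x × proj₁ DΛ/[Λ∨+K] ≡ j ℕ.* x
    [Λ+K]/[Λ∨+K] = card-between sDΛ (s+K sΛ) (s+K sΛ∨) Λ+K⊆DΛ Λ∨+K⊆Λ+K (λ v _ → Λ+K? v) (proj₂ DΛ/[Λ∨+K])

    -- The form (Du, v) pairs D⁻¹Λ with Λ + ker D, because Du is orthogonal to ker D. Its radicals
    -- are D⁻¹Λ∨ and Λ∨ + ker D, the second by biduality together with Λ∨∨ ⊆ Λ.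
    module Dual {k : ℕ} (c∨ : Card DΛ∨ (Λdual B +K) k) where

      Λ∨+K-bidual : ∀ w → ¬ (Λdual B +K) w → ∃ λ y → DΛ y × ¬ IsInt (pair B w (D y))
      Λ∨+K-bidual w ¬p = let (y , int , ¬i) = bidual w ¬p in
          y , Λ∨∨⊆Λ cΛ (D y) (λ a ha → int a (+K-base {Λdual B} {a} ha)) , ¬i
        where
        open Biduality (Λdual B +K) (s+K sΛ∨) (λ p → Λ+K⊆DΛ (Λ∨+K⊆Λ+K p)) (λ v _ → Λ∨+K? v) (k !) (!>0 k) (card-kills sDΛ∨ (s+K sΛ∨) c∨)

      form : V n → V n → ℚ
      -- The factor 1 gives the shape that `bilinear-∘` produces.
      form u v = 1ℚ ℚ.* pair B (D u) v

      form-bilinear : Bilinear form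
      form-bilinear = bilinear-∘ 1ℚ bl linD id-linear

      form-+K : ∀ u v {a c : V n} → K c → v ≐ a ⊕ c → form u v ≡ pair B (D u) a
      form-+K u v kc h = trans (ℚP.*-identityˡ (pair B (D u) v)) (pair-+K u v kc h)

      radˡ : Radical DΛ (Λ +K) form DΛ∨
      radˡ = record
        { sound = λ {u} {v} d (a , c , ha , kc , h) → int-resp (sym (form-+K u v kc h)) (d a ha)
        ; wit = λ {u} _ ¬d → let (l , hl , ¬i) = Λdual-witness B (D u) ¬d in
            l , +K-base {Λ} {l} hl , λ i → ¬i (int-resp (ℚP.*-identityˡ (pair B (D u) l)) i) }

      radʳ : Radical (Λ +K) DΛ (λ v u → form u v) (Λdual B +K)
      radʳ = record
        { sound = λ {v} {u} (a , c , ha , kc , h) hu → int-resp (trans (symB a (D u)) (sym (form-+K u v kc h))) (ha (D u) hu)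
        ; wit = λ {v} _ ¬d → let (y , hy , ¬i) = Λ∨+K-bidual v ¬d in
            y , hy , λ i → ¬i (int-resp (trans (ℚP.*-identityˡ (pair B (D y) v)) (symB (D y) v)) i) }

      x≡y : ∀ {x y} → Card (Λ +K) (Λdual B +K) x → Card DΛ DΛ∨ y → y ≡ x
      x≡y cx cy = duality sDΛ sDΛ∨ (s+K sΛ) (s+K sΛ∨) form-bilinear radˡ radʳ DΛ∨⊆DΛ Λ∨+K⊆Λ+K cy cx

    -- The index of Λ∨ + ker D in D⁻¹Λ is computed through D⁻¹Λ∨ and through Λ + ker D; duality
    -- equates one factor on each route, hence also the other.
    J-dual : Card DΛ∨ (Λdual B +K) J
    J-dual = go DΛ∨/[Λ∨+K] [Λ+K]/[Λ∨+K]
      where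
      go : (∃ λ y → ∃ λ k → Card DΛ DΛ∨ y × Card DΛ∨ (Λdual B +K) k × proj₁ DΛ/[Λ∨+K] ≡ y ℕ.* k) →
        (∃ λ j → ∃ λ x → Card DΛ (Λ +K) j × Card (Λ +K) (Λdual B +K) x × proj₁ DΛ/[Λ∨+K] ≡ j ℕ.* x) → Card DΛ∨ (Λdual B +K) J
      go (y , k , cy , ck , e) (j , x , cj , cx , e′) = subst (Card DΛ∨ (Λdual B +K)) k≡J ck
        where
        y≡x : y ≡ x
        y≡x = Dual.x≡y ck cx cy
        k≡J : k ≡ J
        k≡J = ℕP.*-cancelˡ-≡ k J x {{ℕ.>-nonZero (card->0 (s+K sΛ) cx)}} (trans (cong (ℕ._* k) (sym y≡x))
          (trans (sym e) (trans e′ (trans (cong (ℕ._* x) (card-unique (s+K sΛ) cj cJ)) (ℕP.*-comm J x)))))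

-- The case f = 1

square-ratio : ∀ {Q₁ Qₑ Q₂ Q₂ₑ t a b} → Q₁ ≡ Qₑ ℕ.* t → Q₂ ≡ Q₂ₑ ℕ.* t → Q₂ ≡ a ℕ.* a → Q₂ₑ ≡ b ℕ.* b → Q₁ ℕ.* (b ℕ.* b) ≡ Qₑ ℕ.* (a ℕ.* a)
square-ratio {Q₁} {Qₑ} {Q₂} {Q₂ₑ} {t} {a} {b} e₁ e₂ ea eb = begin
  Q₁ ℕ.* (b ℕ.* b)       ≡⟨ cong₂ ℕ._*_ e₁ (sym eb) ⟩
  (Qₑ ℕ.* t) ℕ.* Q₂ₑ     ≡⟨ ℕP.*-assoc Qₑ t Q₂ₑ ⟩
  Qₑ ℕ.* (t ℕ.* Q₂ₑ)     ≡⟨ cong (Qₑ ℕ.*_) (trans (ℕP.*-comm t Q₂ₑ) (trans (sym e₂) ea)) ⟩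
  Qₑ ℕ.* (a ℕ.* a)       ∎
  where open ≡-Reasoning

square-pos : ∀ {k a} → k ≡ a ℕ.* a → k ℕ.> 0 → a ℕ.> 0
square-pos {k} {zero} e k>0 = ⊥-elim (ℕP.<-irrefl (sym e) k>0)
square-pos {k} {suc a} _ _ = ℕ.s≤s ℕ.z≤n

module Formula {n : ℕ} (F : IMat n) (B : QMat n) (G : IMat n)
  (FG : ∀ v → act F (act G v) ≐ v)
  (kerD² : KerDEqKerD² F) (symB : SymmetricForm B) (invB : FInvariant F B)
  (dual⊆ : ∀ (v : V n) → Λdual B v → Λ v) where

  open Lattice F B G FG kerD² symB invB dual⊆
  open Indices F B G FG kerD² symB invB dual⊆

  QS : ℕ → Pred (V n)
  QS e u = DΛ∨ u × (Λ +K) (ℕtoℚ e ⊙ u)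

  sQS : ∀ e → Subgroup (QS e)
  sQS e = ∩-subgroup sDΛ∨ (preimage-subgroup (s+K sΛ) (scale-linear (ℕtoℚ e)))

  Λ∨+K⊆QS : ∀ e {v} → (Λdual B +K) v → QS e v
  Λ∨+K⊆QS e {v} p = Λ∨+K⊆DΛ∨ p , mulℕ (s+K sΛ) {v} e (Λ∨+K⊆Λ+K p)

  sFixed : Subgroup (λ v → Ft v ≐ v)
  sFixed = record
    { resp = λ e h i → trans (sym (lresp linF e i)) (trans (h i) (e i))
    ; zer = lzero linF
    ; sub = λ {u} {v} h h′ i → trans (lsub linF u v i) (cong₂ ℚ._-_ (h i) (h′ i)) }

  sΛF : Subgroup (ΛF F)
  sΛF = ∩-subgroup sΛ sFixed

  sΛ∨F : Subgroup (ΛdualF F B)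
  sΛ∨F = ∩-subgroup sΛ∨ sFixed

  S : ℕ → Pred (V n)
  S e v = ∃ λ (k : V n) → ∃ λ (w : V n) → ΛF F k × (e · Λdual B) w × v ≐ k ⊕ w

  sS : ∀ e → Subgroup (S e)
  sS e = +-subgroup sΛF (s· e sΛ∨)

  sKD : ∀ e → Subgroup (fixedModDual F B e 1)
  sKD e = ∩-subgroup sΛ (preimage-subgroup (s· e sΛ∨) linD)

  module WithCards {J cLL cFix : ℕ} (cJ : Card DΛ (Λ +K) J) (cΛ : Card Λ (Λdual B) cLL) (cardFix : Card (ΛF F) (ΛdualF F B) cFix) where
    open Finite cJ cΛ cardFix

    QS? : ∀ e v → DΛ∨ v → Dec (QS e v)
    QS? e v d = cases (Λ+K? (ℕtoℚ e ⊙ v))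
      where
      cases : Dec ((Λ +K) (ℕtoℚ e ⊙ v)) → Dec (QS e v)
      cases (yes p) = yes (d , p)
      cases (no ¬p) = no λ q → ¬p (proj₂ q)

    Q-β : ∀ e → ∃ λ Q → ∃ λ β → Card DΛ∨ (QS e) Q × Card (QS e) (Λdual B +K) β × J ≡ Q ℕ.* β
    Q-β e = card-between sDΛ∨ (sQS e) (s+K sΛ∨) proj₁ (Λ∨+K⊆QS e) (QS? e) J-dual

    -- 2e(v, Dv) = -e(Dv, Dv), so the form 2e(v, Dy) is alternating modulo ℤ on D⁻¹Λ∨.
    Q-square : ∀ e {Q} → Card DΛ∨ (QS (2 ℕ.* e)) Q → ∃ λ a → Q ≡ a ℕ.* a
    Q-square e c = alternating-square sDΛ∨ (sQS (2 ℕ.* e)) (bilinear-∘ m bl id-linear linD) rad alt proj₁ c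
      where
      m : ℚ
      m = ℕtoℚ (2 ℕ.* e)
      rad : Radical DΛ∨ DΛ∨ (λ v y → m ℚ.* pair B v (D y)) (QS (2 ℕ.* e))
      rad = record
        { sound = λ {v} {y} (_ , a , c , ha , kc , h) dy → int-resp (trans (sym (pair-+K y (m ⊙ v) kc h)) (trans (symB (D y) (m ⊙ v)) (mulˡ bl m v (D y)))) (dy a ha)
        ; wit = λ {v} dv ¬q → let (y , dy , ¬i) = Λ+K-bidual (m ⊙ v) (λ p → ¬q (dv , p)) in
            y , dy , λ i → ¬i (int-resp (sym (mulˡ bl m v (D y))) i) }
      alt : ∀ v → DΛ∨ v → IsInt (m ℚ.* pair B v (D v))
      alt v d = int-resp (trans (cong (λ t → (ℚ.- 1ℚ) ℚ.* (ℕtoℚ e ℚ.* t)) (D-square v)) (trans (two-e-identity (ℕtoℚ e) (pair B v (D v))) (cong (ℚ._* pair B v (D v)) (sym (ℕtoℚ-* 2 e)))))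
        (int-neg (int-* (int-toℚ (+ e)) (d (D v) (dual⊆ (D v) d))))

    -- In D⁻¹Λ∨ modulo its part in Λ + ker D, the e-torsion meets the 2-torsion trivially and
    -- complements it in the 2e-torsion, as e is odd. So [QS e : QS 1] = [QS 2e : QS 2], and Q₁/Qₑ =
    -- Q₂/Q₂ₑ is a ratio of squares.
    Q-odd : ∀ q {e Q₁ Qₑ} → e ≡ 1 ℕ.+ q ℕ.* 2 → Card DΛ∨ (QS 1) Q₁ → Card DΛ∨ (QS e) Qₑ →
      ∃ λ a → ∃ λ b → a ℕ.> 0 × b ℕ.> 0 × Q₁ ℕ.* (b ℕ.* b) ≡ Qₑ ℕ.* (a ℕ.* a)
    Q-odd q {e} {Q₁} {Qₑ} e≡ c₁ cₑ =
        let (Q₂ , _ , c₂ , _) = Q-β 2 in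
        go Q₂ c₂ (card-between sDΛ∨ (sQS e) (sQS 1) proj₁ 1⊆e (QS? e) c₁)
           (card-between sDΛ∨ (sQS (2 ℕ.* e)) (sQS 2) proj₁ 2⊆2e (QS? (2 ℕ.* e)) c₂)
      where
      Λ+Kr : ∀ {u v : V n} → u ≐ v → (Λ +K) u → (Λ +K) v
      Λ+Kr {u} {v} = resp (s+K sΛ) {u} {v}
      eℚ : ℕtoℚ e ≡ 1ℚ ℚ.+ ℕtoℚ q ℚ.* (1ℚ ℚ.+ 1ℚ)
      eℚ = trans (cong ℕtoℚ e≡) (trans (toℚ-+ (+ 1) (+ (q ℕ.* 2))) (cong (1ℚ ℚ.+_) (ℕtoℚ-* q 2)))
      2e : ∀ x → ℕtoℚ (2 ℕ.* e) ℚ.* x ≡ ((1ℚ ℚ.+ 1ℚ) ℚ.* ℕtoℚ e) ℚ.* x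
      2e x = cong (ℚ._* x) (ℕtoℚ-* 2 e)
      1⊆e : ∀ {v} → QS 1 v → QS e v
      1⊆e {v} (d , p) = d , mulℕ (s+K sΛ) {v} e (Λ+Kr (λ i → ℚP.*-identityˡ (v i)) p)
      2⊆2e : ∀ {v} → QS 2 v → QS (2 ℕ.* e) v
      2⊆2e {v} (d , p) = d , Λ+Kr (λ i → trans (sym (ℚP.*-assoc (ℕtoℚ e) (ℕtoℚ 2) (v i))) (cong (ℚ._* v i) (trans (sym (ℕtoℚ-* e 2)) (cong ℕtoℚ (ℕP.*-comm e 2))))) (mulℕ (s+K sΛ) {ℕtoℚ 2 ⊙ v} e p)
      e⊆2e : ∀ {v} → QS e v → QS (2 ℕ.* e) v
      e⊆2e {v} (d , p) = d , Λ+Kr (λ i → trans (sym (ℚP.*-assoc (ℕtoℚ 2) (ℕtoℚ e) (v i))) (cong (ℚ._* v i) (sym (ℕtoℚ-* 2 e)))) (mulℕ (s+K sΛ) {ℕtoℚ e ⊙ v} 2 p)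
      to : ∀ x y → QS e x → QS e y → QS 1 (x ⊖ y) → QS 2 (x ⊖ y)
      to x y _ _ (d , p) = d , mulℕ (s+K sΛ) {x ⊖ y} 2 (Λ+Kr (λ i → ℚP.*-identityˡ (x i ℚ.- y i)) p)
      from : ∀ x y → QS e x → QS e y → QS 2 (x ⊖ y) → QS 1 (x ⊖ y)
      -- With e = 1 + 2q, w = ew - q·2w is in Λ + ker D as soon as ew and 2w are.
      from x y qx qy (d , p) = d , Λ+Kr (λ i → trans (trans (cong (λ t → t ℚ.* w i ℚ.- ℕtoℚ q ℚ.* (ℕtoℚ 2 ℚ.* w i)) eℚ) (odd-combine (ℕtoℚ q) (w i))) (sym (ℚP.*-identityˡ (w i))))
          (sub (s+K sΛ) {ℕtoℚ e ⊙ w} {ℕtoℚ q ⊙ (ℕtoℚ 2 ⊙ w)} (proj₂ (sub (sQS e) {x} {y} qx qy)) (mulℕ (s+K sΛ) {ℕtoℚ 2 ⊙ w} q p))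
        where
        w : V n
        w = x ⊖ y
      sur : ∀ v → QS (2 ℕ.* e) v → ∃ λ u → Σ (QS e u) λ _ → QS 2 (v ⊖ u)
      -- The e-torsion part of v is u = (1 + e)v: 1 + e = 2(1 + q) gives eu = (1 + q)·2ev, and v - u
      -- = -ev is killed by 2.
      sur v (d , p) = u , (du , Λ+Kr (λ i → trans (cong₂ ℚ._*_ (toℚ-+ (+ 1) (+ q)) (2e (v i))) (trans (odd-halve (ℕtoℚ q) (ℕtoℚ e) (v i) eℚ) (cong (λ t → ℕtoℚ e ℚ.* (t ℚ.* v i)) (sym (toℚ-+ (+ 1) (+ e)))))) (mulℕ (s+K sΛ) {ℕtoℚ (2 ℕ.* e) ⊙ v} (suc q) p)) ,
          sub sDΛ∨ {v} {u} d du , Λ+Kr (λ i → trans (cong (λ t → 0ℚ ℚ.- t) (2e (v i))) (trans (odd-rest (ℕtoℚ e) (v i)) (cong (λ t → ℕtoℚ 2 ℚ.* (v i ℚ.- t ℚ.* v i)) (sym (toℚ-+ (+ 1) (+ e)))))) (neg (s+K sΛ) {ℕtoℚ (2 ℕ.* e) ⊙ v} p)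
        where
        u : V n
        u = ℕtoℚ (suc e) ⊙ v
        du : DΛ∨ u
        du = mulℕ sDΛ∨ {v} (suc e) d
      Goal : Set
      Goal = ∃ λ a → ∃ λ b → a ℕ.> 0 × b ℕ.> 0 × Q₁ ℕ.* (b ℕ.* b) ≡ Qₑ ℕ.* (a ℕ.* a)
      finish : ∀ {Q₂ Q₂ₑ t} → Q₁ ≡ Qₑ ℕ.* t → Q₂ ≡ Q₂ₑ ℕ.* t → Q₂ ℕ.> 0 → Q₂ₑ ℕ.> 0 →
        (∃ λ a → Q₂ ≡ a ℕ.* a) → (∃ λ b → Q₂ₑ ≡ b ℕ.* b) → Goal
      finish {Q₂} {Q₂ₑ} {t} e₁ e₂ p p′ (a , ea) (b , eb) = a , b , square-pos ea p , square-pos eb p′ ,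
        square-ratio {Q₁} {Qₑ} {Q₂} {Q₂ₑ} {t} {a} {b} e₁ e₂ ea eb
      go : ∀ Q₂ → Card DΛ∨ (QS 2) Q₂ → (∃ λ Q → ∃ λ t → Card DΛ∨ (QS e) Q × Card (QS e) (QS 1) t × Q₁ ≡ Q ℕ.* t) →
        (∃ λ Q → ∃ λ t → Card DΛ∨ (QS (2 ℕ.* e)) Q × Card (QS (2 ℕ.* e)) (QS 2) t × Q₂ ≡ Q ℕ.* t) → Goal
      go Q₂ c₂ (Q , t , cQ , ct , eq) (Q′ , t′ , cQ′ , ct′ , eq′) = finish {Q₂} {Q′} {t}
        (trans eq (cong (ℕ._* t) (card-unique (sQS e) cQ cₑ)))
        (trans eq′ (cong (Q′ ℕ.*_) (sym (card-unique (sQS 2) (card-transfer (sQS 1) (sQS 2) (λ v _ → v) (λ _ → e⊆2e) to from sur ct) ct′))))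
        (card->0 sDΛ∨ c₂) (card->0 sDΛ∨ cQ′) (Q-square 1 c₂) (Q-square e cQ′)

    module Scaled (e : ℕ) (e>0 : e ℕ.> 0) where

      ε : ℚ
      ε = proj₁ (inverse (ℕtoℚ e) (ℕtoℚ-≢0 e>0))

      εe : ε ℚ.* ℕtoℚ e ≡ 1ℚ
      εe = proj₂ (inverse (ℕtoℚ e) (ℕtoℚ-≢0 e>0))

      cancel-e : ∀ {x y} → ℕtoℚ e ℚ.* x ≡ ℕtoℚ e ℚ.* y → x ≡ y
      cancel-e = cancelˡ (ℕtoℚ e) (ℕtoℚ-≢0 e>0)

      -- The map multiplies by e and drops the ker D component: eu = a + c goes to a, and Da = e·Du
      -- ∈ eΛ∨. Choosing another splitting of eu changes a by an F-fixed lattice vector, which `S e`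
      -- absorbs; v/e is a preimage of v.
      KD/S : ∀ {β} → Card (QS e) (Λdual B +K) β → Card (fixedModDual F B e 1) (S e) β
      KD/S = card-transfer (s+K sΛ∨) (sS e) g g∈ to from sur
        where
        g : ∀ u → QS e u → V n
        g u (_ , a , _) = a
        g∈ : ∀ u p → fixedModDual F B e 1 (g u p)
        g∈ u (d , a , c , ha , kc , h) = ha , D u , d , λ i → trans (sym (D-+K kc h i)) (lmul linD (ℕtoℚ e) u i)
        to : ∀ u u′ p p′ → (Λdual B +K) (u ⊖ u′) → S e (g u p ⊖ g u′ p′)
        to u u′ (d , a , c , ha , kc , h) (d′ , a′ , c′ , ha′ , kc′ , h′) (l , k , hl , kk , eq) =
            κ , ℕtoℚ e ⊙ l , (resp sΛ {(a ⊖ a′) ⊖ ℕtoℚ e ⊙ l} {κ} (λ i → trans (cong (λ t → t ℚ.- ℕtoℚ e ℚ.* l i) (key i)) ([x+y]-y≡x (κ i) (ℕtoℚ e ℚ.* l i)))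
                (sub sΛ {a ⊖ a′} {ℕtoℚ e ⊙ l} (sub sΛ {a} {a′} ha ha′) (mulℕ sΛ {l} e (dual⊆ l hl))) ,
              K⇒fixed (sub sK {ℕtoℚ e ⊙ k} {c ⊖ c′} (mulℕ sK {k} e kk) (sub sK {c} {c′} kc kc′))) ,
            (l , hl , λ _ → refl) , key
          where
          κ : V n
          κ = ℕtoℚ e ⊙ k ⊖ (c ⊖ c′)
          key : a ⊖ a′ ≐ κ ⊕ ℕtoℚ e ⊙ l
          key i = scaled-split (ℕtoℚ e) (a i) (a′ i) (c i) (c′ i) (l i) (k i)
            (trans (cong₂ ℚ._-_ (sym (h i)) (sym (h′ i))) (trans (sym (distribˡ-- (ℕtoℚ e) (u i) (u′ i))) (cong (ℕtoℚ e ℚ.*_) (eq i))))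
        from : ∀ u u′ p p′ → S e (g u p ⊖ g u′ p′) → (Λdual B +K) (u ⊖ u′)
        from u u′ (d , a , c , ha , kc , h) (d′ , a′ , c′ , ha′ , kc′ , h′) (k , w , (_ , fk) , (l , hl , ew) , eq) =
            l , ε ⊙ κ , hl , (λ i → trans (lmul linD ε κ i) (trans (cong (ε ℚ.*_) (kκ i)) (ℚP.*-zeroʳ ε))) ,
            λ i → cancel-e (trans (key i) (sym (trans (ℚP.*-distribˡ-+ (ℕtoℚ e) (l i) (ε ℚ.* κ i)) (cong (λ t → ℕtoℚ e ℚ.* l i ℚ.+ t) (cancel-t {ℕtoℚ e} {ε} εe (κ i))))))
          where
          κ : V n
          κ = k ⊕ (c ⊖ c′)
          kκ : K κ
          kκ = add sK {k} {c ⊖ c′} (fixed⇒K fk) (sub sK {c} {c′} kc kc′)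
          key : ∀ i → ℕtoℚ e ℚ.* (u i ℚ.- u′ i) ≡ ℕtoℚ e ℚ.* l i ℚ.+ κ i
          key i = trans (distribˡ-- (ℕtoℚ e) (u i) (u′ i)) (trans (cong₂ ℚ._-_ (h i) (h′ i))
            (scaled-join (ℕtoℚ e) (a i) (a′ i) (c i) (c′ i) (l i) (k i) (trans (eq i) (cong (λ t → k i ℚ.+ t) (ew i)))))
        sur : ∀ v → fixedModDual F B e 1 v → ∃ λ u → Σ (QS e u) λ p → S e (v ⊖ g u p)
        sur v (hv , w , dw , ew) = ε ⊙ v , (resp sΛ∨ {w} {D (ε ⊙ v)} (λ i → sym (trans (lmul linD ε v i) (trans (cong (ε ℚ.*_) (ew i)) (cancel-τ {ℕtoℚ e} {ε} εe (w i))))) dw ,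
            v , 𝟎 , hv , zer sK , λ i → trans (cancel-t {ℕtoℚ e} {ε} εe (v i)) (sym (ℚP.+-identityʳ (v i)))) , self (sS e) v

      fixed/scaled : Card (e · ΛF F) (e · ΛdualF F B) cFix
      fixed/scaled = card-transfer sΛ∨F (s· e sΛ∨F) (λ v _ → ℕtoℚ e ⊙ v) (λ v p → v , p , λ _ → refl)
        (λ x y _ _ p → x ⊖ y , p , λ i → sym (distribˡ-- (ℕtoℚ e) (x i) (y i)))
        (λ x y _ _ (w , p , h) → resp sΛ∨F {w} {x ⊖ y} (λ i → cancel-e (trans (sym (h i)) (sym (distribˡ-- (ℕtoℚ e) (x i) (y i))))) p)
        (λ v (w , p , h) → w , p , same (s· e sΛ∨F) v (ℕtoℚ e ⊙ w) h)
        cardFix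

      -- Λ^F ∩ eΛ∨ = e(Λ∨)^F, since ew is F-fixed only if w is. So the quotient is Λ^F/e(Λ∨)^F,
      -- counted through eΛ^F.
      S/scaled : ∀ {α} → Card (ΛF F) (e · ΛF F) α → Card (S e) (e · Λdual B) (α ℕ.* cFix)
      S/scaled cα = card-transfer (s· e sΛ∨F) (s· e sΛ∨) (λ v _ → v)
        (λ v p → v , 𝟎 , p , zer (s· e sΛ∨) , λ i → sym (ℚP.+-identityʳ (v i)))
        (λ x y _ _ (w , (d , _) , h) → w , d , h)
        (λ x y px py (w , d , h) → w , (d , λ i → cancel-e (trans (sym (lmul linF (ℕtoℚ e) w i)) (trans (lresp linF {ℕtoℚ e ⊙ w} {x ⊖ y} (λ j → sym (h j)) i)
            (trans (proj₂ (sub sΛF {x} {y} px py) i) (h i))))) , h)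
        (λ v (k , w , p , q , h) → k , p , resp (s· e sΛ∨) {w} {v ⊖ k} (λ i → sym (trans (cong (λ t → t ℚ.- k i) (h i)) ([x+y]-x≡y (k i) (w i)))) q)
        (card-tower sΛF (s· e sΛF) (s· e sΛ∨F) (·-⊆ e sΛF) (λ (w , (d , f) , h) → w , (dual⊆ w d , f) , h) cα fixed/scaled)

      S⊆KD : ∀ {v} → S e v → fixedModDual F B e 1 v
      S⊆KD {v} (k , w , (hk , fk) , (l , hl , ew) , h) = resp sΛ {k ⊕ w} {v} (λ i → sym (h i)) (add sΛ {k} {w} hk (·-⊆ e sΛ {w} (l , dual⊆ l hl , ew))) ,
        D l , D-Λ∨ l hl , λ i → trans (D-+K {v} {w} {k} (fixed⇒K fk) (λ j → trans (h j) (ℚP.+-comm (k j) (w j))) i) (trans (lresp linD ew i) (lmul linD (ℕtoℚ e) l i))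

      -- N is the product of the index β from `KD/S` and the order α·cFix from `S/scaled`, and β·Q =
      -- J.
      N₁-formula : ∀ {N Q α} → Card (fixedModDual F B e 1) (scaledDual B e) N → Card DΛ∨ (QS e) Q → Card (ΛF F) (e · ΛF F) α →
        N ℕ.* Q ≡ (α ℕ.* cFix) ℕ.* J
      N₁-formula {N} {Q} {α} cN cQ cα = go (Q-β e)
        where
        go : (∃ λ Q → ∃ λ β → Card DΛ∨ (QS e) Q × Card (QS e) (Λdual B +K) β × J ≡ Q ℕ.* β) → N ℕ.* Q ≡ (α ℕ.* cFix) ℕ.* J
        go (Q′ , β , cQ′ , cβ , eq) = begin
            N ℕ.* Q                            ≡⟨ cong₂ ℕ._*_ (card-unique (s· e sΛ∨) cN (card-tower (sKD e) (sS e) (s· e sΛ∨) S⊆KD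
                                                   (λ {v} p → 𝟎 , v , zer sΛF , p , λ i → sym (ℚP.+-identityˡ (v i))) (KD/S cβ) (S/scaled cα)))
                                                   (card-unique (sQS e) cQ cQ′) ⟩
            (β ℕ.* (α ℕ.* cFix)) ℕ.* Q′        ≡⟨ cong (ℕ._* Q′) (ℕP.*-comm β (α ℕ.* cFix)) ⟩
            ((α ℕ.* cFix) ℕ.* β) ℕ.* Q′        ≡⟨ ℕP.*-assoc (α ℕ.* cFix) β Q′ ⟩
            (α ℕ.* cFix) ℕ.* (β ℕ.* Q′)        ≡⟨ cong ((α ℕ.* cFix) ℕ.*_) (trans (ℕP.*-comm β Q′) (sym eq)) ⟩
            (α ℕ.* cFix) ℕ.* J                 ∎
          where open ≡-Reasoning

-- Dependence on f

tower-ratio : ∀ {N N₁ t A C a b} → N ≡ t ℕ.* N₁ → A ≡ C ℕ.* t → A ≡ a ℕ.* a → C ≡ b ℕ.* b → N ℕ.* (b ℕ.* b) ≡ N₁ ℕ.* (a ℕ.* a)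
tower-ratio {N} {N₁} {t} {A} {C} {a} {b} eN eA ea eb = begin
  N ℕ.* (b ℕ.* b)        ≡⟨ cong₂ ℕ._*_ eN (sym eb) ⟩
  (t ℕ.* N₁) ℕ.* C       ≡⟨ cong (ℕ._* C) (ℕP.*-comm t N₁) ⟩
  (N₁ ℕ.* t) ℕ.* C       ≡⟨ ℕP.*-assoc N₁ t C ⟩
  N₁ ℕ.* (t ℕ.* C)       ≡⟨ cong (N₁ ℕ.*_) (trans (ℕP.*-comm t C) (trans (sym eA) ea)) ⟩
  N₁ ℕ.* (a ℕ.* a)       ∎
  where open ≡-Reasoning

module Powers {n : ℕ} (F : IMat n) (B : QMat n) (G : IMat n)
  (FG : ∀ v → act F (act G v) ≐ v)
  (kerD² : KerDEqKerD² F) (symB : SymmetricForm B) (invB : FInvariant F B)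
  (dual⊆ : ∀ (v : V n) → Λdual B v → Λ v)
  {cLL : ℕ} (cΛ : Card Λ (Λdual B) cLL) (e : ℕ) (e>0 : e ℕ.> 0) where

  open Lattice F B G FG kerD² symB invB dual⊆
  open Indices F B G FG kerD² symB invB dual⊆

  P : ℕ → V n → V n
  P = actPow F

  linP : ∀ k → Linear (P k)
  linP = actPow-linear F

  P-+ : ∀ a b v → P (a ℕ.+ b) v ≡ P a (P b v)
  P-+ zero b v = refl
  P-+ (suc a) b v = cong Ft (P-+ a b v)

  P-comm : ∀ a b v → P a (P b v) ≡ P b (P a v)
  P-comm a b v = trans (sym (P-+ a b v)) (trans (cong (λ k → P k v) (ℕP.+-comm a b)) (P-+ b a v))

  P-Λ : ∀ k v → Λ v → Λ (P k v)
  P-Λ zero v h = h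
  P-Λ (suc k) v h = act-Λ F (P k v) (P-Λ k v h)

  P-isometry : ∀ k u v → pair B (P k u) (P k v) ≡ pair B u v
  P-isometry zero u v = refl
  P-isometry (suc k) u v = trans (invB (P k u) (P k v)) (P-isometry k u v)

  P-surjective : ∀ k l → Λ l → ∃ λ y → Λ y × P k y ≐ l
  P-surjective zero l h = l , h , λ _ → refl
  P-surjective (suc k) l h = let (y , hy , eq) = P-surjective k (act G l) (act-Λ G l h) in
    y , hy , λ i → trans (lresp linF eq i) (FG l i)

  eΛ∨ : Pred (V n)
  eΛ∨ = scaledDual B e

  seΛ∨ : Subgroup eΛ∨
  seΛ∨ = s· e sΛ∨

  eΛ∨⊆Λ : ∀ {v} → eΛ∨ v → Λ v
  eΛ∨⊆Λ {v} (w , d , h) = ·-⊆ e sΛ {v} (w , dual⊆ w d , h)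

  F-eΛ∨ : ∀ w → eΛ∨ w → eΛ∨ (Ft w)
  F-eΛ∨ w (l , d , h) = Ft l , F-Λ∨ l d , λ i → trans (lresp linF h i) (lmul linF (ℕtoℚ e) l i)

  P-eΛ∨ : ∀ k w → eΛ∨ w → eΛ∨ (P k w)
  P-eΛ∨ zero w p = p
  P-eΛ∨ (suc k) w p = F-eΛ∨ (P k w) (P-eΛ∨ k w p)

  ε : ℚ
  ε = proj₁ (inverse (ℕtoℚ e) (ℕtoℚ-≢0 e>0))

  εe : ε ℚ.* ℕtoℚ e ≡ 1ℚ
  εe = proj₂ (inverse (ℕtoℚ e) (ℕtoℚ-≢0 e>0))

  eΛ∨-intro : ∀ v → Λdual B (ε ⊙ v) → eΛ∨ v
  eΛ∨-intro v d = ε ⊙ v , d , λ i → sym (cancel-t {ℕtoℚ e} {ε} εe (v i))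

  eΛ∨-elim : ∀ v → eΛ∨ v → Λdual B (ε ⊙ v)
  eΛ∨-elim v (w , d , h) = resp sΛ∨ {w} {ε ⊙ v} (λ i → sym (trans (cong (ε ℚ.*_) (h i)) (cancel-τ {ℕtoℚ e} {ε} εe (w i)))) d

  eΛ∨? : ∀ v → Dec (eΛ∨ v)
  eΛ∨? v = cases (Λdual? B (ε ⊙ v))
    where
    cases : Dec (Λdual B (ε ⊙ v)) → Dec (eΛ∨ v)
    cases (yes d) = yes (eΛ∨-intro v d)
    cases (no ¬d) = no λ p → ¬d (eΛ∨-elim v p)

  Λ/eΛ∨ : Card Λ eΛ∨ (e ^ n ℕ.* cLL)
  Λ/eΛ∨ = card-tower sΛ (s· e sΛ) seΛ∨ (·-⊆ e sΛ) (λ (w , d , h) → w , dual⊆ w d , h) (·Λ-card e e>0)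
    (card-transfer sΛ∨ seΛ∨ (λ v _ → ℕtoℚ e ⊙ v) (λ v p → v , p , λ _ → refl)
      (λ x y _ _ d → x ⊖ y , d , λ i → sym (distribˡ-- (ℕtoℚ e) (x i) (y i)))
      (λ x y _ _ (w , d , h) → resp sΛ∨ {w} {x ⊖ y} (λ i → cancelˡ (ℕtoℚ e) (ℕtoℚ-≢0 e>0) (trans (sym (h i)) (sym (distribˡ-- (ℕtoℚ e) (x i) (y i))))) d)
      (λ v (w , p , h) → w , p , same seΛ∨ v (ℕtoℚ e ⊙ w) h)
      cΛ)

  Kernel : (V n → V n) → Pred (V n)
  Kernel Y v = Λ v × eΛ∨ (Y v)

  sKernel : ∀ {Y} → Linear Y → Subgroup (Kernel Y)
  sKernel Y = ∩-subgroup sΛ (preimage-subgroup seΛ∨ Y)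

  Kernel? : ∀ Y v → Λ v → Dec (Kernel Y v)
  Kernel? Y v h = cases (eΛ∨? (Y v))
    where
    cases : Dec (eΛ∨ (Y v)) → Dec (Kernel Y v)
    cases (yes p) = yes (h , p)
    cases (no ¬p) = no λ q → ¬p (proj₂ q)

  Λ/Kernel : ∀ {Y} → Linear Y → (∀ w → eΛ∨ w → eΛ∨ (Y w)) →
    ∃ λ i → ∃ λ j → Card Λ (Kernel Y) i × Card (Kernel Y) eΛ∨ j × e ^ n ℕ.* cLL ≡ i ℕ.* j
  Λ/Kernel {Y} lY stable = card-between sΛ (sKernel lY) seΛ∨ proj₁ (λ {v} p → eΛ∨⊆Λ p , stable v p) (Kernel? Y) Λ/eΛ∨

  -- S only reparametrises the second argument: being onto Λ it leaves the radical determined by Y,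
  -- and it may be chosen freely to make the form alternating.
  Kernel-square : ∀ {Y S} → Linear Y → Linear S → (∀ v → Λ v → Λ (S v)) → (∀ l → Λ l → ∃ λ y → Λ y × S y ≐ l) →
    (∀ v → pair B (Y v) (S v) ≡ 0ℚ) → ∀ {i} → Card Λ (Kernel Y) i → ∃ λ a → i ≡ a ℕ.* a
  Kernel-square {Y} {S} lY lS SΛ Ssur alt c = alternating-square sΛ (sKernel lY) (bilinear-∘ ε bl lY lS) rad
      (λ v _ → int-resp (sym (trans (cong (ε ℚ.*_) (alt v)) (ℚP.*-zeroʳ ε))) int-0) proj₁ c
    where
    rad : Radical Λ Λ (λ x y → ε ℚ.* pair B (Y x) (S y)) (Kernel Y)
    rad = record
      { sound = λ {v} {y} (_ , p) hy → int-resp (mulˡ bl ε (Y v) (S y)) (eΛ∨-elim (Y v) p (S y) (SΛ y hy))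
      ; wit = λ {v} hv ¬p → let (l , hl , ¬i) = Λdual-witness B (ε ⊙ Y v) (λ d → ¬p (hv , eΛ∨-intro (Y v) d))
                                (y , hy , eq) = Ssur l hl in
          y , hy , λ i → ¬i (int-resp (trans (sym (mulˡ bl ε (Y v) (S y))) (respʳ bl {u = ε ⊙ Y v} eq)) i) }

  P-1 : ℕ → V n → V n
  P-1 k v = P k v ⊖ v

  linP-1 : ∀ k → Linear (P-1 k)
  linP-1 k = ⊖-linear (linP k) id-linear

  P-1-stable : ∀ k w → eΛ∨ w → eΛ∨ (P-1 k w)
  P-1-stable k w p = sub seΛ∨ {P k w} {w} (P-eΛ∨ k w p) p

  -- Cancelling the isometry F^g gives (F^(2g)v, F^g v) = (F^g v, v), which is (v, F^g v) by
  -- symmetry.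
  even-alternating : ∀ g v → pair B (P-1 (g ℕ.+ g) v) (P g v) ≡ 0ℚ
  even-alternating g v = trans (subˡ bl (P (g ℕ.+ g) v) v (P g v)) (trans (cong (λ t → t ℚ.- pair B v (P g v))
    (trans (cong (λ t → pair B t (P g v)) (P-+ g g v)) (trans (P-isometry g (P g v) v) (symB (P g v) v)))) (ℚP.+-inverseʳ (pair B v (P g v))))

  Λ/fixed-even-square : ∀ g {i} → Card Λ (fixedModDual F B e (g ℕ.+ g)) i → ∃ λ a → i ≡ a ℕ.* a
  Λ/fixed-even-square g = Kernel-square (linP-1 (g ℕ.+ g)) (linP g) (P-Λ g) (P-surjective g) (even-alternating g)

  even-formula : ∀ g {N} → Card (fixedModDual F B e (g ℕ.+ g)) eΛ∨ N → ∃ λ a → a ℕ.> 0 × N ℕ.* (a ℕ.* a) ≡ e ^ n ℕ.* cLL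
  even-formula g {N} cN = go (Λ/Kernel (linP-1 (g ℕ.+ g)) (P-1-stable (g ℕ.+ g)))
    where
    finish : ∀ {i j} → i ℕ.> 0 → N ≡ j → e ^ n ℕ.* cLL ≡ i ℕ.* j → (∃ λ a → i ≡ a ℕ.* a) → ∃ λ a → a ℕ.> 0 × N ℕ.* (a ℕ.* a) ≡ e ^ n ℕ.* cLL
    finish {i} {j} i>0 N≡ eq (a , ea) = a , square-pos ea i>0 , trans (cong₂ ℕ._*_ N≡ (sym ea)) (trans (ℕP.*-comm j i) (sym eq))
    go : (∃ λ i → ∃ λ j → Card Λ (fixedModDual F B e (g ℕ.+ g)) i × Card (fixedModDual F B e (g ℕ.+ g)) eΛ∨ j × e ^ n ℕ.* cLL ≡ i ℕ.* j) →
      ∃ λ a → a ℕ.> 0 × N ℕ.* (a ℕ.* a) ≡ e ^ n ℕ.* cLL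
    go (i , j , ci , cj , eq) = finish (card->0 sΛ ci) (card-unique seΛ∨ cN cj) eq (Λ/fixed-even-square g ci)

  -- E = F + 1; for f = 2g + 1 one has F^f - 1 = D (1 + E Θ) with Θ = F + F³ + … + F^(2g-1).

  E : V n → V n
  E v = Ft v ⊕ v

  linE : Linear E
  linE = ⊕-linear linF id-linear

  E-eΛ∨ : ∀ w → eΛ∨ w → eΛ∨ (E w)
  E-eΛ∨ w p = add seΛ∨ {Ft w} {w} (F-eΛ∨ w p) p

  Θ : ℕ → V n → V n
  Θ zero v = 𝟎
  Θ (suc g) v = Θ g v ⊕ P (suc (g ℕ.+ g)) v

  linΘ : ∀ g → Linear (Θ g)
  linΘ zero = record { lresp = λ _ _ → refl ; lsub = λ _ _ _ → refl ; lmul = λ c _ _ → sym (ℚP.*-zeroʳ c) }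
  linΘ (suc g) = ⊕-linear (linΘ g) (linP (suc (g ℕ.+ g)))

  Θ-Λ : ∀ g v → Λ v → Λ (Θ g v)
  Θ-Λ zero v h = zer sΛ
  Θ-Λ (suc g) v h = add sΛ {Θ g v} {P (suc (g ℕ.+ g)) v} (Θ-Λ g v h) (P-Λ (suc (g ℕ.+ g)) v h)

  Θ-eΛ∨ : ∀ g v → eΛ∨ v → eΛ∨ (Θ g v)
  Θ-eΛ∨ zero v h = zer seΛ∨
  Θ-eΛ∨ (suc g) v h = add seΛ∨ {Θ g v} {P (suc (g ℕ.+ g)) v} (Θ-eΛ∨ g v h) (P-eΛ∨ (suc (g ℕ.+ g)) v h)

  P-Θ : ∀ k g v → P k (Θ g v) ≐ Θ g (P k v)
  P-Θ k zero v = lzero (linP k)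
  P-Θ k (suc g) v i = trans (ladd (linP k) (Θ g v) (P (suc (g ℕ.+ g)) v) i)
    (cong₂ ℚ._+_ (P-Θ k g v i) (cong (λ w → w i) (P-comm k (suc (g ℕ.+ g)) v)))

  P-E : ∀ k v → P k (E v) ≐ E (P k v)
  P-E k v i = trans (ladd (linP k) (Ft v) v i) (cong (λ t → t ℚ.+ P k v i) (cong (λ w → w i) (P-comm k 1 v)))

  D-E : ∀ v → D (E v) ≐ P-1 2 v
  D-E v i = trans (cong (λ t → t ℚ.- (Ft v i ℚ.+ v i)) (ladd linF (Ft v) v i)) (cancel-middle (Ft (Ft v) i) (Ft v i) (v i))

  -- A telescoping sum: DE = F² - 1, so each new term F^(2g+1) of Θ contributes F^(2g+3) - F^(2g+1).
  D-1+EΘ : ∀ g v → D (v ⊕ E (Θ g v)) ≐ P-1 (suc (g ℕ.+ g)) v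
  D-1+EΘ zero v i = lresp linD {v ⊕ E 𝟎} {v} (λ j → trans (cong (v j ℚ.+_) (lzero linE j)) (ℚP.+-identityʳ (v j))) i
  D-1+EΘ (suc g) v i = begin
    D (v ⊕ E (Θ g v ⊕ Q v)) i                     ≡⟨ lresp linD {v ⊕ E (Θ g v ⊕ Q v)} {(v ⊕ E (Θ g v)) ⊕ E (Q v)} (λ j → trans (cong (v j ℚ.+_) (ladd linE (Θ g v) (Q v) j)) (sym (ℚP.+-assoc (v j) (E (Θ g v) j) (E (Q v) j)))) i ⟩
    D ((v ⊕ E (Θ g v)) ⊕ E (Q v)) i               ≡⟨ ladd linD (v ⊕ E (Θ g v)) (E (Q v)) i ⟩
    D (v ⊕ E (Θ g v)) i ℚ.+ D (E (Q v)) i         ≡⟨ cong₂ ℚ._+_ (D-1+EΘ g v i) (D-E (Q v) i) ⟩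
    (Q v i ℚ.- v i) ℚ.+ (P 2 (Q v) i ℚ.- Q v i)   ≡⟨ [x-y]+[z-x]≡z-y (Q v i) (v i) (P 2 (Q v) i) ⟩
    P 2 (Q v) i ℚ.- v i                           ≡⟨ cong (λ k → P (suc (suc k)) v i ℚ.- v i) (sym (ℕP.+-suc g g)) ⟩
    P-1 (suc (suc g ℕ.+ suc g)) v i               ∎
    where
    open ≡-Reasoning
    Q : V n → V n
    Q = P (suc (g ℕ.+ g))

  -- F^(k+1) - 1 = F(F^k - 1) + D and eΛ∨ is F-stable: what F fixes modulo eΛ∨, its powers fix too.
  P-1-step : ∀ k v → eΛ∨ (D v) → eΛ∨ (P-1 k v)
  P-1-step zero v p = resp seΛ∨ {𝟎} {P-1 zero v} (λ i → sym (ℚP.+-inverseʳ (v i))) (zer seΛ∨)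
  P-1-step (suc k) v p = resp seΛ∨ {Ft (P-1 k v) ⊕ D v} {P-1 (suc k) v}
    (λ i → trans (cong (λ t → t ℚ.+ D v i) (lsub linF (P k v) v i)) ([x-y]+[y-z]≡x-z (Ft (P k v) i) (Ft v i) (v i)))
    (add seΛ∨ {Ft (P-1 k v)} {D v} (F-eΛ∨ (P-1 k v) (P-1-step k v p)) p)

  module Odd (g : ℕ) where

    f : ℕ
    f = suc (g ℕ.+ g)

    Y : V n → V n
    Y v = E (P-1 f v)

    linY : Linear Y
    linY = ∘-linear linE (linP-1 f)

    -- Y = F^(2g+2) - F + F^(2g+1) - 1, and S = F^(g+1) is half of its top exponent. By isometry and
    -- symmetry the first term cancels the last, (Sv, v) = (v, Sv), and the third cancels the
    -- second, both being (v, F^g v).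
    Y-alternating : ∀ v → pair B (Y v) (P (suc g) v) ≡ 0ℚ
    Y-alternating v = begin
      pair B (Ft (P-1 f v) ⊕ P-1 f v) S              ≡⟨ respˡ bl {y = S} (λ i → trans (sym (x-[0-y]≡x+y (Ft (P-1 f v) i) (P-1 f v i))) (cong (λ t → t ℚ.- (0ℚ ℚ.- P-1 f v i)) (lsub linF (P f v) v i))) ⟩
      pair B ((Ft (P f v) ⊖ Ft v) ⊖ (𝟎 ⊖ P-1 f v)) S  ≡⟨ subˡ bl (Ft (P f v) ⊖ Ft v) (𝟎 ⊖ P-1 f v) S ⟩
      pair B (Ft (P f v) ⊖ Ft v) S ℚ.- pair B (𝟎 ⊖ P-1 f v) S ≡⟨ cong₂ ℚ._-_ (subˡ bl (Ft (P f v)) (Ft v) S) (trans (respˡ bl {y = S} (λ i → 0-[x-y]≡y-x (P f v i) (v i))) (subˡ bl v (P f v) S)) ⟩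
      (pair B (Ft (P f v)) S ℚ.- pair B (Ft v) S) ℚ.- (pair B v S ℚ.- pair B (P f v) S) ≡⟨ cong₂ (λ s t → (s ℚ.- pair B (Ft v) S) ℚ.- (pair B v S ℚ.- t)) FPf Pf ⟩
      (pair B v S ℚ.- pair B (Ft v) S) ℚ.- (pair B v S ℚ.- pair B v (P g v)) ≡⟨ cong (λ t → (pair B v S ℚ.- t) ℚ.- (pair B v S ℚ.- pair B v (P g v))) (invB v (P g v)) ⟩
      (pair B v S ℚ.- pair B v (P g v)) ℚ.- (pair B v S ℚ.- pair B v (P g v)) ≡⟨ ℚP.+-inverseʳ (pair B v S ℚ.- pair B v (P g v)) ⟩
      0ℚ ∎
      where
      open ≡-Reasoning
      S : V n
      S = P (suc g) v
      FPf : pair B (Ft (P f v)) S ≡ pair B v S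
      FPf = trans (cong (λ w → pair B w S) (trans (cong (λ k → P (suc k) v) (sym (ℕP.+-suc g g))) (P-+ (suc g) (suc g) v))) (trans (P-isometry (suc g) S v) (symB S v))
      Pf : pair B (P f v) S ≡ pair B v (P g v)
      Pf = trans (cong (λ w → pair B w S) (P-+ (suc g) g v)) (trans (P-isometry (suc g) (P g v) v) (symB (P g v) v))

    Λ/Y-square : ∀ {i} → Card Λ (Kernel Y) i → ∃ λ a → i ≡ a ℕ.* a
    Λ/Y-square = Kernel-square linY (linP (suc g)) (P-Λ (suc g)) (P-surjective (suc g)) Y-alternating

    E-Λ : ∀ v → Λ v → Λ (E v)
    E-Λ v h = add sΛ {Ft v} {v} (act-Λ F v h) h

    Fixed : ℕ → Pred (V n)
    Fixed k = fixedModDual F B e k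

    Fixed-2⊆Y : ∀ {v} → Fixed 2 v → Kernel Y v
    Fixed-2⊆Y {v} (h , p) = h , resp seΛ∨ {P-1 f (E v)} {Y v} (λ i → trans (cong (λ t → t ℚ.- E v i) (P-E f v i)) (sym (lsub linE (P f v) v i)))
      (P-1-step f (E v) (resp seΛ∨ {P-1 2 v} {D (E v)} (λ i → sym (D-E v i)) p))

    -- E sends {x : Yx ∈ eΛ∨} into the vectors fixed by F^f modulo eΛ∨, as it commutes with F^f - 1.
    -- Since DE = F² - 1, the preimage of those fixed by F is exactly those fixed by F².
    Y/Fixed-2→ : ∀ {t} → Card (Kernel Y) (Fixed 2) t → Card (Fixed f) (Fixed 1) t
    Y/Fixed-2→ = card-transfer (sKernel (linP-1 2)) (sKernel (linP-1 1)) (λ x _ → E x)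
      (λ x (h , p) → E-Λ x h , resp seΛ∨ {Y x} {P-1 f (E x)} (λ i → trans (lsub linE (P f x) x i) (cong (λ t → t ℚ.- E x i) (sym (P-E f x i)))) p)
      (λ x y _ _ (h , p) → resp sΛ {E (x ⊖ y)} {E x ⊖ E y} (lsub linE x y) (E-Λ (x ⊖ y) h) ,
        resp seΛ∨ {P-1 2 (x ⊖ y)} {D (E x ⊖ E y)} (λ i → trans (sym (D-E (x ⊖ y) i)) (lresp linD (lsub linE x y) i)) p)
      (λ x y (hx , _) (hy , _) (h , p) → sub sΛ {x} {y} hx hy ,
        resp seΛ∨ {D (E x ⊖ E y)} {P-1 2 (x ⊖ y)} (λ i → trans (sym (lresp linD (lsub linE x y) i)) (D-E (x ⊖ y) i)) p)
      sur
      where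
      -- The preimage x = -Θv comes from 1 + EΘ: v - Ex = (1 + EΘ)v, and D of it is (F^f - 1)v ∈
      -- eΛ∨.
      sur : ∀ v → Fixed f v → ∃ λ x → Σ (Kernel Y x) λ _ → Fixed 1 (v ⊖ E x)
      sur v (h , p) = x , (hx , E-eΛ∨ (P-1 f x) (resp seΛ∨ {𝟎 ⊖ Θ g (P-1 f v)} {P-1 f x} shift (neg seΛ∨ {Θ g (P-1 f v)} (Θ-eΛ∨ g (P-1 f v) p)))) ,
          sub sΛ {v} {E x} h (E-Λ x hx) , resp seΛ∨ {P-1 f v} {D (v ⊖ E x)} (λ i → sym (trans (lresp linD v-Ex i) (D-1+EΘ g v i))) p
        where
        x : V n
        x = 𝟎 ⊖ Θ g v
        hx : Λ x
        hx = neg sΛ {Θ g v} (Θ-Λ g v h)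
        shift : 𝟎 ⊖ Θ g (P-1 f v) ≐ P-1 f x
        shift i = sym (trans (cong (λ t → t ℚ.- (0ℚ ℚ.- Θ g v i)) (trans (lsub (linP f) 𝟎 (Θ g v) i) (cong₂ ℚ._-_ (lzero (linP f) i) (P-Θ f g v i))))
          (trans (neg-diff (Θ g (P f v) i) (Θ g v i)) (cong (λ t → 0ℚ ℚ.- t) (sym (lsub (linΘ g) (P f v) v i)))))
        v-Ex : v ⊖ E x ≐ v ⊕ E (Θ g v)
        v-Ex i = trans (cong (λ t → v i ℚ.- t) (trans (lsub linE 𝟎 (Θ g v) i) (cong (λ t → t ℚ.- E (Θ g v) i) (lzero linE i)))) (x-[0-y]≡x+y (v i) (E (Θ g v) i))

    odd-formula : ∀ {N N₁} → Card (Fixed f) eΛ∨ N → Card (Fixed 1) eΛ∨ N₁ →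
      ∃ λ a → ∃ λ b → a ℕ.> 0 × b ℕ.> 0 × N ℕ.* (b ℕ.* b) ≡ N₁ ℕ.* (a ℕ.* a)
    odd-formula {N} {N₁} cN cN₁ = let (A , _ , cA , _) = Λ/Kernel (linP-1 2) (P-1-stable 2) in
        go cA (card-between sΛ (sKernel linY) (sKernel (linP-1 2)) proj₁ Fixed-2⊆Y (Kernel? Y) cA)
      where
      Goal : Set
      Goal = ∃ λ a → ∃ λ b → a ℕ.> 0 × b ℕ.> 0 × N ℕ.* (b ℕ.* b) ≡ N₁ ℕ.* (a ℕ.* a)
      finish : ∀ {A C t} → A ℕ.> 0 → C ℕ.> 0 → N ≡ t ℕ.* N₁ → A ≡ C ℕ.* t → (∃ λ a → A ≡ a ℕ.* a) → (∃ λ b → C ≡ b ℕ.* b) → Goal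
      finish {A} {C} {t} A>0 C>0 eN eA (a , ea) (b , eb) = a , b , square-pos ea A>0 , square-pos eb C>0 , tower-ratio {N} {N₁} {t} {A} {C} {a} {b} eN eA ea eb
      go : ∀ {A} → Card Λ (Fixed 2) A → (∃ λ C → ∃ λ t → Card Λ (Kernel Y) C × Card (Kernel Y) (Fixed 2) t × A ≡ C ℕ.* t) → Goal
      go cA (C , t , cC , ct , eq) = finish (card->0 sΛ cA) (card->0 sΛ cC)
        (card-unique seΛ∨ cN (card-tower (sKernel (linP-1 f)) (sKernel (linP-1 1)) seΛ∨ (λ {v} (h , p) → h , P-1-step f v p) (λ {v} p → eΛ∨⊆Λ p , P-1-stable 1 v p) (Y/Fixed-2→ ct) cN₁))
        eq (Λ/fixed-even-square 1 cA) (Λ/Y-square cC)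

-- Square classes and assembly of the three cases

ratio⇒SqEquiv : ∀ {X Y a b} → a ℕ.> 0 → b ℕ.> 0 → X ℕ.* (b ℕ.* b) ≡ Y ℕ.* (a ℕ.* a) → SqEquiv (ℕtoℚ X) (ℕtoℚ Y)
ratio⇒SqEquiv {X} {Y} {a} {b} a>0 b>0 h = ℕtoℚ a ℚ.* β , q≢0 , ratio-identity (ℕtoℚ X) (ℕtoℚ Y) (ℕtoℚ a) (ℕtoℚ b) β βb
    (trans (sym (square X b)) (trans (cong ℕtoℚ h) (square Y a)))
  where
  β : ℚ
  β = proj₁ (inverse (ℕtoℚ b) (ℕtoℚ-≢0 b>0))
  βb : β ℚ.* ℕtoℚ b ≡ 1ℚ
  βb = proj₂ (inverse (ℕtoℚ b) (ℕtoℚ-≢0 b>0))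
  square : ∀ x c → ℕtoℚ (x ℕ.* (c ℕ.* c)) ≡ ℕtoℚ x ℚ.* (ℕtoℚ c ℚ.* ℕtoℚ c)
  square x c = trans (ℕtoℚ-* x (c ℕ.* c)) (cong (ℕtoℚ x ℚ.*_) (ℕtoℚ-* c c))
  q≢0 : ¬ (ℕtoℚ a ℚ.* β ≡ 0ℚ)
  q≢0 e = ℕtoℚ-≢0 a>0 (trans (sym (ℚP.*-identityʳ (ℕtoℚ a))) (trans (cong (ℕtoℚ a ℚ.*_) (sym βb))
    (trans (sym (ℚP.*-assoc (ℕtoℚ a) β (ℕtoℚ b))) (trans (cong (ℚ._* ℕtoℚ b) e) (ℚP.*-zeroˡ (ℕtoℚ b))))))

-- Here N₁ is the count for f = 1, Q stands for Q_e, I for p(1) and α for e^r. The pairs a, b and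
-- a′, b′ record the square factors relating |𝔅| to Q and N to N₁.
odd-odd : ∀ {N N₁ Q cB cT cFix J I α a b a′ b′} → N₁ ℕ.* Q ≡ (α ℕ.* cFix) ℕ.* J → I ≡ cT ℕ.* J →
  cB ℕ.* (b ℕ.* b) ≡ Q ℕ.* (a ℕ.* a) → N ℕ.* (b′ ℕ.* b′) ≡ N₁ ℕ.* (a′ ℕ.* a′) →
  (N ℕ.* (cB ℕ.* cT)) ℕ.* ((b ℕ.* b′) ℕ.* (b ℕ.* b′)) ≡ (cFix ℕ.* (I ℕ.* α)) ℕ.* ((a ℕ.* a′) ℕ.* (a ℕ.* a′))
odd-odd {N} {N₁} {Q} {cB} {cT} {cFix} {J} {I} {α} {a} {b} {a′} {b′} h₁ hI hQ hN = begin
  (N ℕ.* (cB ℕ.* cT)) ℕ.* ((b ℕ.* b′) ℕ.* (b ℕ.* b′))      ≡⟨ solve 5 (λ N cB cT b b′ → (N :* (cB :* cT)) :* ((b :* b′) :* (b :* b′)) := ((N :* (b′ :* b′)) :* (cB :* (b :* b))) :* cT) refl N cB cT b b′ ⟩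
  ((N ℕ.* (b′ ℕ.* b′)) ℕ.* (cB ℕ.* (b ℕ.* b))) ℕ.* cT      ≡⟨ cong₂ (λ s t → (s ℕ.* t) ℕ.* cT) hN hQ ⟩
  ((N₁ ℕ.* (a′ ℕ.* a′)) ℕ.* (Q ℕ.* (a ℕ.* a))) ℕ.* cT      ≡⟨ solve 5 (λ N Q cT a a′ → ((N :* (a′ :* a′)) :* (Q :* (a :* a))) :* cT := ((N :* Q) :* cT) :* ((a :* a′) :* (a :* a′))) refl N₁ Q cT a a′ ⟩
  ((N₁ ℕ.* Q) ℕ.* cT) ℕ.* ((a ℕ.* a′) ℕ.* (a ℕ.* a′))      ≡⟨ cong (λ s → (s ℕ.* cT) ℕ.* ((a ℕ.* a′) ℕ.* (a ℕ.* a′))) h₁ ⟩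
  (((α ℕ.* cFix) ℕ.* J) ℕ.* cT) ℕ.* ((a ℕ.* a′) ℕ.* (a ℕ.* a′)) ≡⟨ cong (ℕ._* ((a ℕ.* a′) ℕ.* (a ℕ.* a′))) (solve 4 (λ α c J T → ((α :* c) :* J) :* T := c :* ((T :* J) :* α)) refl α cFix J cT) ⟩
  (cFix ℕ.* ((cT ℕ.* J) ℕ.* α)) ℕ.* ((a ℕ.* a′) ℕ.* (a ℕ.* a′)) ≡⟨ cong (λ s → (cFix ℕ.* (s ℕ.* α)) ℕ.* ((a ℕ.* a′) ℕ.* (a ℕ.* a′))) (sym hI) ⟩
  (cFix ℕ.* (I ℕ.* α)) ℕ.* ((a ℕ.* a′) ℕ.* (a ℕ.* a′))     ∎
  where
  open ≡-Reasoning
  open ℕS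

even-odd : ∀ {N N₁ Q cT cFix J I α a a′ b′} → N₁ ℕ.* Q ≡ (α ℕ.* cFix) ℕ.* J → I ≡ cT ℕ.* J →
  Q ≡ a ℕ.* a → N ℕ.* (b′ ℕ.* b′) ≡ N₁ ℕ.* (a′ ℕ.* a′) →
  (N ℕ.* cT) ℕ.* ((a ℕ.* b′) ℕ.* (a ℕ.* b′)) ≡ (cFix ℕ.* (I ℕ.* α)) ℕ.* (a′ ℕ.* a′)
even-odd {N} {N₁} {Q} {cT} {cFix} {J} {I} {α} {a} {a′} {b′} h₁ hI hQ hN = begin
  (N ℕ.* cT) ℕ.* ((a ℕ.* b′) ℕ.* (a ℕ.* b′))       ≡⟨ solve 4 (λ N cT a b′ → (N :* cT) :* ((a :* b′) :* (a :* b′)) := ((N :* (b′ :* b′)) :* (a :* a)) :* cT) refl N cT a b′ ⟩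
  ((N ℕ.* (b′ ℕ.* b′)) ℕ.* (a ℕ.* a)) ℕ.* cT       ≡⟨ cong₂ (λ s t → (s ℕ.* t) ℕ.* cT) hN (sym hQ) ⟩
  ((N₁ ℕ.* (a′ ℕ.* a′)) ℕ.* Q) ℕ.* cT              ≡⟨ solve 4 (λ N Q cT a′ → ((N :* (a′ :* a′)) :* Q) :* cT := ((N :* Q) :* cT) :* (a′ :* a′)) refl N₁ Q cT a′ ⟩
  ((N₁ ℕ.* Q) ℕ.* cT) ℕ.* (a′ ℕ.* a′)              ≡⟨ cong (λ s → (s ℕ.* cT) ℕ.* (a′ ℕ.* a′)) h₁ ⟩
  (((α ℕ.* cFix) ℕ.* J) ℕ.* cT) ℕ.* (a′ ℕ.* a′)    ≡⟨ cong (ℕ._* (a′ ℕ.* a′)) (solve 4 (λ α c J T → ((α :* c) :* J) :* T := c :* ((T :* J) :* α)) refl α cFix J cT) ⟩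
  (cFix ℕ.* ((cT ℕ.* J) ℕ.* α)) ℕ.* (a′ ℕ.* a′)    ≡⟨ cong (λ s → (cFix ℕ.* (s ℕ.* α)) ℕ.* (a′ ℕ.* a′)) (sym hI) ⟩
  (cFix ℕ.* (I ℕ.* α)) ℕ.* (a′ ℕ.* a′)             ∎
  where
  open ≡-Reasoning
  open ℕS

¬2∣⇒odd : ∀ k → ¬ (2 ∣ k) → ∃ λ q → k ≡ 1 ℕ.+ q ℕ.* 2
¬2∣⇒odd k ¬d = k ℕ./ 2 , cases (k ℕ.% 2) refl (ℕDM.m%n<n k 2)
  where
  cases : ∀ r → k ℕ.% 2 ≡ r → r ℕ.< 2 → k ≡ 1 ℕ.+ (k ℕ./ 2) ℕ.* 2
  cases zero e _ = ⊥-elim (¬d (ℕD.m%n≡0⇒n∣m k 2 e))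
  cases (suc zero) e _ = trans (ℕDM.m≡m%n+[m/n]*n k 2) (cong (ℕ._+ (k ℕ./ 2) ℕ.* 2) e)
  cases (suc (suc r)) _ (ℕ.s≤s (ℕ.s≤s ()))

q*2≡q+q : ∀ q → q ℕ.* 2 ≡ q ℕ.+ q
q*2≡q+q = ℕS.solve 1 (λ q → q :* con 2 := q :+ q) refl
  where open ℕS

HasCard⇒Card : ∀ {n} {A B : Pred (V n)} {k} → HasCard A B k → Card A B k
HasCard⇒Card (r , r∈ , cov , inj) = card r r∈ cov inj

module Assembly {n : ℕ} (F : IMat n) (B : QMat n) (G : IMat n)
  (FG : ∀ v → act F (act G v) ≐ v)
  (kerD² : KerDEqKerD² F) (symB : SymmetricForm B) (invB : FInvariant F B)
  (dual⊆ : ∀ (v : V n) → Λdual B v → Λ v) where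

  open Lattice F B G FG kerD² symB invB dual⊆
  open Indices F B G FG kerD² symB invB dual⊆
  open Formula F B G FG kerD² symB invB dual⊆

  -- At m = 0 the operator m - D is -D, hence the change of sign of x here and in the converse.
  ImK⇒DImage : ∀ {v} → ImK F (+ 0) v → DImage v
  ImK⇒DImage {v} (x , κ , kκ , h) = 𝟎 ⊖ ι x , ι κ , neg sΛ {ι x} (Λ-ι x) ,
    (Λ-ι κ , λ i → trans (actD-ι F κ i) (cong toℚ (kκ i))) ,
    λ i → trans (h i) (trans (toℚ-+ (((+ 0) ∙-D[ F ] x) i) (κ i)) (cong (ℚ._+ toℚ (κ i))
      (trans (toℚ-- (+ 0 ℤ.* x i) (Dℤ F x i)) (trans (cong₂ (λ s t → toℚ s ℚ.- t) (ℤP.*-zeroˡ (x i)) (sym (actD-ι F x i)))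
        (sym (trans (lsub linD 𝟎 (ι x) i) (cong (λ t → t ℚ.- D (ι x) i) (lzero linD i))))))))

  Ker-coords : ∀ {v} (hv : Λ v) → K v → Ker F (λ i → proj₁ (hv i))
  Ker-coords {v} hv kv i = toℚ-injective {Dℤ F (λ i → proj₁ (hv i)) i} {+ 0} (trans (sym (actD-ι F (λ i → proj₁ (hv i)) i))
    (trans (lresp linD {ι (λ i → proj₁ (hv i))} {v} (λ j → sym (proj₂ (hv j))) i) (kv i)))

  DImage⇒ImK : ∀ {v} → DImage v → ImK F (+ 0) v
  DImage⇒ImK {v} (u , c , hu , (hc , kc) , h) = x , κ , Ker-coords hc kc ,
      λ i → trans (h i) (trans (cong₂ ℚ._+_ (Du i) (proj₂ (hc i))) (sym (toℚ-+ (((+ 0) ∙-D[ F ] x) i) (κ i))))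
    where
    y κ x : Fin n → ℤ
    y i = proj₁ (hu i)
    κ i = proj₁ (hc i)
    x i = + 0 ℤ.- (+ 1) ℤ.* y i
    Dx : ∀ i → ((+ 0) ∙-D[ F ] x) i ≡ Dℤ F y i
    Dx i = trans (lin (∙-D-functional F (+ 0) i) (λ _ → + 0) (+ 1) y) (trans (cong (λ t → t ℤ.- (+ 1) ℤ.* ((+ 0) ∙-D[ F ] y) i) (functional-0 (∙-D-functional F (+ 0) i)))
      (shape (y i) (Dℤ F y i)))
      where
      open ℤS
      shape : ∀ y d → + 0 ℤ.- (+ 1) ℤ.* (+ 0 ℤ.* y ℤ.- d) ≡ d
      shape = ℤS.solve 2 (λ y d → con (+ 0) :- con (+ 1) :* (con (+ 0) :* y :- d) := d) refl
    Du : ∀ i → D u i ≡ toℚ (((+ 0) ∙-D[ F ] x) i)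
    Du i = trans (lresp linD {u} {ι y} (λ j → proj₂ (hu j)) i) (trans (actD-ι F y i) (cong toℚ (sym (Dx i))))

  DImage-card : ∀ {k} → Card Λ (ImK F (+ 0)) k → Card Λ DImage k
  DImage-card = card-cong (ImK-subgroup F (+ 0)) sDImage (λ p → p) (λ p → p) ImK⇒DImage DImage⇒ImK

  module _ (ad : Adapted (λ i x → Dℤ F x i)) where
    open AdaptedBasis F ad

    ΛF/eΛF : ∀ e {k} → Card KerΛ (MultK (+ e)) k → Card (ΛF F) (e · ΛF F) k
    ΛF/eΛF e = card-cong (MultK-subgroup (+ e)) (s· e sΛF) toΛF fromΛF
      (λ (x , kx , h) → ι x , toΛF (x , kx , λ _ → refl) , λ i → trans (h i) (toℚ-* (+ e) (x i)))
      (λ (w , (hw , fw) , h) → (λ i → proj₁ (hw i)) , Ker-coords hw (fixed⇒K fw) ,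
        λ i → trans (h i) (trans (cong (ℕtoℚ e ℚ.*_) (proj₂ (hw i))) (sym (toℚ-* (+ e) (proj₁ (hw i))))))
      where
      toΛF : ∀ {v} → KerΛ v → ΛF F v
      toΛF {v} (x , kx , h) = resp sΛF {ι x} {v} (λ i → sym (h i)) (Λ-ι x , K⇒fixed (λ i → trans (actD-ι F x i) (cong toℚ (kx i))))
      fromΛF : ∀ {v} → ΛF F v → KerΛ v
      fromΛF (hv , fv) = (λ i → proj₁ (hv i)) , Ker-coords hv (fixed⇒K fv) , λ i → proj₂ (hv i)

  -- The second isomorphism theorem: (Λ + D⁻¹Λ∨)/(Λ + ker D) is D⁻¹Λ∨ modulo its intersection with Λ
  -- + ker D, and that intersection is `QS 1`.
  𝔅-card : ∀ {k} → Card (ΛplusDinvDual F B) (ΛplusKerD F) k → Card DΛ∨ (QS 1) k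
  𝔅-card = card-transfer (s+K sΛ) (sQS 1) g (λ v (a , b , _ , d , _) → d) to from sur
    where
    g : ∀ v → ΛplusDinvDual F B v → V n
    g v (a , b , _) = b
    diff : ∀ v v′ (p : ΛplusDinvDual F B v) (p′ : ΛplusDinvDual F B v′) → g v p ⊖ g v′ p′ ≐ (v ⊖ v′) ⊖ (proj₁ p ⊖ proj₁ p′)
    diff v v′ (a , b , _ , _ , h) (a′ , b′ , _ , _ , h′) i = difference-of-sums (v i) (a i) (b i) (v′ i) (a′ i) (b′ i) (h i) (h′ i)
    Λa : ∀ v v′ (p : ΛplusDinvDual F B v) (p′ : ΛplusDinvDual F B v′) → (Λ +K) (proj₁ p ⊖ proj₁ p′)
    Λa v v′ (a , _ , ha , _) (a′ , _ , ha′ , _) = +K-base {Λ} {a ⊖ a′} (sub sΛ {a} {a′} ha ha′)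
    to : ∀ v v′ p p′ → (Λ +K) (v ⊖ v′) → QS 1 (g v p ⊖ g v′ p′)
    to v v′ p@(_ , b , _ , d , _) p′@(_ , b′ , _ , d′ , _) q = sub sDΛ∨ {b} {b′} d d′ ,
      resp (s+K sΛ) {(v ⊖ v′) ⊖ (proj₁ p ⊖ proj₁ p′)} {ℕtoℚ 1 ⊙ (b ⊖ b′)} (λ i → trans (sym (diff v v′ p p′ i)) (sym (ℚP.*-identityˡ (b i ℚ.- b′ i))))
        (sub (s+K sΛ) {v ⊖ v′} {proj₁ p ⊖ proj₁ p′} q (Λa v v′ p p′))
    from : ∀ v v′ p p′ → QS 1 (g v p ⊖ g v′ p′) → (Λ +K) (v ⊖ v′)
    from v v′ p@(_ , b , _) p′@(_ , b′ , _) (_ , q) = split (s+K sΛ) (v ⊖ v′) (proj₁ p ⊖ proj₁ p′)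
      (resp (s+K sΛ) {ℕtoℚ 1 ⊙ (b ⊖ b′)} {(v ⊖ v′) ⊖ (proj₁ p ⊖ proj₁ p′)} (λ i → trans (ℚP.*-identityˡ (b i ℚ.- b′ i)) (diff v v′ p p′ i)) q) (Λa v v′ p p′)
    sur : ∀ u → DΛ∨ u → ∃ λ v → Σ (ΛplusDinvDual F B v) λ p → QS 1 (u ⊖ g v p)
    sur u d = u , (𝟎 , u , zer sΛ , d , λ i → sym (ℚP.+-identityˡ (u i))) , self (sQS 1) u

  -- DΛ + Λ^F lies inside the denominator of T_D(Λ), so its index in Λ is |T_D(Λ)| times an index
  -- that D⁻¹ turns into J. This also proves that J is finite.
  J-card : ∀ {I cT} → Card Λ (TDsub F) cT → Card Λ DImage I → ∃ λ J → Card DΛ (Λ +K) J × I ≡ cT ℕ.* J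
  J-card {I} {cT} cTD cI = go (card-between sΛ sTD sDImage TD⊆Λ DImage⊆TD (card-dec sΛ sTD cTD) cI)
    where
    go : (∃ λ i → ∃ λ j → Card Λ (TDsub F) i × Card (TDsub F) DImage j × I ≡ i ℕ.* j) → ∃ λ J → Card DΛ (Λ +K) J × I ≡ cT ℕ.* J
    go (i , j , ci , cj , eq) = j , DΛ/[Λ+K] cj , trans eq (cong (ℕ._* j) (card-unique sTD ci cTD))

  module Main {I J cT cLL cFix cB r : ℕ} (cJ : Card DΛ (Λ +K) J) (I≡ : I ≡ cT ℕ.* J) (cΛ : Card Λ (Λdual B) cLL)
    (cardFix : Card (ΛF F) (ΛdualF F B) cFix) (card𝔅 : Card DΛ∨ (QS 1) cB)
    (cα : ∀ e → e ℕ.> 0 → Card (ΛF F) (e · ΛF F) (e ^ r)) (e : ℕ) (e>0 : e ℕ.> 0) where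
    open WithCards cJ cΛ cardFix
    open Scaled e e>0
    open Powers F B G FG kerD² symB invB dual⊆ cΛ e e>0 hiding (ε; εe)

    target : ℕ
    target = cFix ℕ.* (I ℕ.* e ^ r)

    -- The given cardinality concerns F^f, so the count for F itself has to be obtained from the
    -- finite group Λ/eΛ∨.
    N₁-card : ∃ λ N₁ → Card (fixedModDual F B e 1) (scaledDual B e) N₁
    N₁-card = let (_ , j , _ , cj , _) = Λ/Kernel (linP-1 1) (P-1-stable 1) in j , cj

    odd-odd-case : ∀ q q′ {f N} → e ≡ 1 ℕ.+ q ℕ.* 2 → f ≡ suc (q′ ℕ.+ q′) → Card (fixedModDual F B e f) (scaledDual B e) N →
      SqEquiv (ℕtoℚ (N ℕ.* (cB ℕ.* cT))) (ℕtoℚ target)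
    odd-odd-case q q′ {N = N} e≡ refl cN = go N₁-card (Q-β e)
      where
      finish : ∀ {N₁ Q} → N₁ ℕ.* Q ≡ (e ^ r ℕ.* cFix) ℕ.* J →
        (∃ λ a → ∃ λ b → a ℕ.> 0 × b ℕ.> 0 × cB ℕ.* (b ℕ.* b) ≡ Q ℕ.* (a ℕ.* a)) →
        (∃ λ a → ∃ λ b → a ℕ.> 0 × b ℕ.> 0 × N ℕ.* (b ℕ.* b) ≡ N₁ ℕ.* (a ℕ.* a)) → SqEquiv (ℕtoℚ (N ℕ.* (cB ℕ.* cT))) (ℕtoℚ target)
      finish {N₁} {Q} h₁ (a , b , a>0 , b>0 , hQ) (a′ , b′ , a′>0 , b′>0 , hN) =
        ratio⇒SqEquiv {N ℕ.* (cB ℕ.* cT)} {target} {a ℕ.* a′} {b ℕ.* b′} (ℕP.*-mono-≤ a>0 a′>0) (ℕP.*-mono-≤ b>0 b′>0)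
          (odd-odd {N} {N₁} {Q} {cB} {cT} {cFix} {J} {I} {e ^ r} {a} {b} {a′} {b′} h₁ I≡ hQ hN)
      go : (∃ λ N₁ → Card (fixedModDual F B e 1) (scaledDual B e) N₁) →
        (∃ λ Q → ∃ λ β → Card DΛ∨ (QS e) Q × Card (QS e) (Λdual B +K) β × J ≡ Q ℕ.* β) → SqEquiv (ℕtoℚ (N ℕ.* (cB ℕ.* cT))) (ℕtoℚ target)
      go (N₁ , cN₁) (Q , _ , cQ , _) = finish {N₁} {Q} (N₁-formula cN₁ cQ (cα e e>0)) (Q-odd q e≡ card𝔅 cQ) (Odd.odd-formula q′ cN cN₁)

    even-odd-case : ∀ q q′ {f N} → e ≡ 2 ℕ.* q → f ≡ suc (q′ ℕ.+ q′) → Card (fixedModDual F B e f) (scaledDual B e) N →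
      SqEquiv (ℕtoℚ (N ℕ.* cT)) (ℕtoℚ target)
    even-odd-case q q′ {N = N} e≡ refl cN = go N₁-card (Q-β e)
      where
      finish : ∀ {N₁ Q} → Q ℕ.> 0 → N₁ ℕ.* Q ≡ (e ^ r ℕ.* cFix) ℕ.* J → (∃ λ a → Q ≡ a ℕ.* a) →
        (∃ λ a → ∃ λ b → a ℕ.> 0 × b ℕ.> 0 × N ℕ.* (b ℕ.* b) ≡ N₁ ℕ.* (a ℕ.* a)) → SqEquiv (ℕtoℚ (N ℕ.* cT)) (ℕtoℚ target)
      finish {N₁} {Q} Q>0 h₁ (a , hQ) (a′ , b′ , a′>0 , b′>0 , hN) =
        ratio⇒SqEquiv {N ℕ.* cT} {target} {a′} {a ℕ.* b′} a′>0 (ℕP.*-mono-≤ (square-pos {Q} {a} hQ Q>0) b′>0)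
          (even-odd {N} {N₁} {Q} {cT} {cFix} {J} {I} {e ^ r} {a} {a′} {b′} h₁ I≡ hQ hN)
      go : (∃ λ N₁ → Card (fixedModDual F B e 1) (scaledDual B e) N₁) →
        (∃ λ Q → ∃ λ β → Card DΛ∨ (QS e) Q × Card (QS e) (Λdual B +K) β × J ≡ Q ℕ.* β) → SqEquiv (ℕtoℚ (N ℕ.* cT)) (ℕtoℚ target)
      go (N₁ , cN₁) (Q , _ , cQ , _) = finish {N₁} {Q} (card->0 sDΛ∨ cQ) (N₁-formula cN₁ cQ (cα e e>0))
        (Q-square q (subst (λ k → Card DΛ∨ (QS k) Q) e≡ cQ)) (Odd.odd-formula q′ cN cN₁)

    even-case : ∀ q {f N} → f ≡ q ℕ.+ q → Card (fixedModDual F B e f) (scaledDual B e) N → SqEquiv (ℕtoℚ N) (ℕtoℚ (cLL ℕ.* e ^ n))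
    even-case q {N = N} refl cN = let (a , a>0 , h) = even-formula q cN in
      ratio⇒SqEquiv {N} {cLL ℕ.* e ^ n} {1} {a} (ℕ.s≤s ℕ.z≤n) a>0 (trans h (trans (ℕP.*-comm (e ^ n) cLL) (sym (ℕP.*-identityʳ (cLL ℕ.* e ^ n)))))

theorem2p4p4 : ∀ (n : ℕ) (F : IMat n) (B : QMat n) →
    IsAut F → KerDEqKerD² F →
    SymmetricForm B → NonDegenerate B → FInvariant F B →
    (∀ (v : V n) → Λdual B v → Λ v) →
    ∀ (s : ℤ) (r : ℕ) (p : Poly) →
    (s ≡ + 1 ⊎ s ≡ -[1+ 0 ]) →
    charPoly F ≈P (constP s *P (((XP +P constP -[1+ 0 ]) ^P r) *P p)) →
    evalP p (+ 1) ℤ.> + 0 →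
    ∀ (e f : ℕ) → e > 0 → f > 0 →
    ∀ (N cFix cB cT cLL : ℕ) →
    HasCard (fixedModDual F B e f) (scaledDual B e) N →
    HasCard (ΛF F) (ΛdualF F B) cFix →
    HasCard (ΛplusDinvDual F B) (ΛplusKerD F) cB →
    HasCard Λ (TDsub F) cT →
    HasCard Λ (Λdual B) cLL →
    (¬ (2 ∣ e) → ¬ (2 ∣ f) →
    SqEquiv (ℕtoℚ N ℚ.* (ℕtoℚ cB ℚ.* ℕtoℚ cT))
    (ℕtoℚ cFix ℚ.* (toℚ (evalP p (+ 1)) ℚ.* ℕtoℚ (e ^ r)))) ×
    (2 ∣ e → ¬ (2 ∣ f) →
    SqEquiv (ℕtoℚ N ℚ.* ℕtoℚ cT)
    (ℕtoℚ cFix ℚ.* (toℚ (evalP p (+ 1)) ℚ.* ℕtoℚ (e ^ r)))) ×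
    (2 ∣ f →
    SqEquiv (ℕtoℚ N) (ℕtoℚ cLL ℚ.* ℕtoℚ (e ^ n)))
theorem2p4p4 n F B (G , FG , _) kerD² symB _ invB dual⊆ s r p s-unit char p>0 e f e>0 _ N cFix cB cT cLL hN hFix hB hT hLL =
    (λ ¬e ¬f → let (q , e≡) = ¬2∣⇒odd e ¬e ; (q′ , f≡) = ¬2∣⇒odd f ¬f in
      subst₂ SqEquiv (trans (ℕtoℚ-* N (cB ℕ.* cT)) (cong (ℕtoℚ N ℚ.*_) (ℕtoℚ-* cB cT))) target≡
        (M.odd-odd-case q q′ e≡ (trans f≡ (cong suc (q*2≡q+q q′))) (HasCard⇒Card hN))) ,
    (λ { (divides q e≡) ¬f → let (q′ , f≡) = ¬2∣⇒odd f ¬f in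
      subst₂ SqEquiv (ℕtoℚ-* N cT) target≡
        (M.even-odd-case q q′ (trans e≡ (ℕP.*-comm q 2)) (trans f≡ (cong suc (q*2≡q+q q′))) (HasCard⇒Card hN)) }) ,
    (λ { (divides q f≡) → subst (SqEquiv (ℕtoℚ N)) (ℕtoℚ-* cLL (e ^ n))
        (M.even-case q (trans f≡ (q*2≡q+q q)) (HasCard⇒Card hN)) })
  where
  FG′ : ∀ v → act F (act G v) ≐ v
  FG′ = act-inverse F G FG
  module A = Assembly F B G FG′ kerD² symB invB dual⊆
  module L = Lattice F B G FG′ kerD² symB invB dual⊆
  ad : Adapted (λ i x → Dℤ F x i)
  ad = adapted (λ i x → Dℤ F x i) (Dℤ-functional F)
  module C = CharPoly F ad L.Ker-D² s r p s-unit char p>0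
  J : ∃ λ J → Card L.DΛ (Λ L.+K) J × ∣ evalP p (+ 1) ∣ ≡ cT ℕ.* J
  J = A.J-card (HasCard⇒Card hT) (A.DImage-card C.image-card)
  module M = A.Main {cT = cT} {r = r} (proj₁ (proj₂ J)) (proj₂ (proj₂ J)) (HasCard⇒Card hLL) (HasCard⇒Card hFix) (A.𝔅-card (HasCard⇒Card hB))
    (λ e e>0 → A.ΛF/eΛF ad e (C.kernel-card e e>0)) e e>0
  -- The index computations yield ∣p(1)∣; positivity of p(1) removes the absolute value.
  target≡ : ℕtoℚ (cFix ℕ.* (∣ evalP p (+ 1) ∣ ℕ.* e ^ r)) ≡ ℕtoℚ cFix ℚ.* (toℚ (evalP p (+ 1)) ℚ.* ℕtoℚ (e ^ r))
  target≡ = trans (ℕtoℚ-* cFix (∣ evalP p (+ 1) ∣ ℕ.* e ^ r)) (cong (ℕtoℚ cFix ℚ.*_) (trans (ℕtoℚ-* ∣ evalP p (+ 1) ∣ (e ^ r))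
    (cong (λ t → toℚ t ℚ.* ℕtoℚ (e ^ r)) (ℤP.0≤i⇒+∣i∣≡i (ℤP.<⇒≤ p>0)))))
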